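{- Let $n\geq k\geq 4$ be integers. Then \[ S_k(n)=\begin{cases} 40 & \text{if } n=k=4,\\ 2^{t_{k-1}(n)} & \text{if } n\geq 5 \text{ or } k\geq 5.\end{cases} \] Furthermore, $K_4$ is the only $4$-vertex graph $G$ with $S_4(G)=S_4(4)$, and if $n\geq 5$ or $k\geq 5$, then the Tur\'an graph $T_{k-1}(n)$ is the only $n$-vertex graph $G$ (up to isomorphism) with $S_k(G)=S_k(n)$.
   Context: All graphs are finite and simple. An orientation of a graph $G$ assigns a direction to every edge. A tournament is an orientation of a complete graph; it is strongly connected if for any two vertices there is a directed path from each to the other. For a graph $G$ and integer $k$, $S_k(G)$ denotes the number of orientations of $G$ in which no set of $k$ vertices inducing a complete graph $K_k$ in $G$ induces a strongly connected tournament (i.e., the orientation contains no copy of any strongly connected tournament on $k$ vertices). $S_k(n)=\max\{S_k(G): G \text{ a graph with } n \text{ vertices}\}$. The Tur\'an graph $T_{k-1}(n)$ is the complete $(k-1)$-partite graph on $n$ vertices whose part sizes differ by at most one, and $t_{k-1}(n)$ is its number of edges. -}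

module Defs where

open import Data.Nat using (ℕ; zero; suc; _+_; _∸_; _^_; _≤_; _<ᵇ_; _≡ᵇ_)
open import Data.Nat.DivMod using (_%_)
open import Data.Bool using (Bool; true; false; _∧_; not; if_then_else_)
open import Data.Fin using (Fin; toℕ)
open import Data.List using (List; []; _∷_; [_]; length; concatMap; allFin)
import Data.List as List
open import Data.Vec using (Vec)
import Data.Vec as Vec
open import Data.Product using (Σ; _×_; _,_; ∃)
open import Data.Sum using (_⊎_)
open import Data.List.Membership.Propositional using (_∈_)
open import Data.List.Relation.Unary.Unique.Propositional using (Unique)
open import Relation.Nullary using (¬_)
open import Relation.Binary.PropositionalEquality using (_≡_; _≢_)
open import Function.Bundles using (_↔_; Inverse)

record Graph (n : ℕ) : Set where
  field
    adj    : Fin n → Fin n → Bool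
    sym    : ∀ i j → adj i j ≡ adj j i
    irrefl : ∀ i → adj i i ≡ false
open Graph public

edges : ∀ {n} → Graph n → List (Fin n × Fin n)
edges {n} G = concatMap (λ i → concatMap (λ j →
  if adj G i j ∧ (toℕ i <ᵇ toℕ j) then [ (i , j) ] else []) (allFin n)) (allFin n)

-- An orientation assigns one bit per edge: for the edge (i , j) (i < j),
-- true means i → j and false means j → i.
Orientation : ∀ {n} → Graph n → Set
Orientation G = Vec Bool (length (edges G))

Arc : ∀ {n} (G : Graph n) → Orientation G → Fin n → Fin n → Set
Arc G o u v = Σ (Fin (length (edges G))) λ p →
  (List.lookup (edges G) p ≡ (u , v) × Vec.lookup o p ≡ true)
  ⊎ (List.lookup (edges G) p ≡ (v , u) × Vec.lookup o p ≡ false)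

data PathIn {n} (G : Graph n) (o : Orientation G) (S : List (Fin n)) : Fin n → Fin n → Set where
  here : ∀ {u} → PathIn G o S u u
  step : ∀ {u w v} → Arc G o u w → w ∈ S → PathIn G o S w v → PathIn G o S u v

IsKClique : ∀ {n} → Graph n → ℕ → List (Fin n) → Set
IsKClique G k S = length S ≡ k × Unique S ×
  (∀ {u v} → u ∈ S → v ∈ S → u ≢ v → adj G u v ≡ true)

StronglyConnectedOn : ∀ {n} (G : Graph n) → Orientation G → List (Fin n) → Set
StronglyConnectedOn G o S = ∀ {u v} → u ∈ S → v ∈ S → PathIn G o S u v

Good : ∀ {n} (G : Graph n) → ℕ → Orientation G → Set
Good G k o = ∀ S → IsKClique G k S → ¬ StronglyConnectedOn G o S

SkIs : ∀ {n} → ℕ → Graph n → ℕ → Set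
SkIs {n} k G m = Σ (List (Orientation G)) λ L →
  Unique L × (∀ o → (o ∈ L → Good G k o) × (Good G k o → o ∈ L)) × length L ≡ m

SknIs : ℕ → ℕ → ℕ → Set
SknIs k n M = (∀ (G : Graph n) m → SkIs k G m → m ≤ M) × Σ (Graph n) λ G → SkIs k G M

_≅_ : ∀ {n} → Graph n → Graph n → Set
_≅_ {n} G H = Σ (Fin n ↔ Fin n) λ σ →
  ∀ i j → adj G i j ≡ adj H (Inverse.to σ i) (Inverse.to σ j)

-- Turán graph T_r(n): vertex i in part (i mod r); adjacent iff different parts.
-- (Part sizes differ by at most one.)
turán : (r n : ℕ) → Graph n
turán r n = record
  { adj = λ i j → not (((toℕ i) % suc (r ∸ 1)) ≡ᵇ ((toℕ j) % suc (r ∸ 1)))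
  ; sym = λ i j → symm (toℕ i % suc (r ∸ 1)) (toℕ j % suc (r ∸ 1))
  ; irrefl = λ i → refl' (toℕ i % suc (r ∸ 1)) }
  where
  open import Relation.Binary.PropositionalEquality using (refl; cong)
  symm : ∀ a b → not (a ≡ᵇ b) ≡ not (b ≡ᵇ a)
  symm zero zero = refl
  symm zero (suc b) = refl
  symm (suc a) zero = refl
  symm (suc a) (suc b) = symm a b
  refl' : ∀ a → not (a ≡ᵇ a) ≡ false
  refl' zero = refl
  refl' (suc a) = refl' a

t : ℕ → ℕ → ℕ
t r n = length (edges (turán r n))

complete : (n : ℕ) → Graph n
complete n = turán n n

module Submission where

-- A graph without K_k has 2^e orientations, all of them good, and Turán's theorem applies. Otherwise remove a
-- maximum clique W with r ≥ k vertices. By Moon's theorem a strong tournament on at least k vertices contains a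
-- strong one on exactly k, so a good orientation has no strong clique on k or more vertices. Hence, if W is oriented
-- and its vertices adjacent to an outside vertex v are listed along a Hamiltonian path, the arcs at v form a bit
-- string in which no "in" occurs k − 2 or more places after an "out". There are linearly many times 2^(k−3) such
-- strings, which together with the bound for the orientations of W loses against the Turán number.
-- The bound for W starts at r = k from "fewer than half of the tournaments are not strong" (k ≥ 5: 480 of 1024 for
-- k = 5, then recursively) and at r = 5 for k = 4 (240 of 1024). The tight case k = r = 4 needs one outside vertex
-- added to W: K₅ minus an edge has at most 224 good orientations.

open import Defs renaming (sym to adj-sym)
open import Data.Nat
open import Data.Nat.Properties
open import Data.Nat.DivMod using (_%_; m<n⇒m%n≡m; m%n<n; m%n%n≡m%n; [m+n]%n≡m%n)
open import Data.Nat.Solver using (module +-*-Solver)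
open import Data.Bool using (Bool; true; false; not; _∧_; _∨_; T?; if_then_else_)
import Data.Bool as Bool
open import Data.Bool.ListAction using (all; any)
open import Data.Bool.Properties using (T-≡; T-∧; ¬-not; not-injective; not-involutive; ∧-zeroʳ; ∧-identityʳ; ∨-zeroʳ)
open import Data.Empty using (⊥; ⊥-elim)
open import Data.Fin using (Fin; toℕ)
import Data.Fin as Fin
open import Data.Fin.Patterns
open import Data.Fin.Properties using (toℕ-injective; toℕ-cast; cast-is-id; cast-trans)
open import Data.List
  using (List; []; _∷_; [_]; length; map; _++_; drop; take; filter; filterᵇ; concatMap; cartesianProduct; tabulate;
    applyUpTo; upTo; allFin; lookup)
open import Data.List.Properties
  using (length-++; length-map; length-take; length-tabulate; length-upTo; length-applyUpTo; ++-identityʳ; map-∘;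
    map-tabulate; map-applyUpTo; drop-map; filter-++)
open import Data.List.Membership.Propositional using (_∈_; _∉_; find; lose)
open import Data.List.Membership.Propositional.Properties
  using (∈-++⁺ˡ; ∈-++⁺ʳ; ∈-++⁻; ∈-∃++; ∈-map⁺; ∈-map⁻; ∈-filter⁺; ∈-filter⁻; ∈-cartesianProduct⁺; ∈-allFin;
    ∈-lookup; ∈-upTo⁺)
open import Data.List.Relation.Binary.Permutation.Propositional
  using (_↭_; prep; swap; ↭⇒↭ₛ; ↭-refl; ↭-sym; ↭-trans) renaming (refl to ↭-done; trans to ↭-then)
open import Data.List.Relation.Binary.Permutation.Propositional.Properties
  using (∈-resp-↭; All-resp-↭; ↭-length; drop-∷; ++⁺) renaming (shift to ↭-shift)
import Data.List.Relation.Binary.Permutation.Setoid.Properties as Permₛ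
open import Data.List.Relation.Binary.Sublist.Propositional using ([]; _∷_; _∷ʳ_) renaming (_⊆_ to _⊑_)
import Data.List.Relation.Binary.Sublist.Propositional as Sublist
import Data.List.Relation.Binary.Sublist.Propositional.Properties as Sublist
open import Data.List.Relation.Binary.Subset.Propositional using (_⊆_)
open import Data.List.Relation.Unary.All as All using (All; []; _∷_; all?)
import Data.List.Relation.Unary.All.Properties as All
open import Data.List.Relation.Unary.AllPairs as AllPairs using (AllPairs; []; _∷_)
import Data.List.Relation.Unary.AllPairs.Properties as AllPairs
open import Data.List.Relation.Unary.Any using (Any; here; there; any?; index)
open import Data.List.Relation.Unary.Any.Properties using (lookup-index; any⁻)
open import Data.List.Relation.Unary.Linked as Linked using (Linked; []; [-]; _∷_)
open import Data.List.Relation.Unary.Unique.Propositional using (Unique)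
import Data.List.Relation.Unary.Unique.Propositional.Properties as Unique
open import Data.Product using (∃; ∃₂; _×_; _,_; proj₁; proj₂)
open import Data.Product.Properties using (≡-dec)
open import Data.Sum using (_⊎_; inj₁; inj₂)
open import Data.Unit using (⊤)
open import Data.Vec using (Vec; []; _∷_)
import Data.Vec as Vec
import Data.Vec.Properties as Vec
open import Function using (_∘_; id; case_of_)
open import Function.Bundles using (mk↔ₛ′; Equivalence)
open import Relation.Binary using (tri<; tri≈; tri>)
open import Relation.Binary.PropositionalEquality hiding ([_])
open import Relation.Nullary using (¬_; Dec; yes; no; contradiction; ¬?)
open import Relation.Nullary.Decidable using (_×-dec_; _⊎-dec_; map′; decidable-stable; ¬¬-excluded-middle; from-yes)
open +-*-Solver

-- Why outside vertices never hurt: put p = k - 1 and let W have p + s vertices, s ≥ 1. By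
-- maximality an outside vertex has at most p + s - 1 neighbours in W, hence at most (s + 2) ·
-- 2^(k-3) admissible rows. Superadditivity of the Turán numbers credits it with 2^((p-1)(p+s)/p),
-- and the p-th power of the former is at most that of the latter. The exponent is fractional, so
-- inequalities are compared after raising them to the power p. The strict loss therefore comes from
-- W alone, and this strictness leaves for equality only graphs without K_k, where the equality case
-- of Turán's theorem decides. The obstacle is K₄ for k = 4, the only W with no loss: its 40
-- orientations exceed 2^5 = 32. With one more vertex the surplus is gone, since 224 < 2^8. But the
-- same surplus can also occur in the graph left after removing W, so the induction hypothesis has
-- to admit 40 there, and each comparison has a variant with enough slack for it.

private variable
  A B : Set

-- Cardinality bounds up to an equivalence

-- Stated through lists of pairwise inequivalent elements, so that neither `P` nor the relation has
-- to be decidable and no set of classes is formed. A duplicate-free list, as in `SkIs`, is such a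
-- list for equality.
Bnd : (A → Set) → (A → A → Set) → ℕ → Set
Bnd {A} P _~_ N = (L : List A) → All P L → AllPairs (λ x y → ¬ (x ~ y)) L → length L ≤ N

AllPairs-resp-⊑ : ∀ {R : A → A → Set} {xs ys} → xs ⊑ ys → AllPairs R ys → AllPairs R xs
AllPairs-resp-⊑ [] [] = []
AllPairs-resp-⊑ (_ ∷ʳ s) (_ ∷ rs) = AllPairs-resp-⊑ s rs
AllPairs-resp-⊑ (refl ∷ s) (r ∷ rs) = Sublist.All-resp-⊆ s r ∷ AllPairs-resp-⊑ s rs

¬¬-All-Dec : (Q : A → Set) (L : List A) → ¬ ¬ All (λ x → Dec (Q x)) L
¬¬-All-Dec Q [] k = k []
¬¬-All-Dec Q (x ∷ L) k = ¬¬-All-Dec Q L λ ds → ¬¬-excluded-middle λ d → k (d ∷ ds)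

-- An inequality of numbers is stable under double negation, so excluded middle may be assumed for
-- the finitely many entries of `L`.
classically : ∀ (Q : A → Set) (L : List A) {m n} →
  (All (λ x → Dec (Q x)) L → m ≤ n) → m ≤ n
classically Q L {m} {n} f = decidable-stable (m ≤? n) λ m≰n → ¬¬-All-Dec Q L (m≰n ∘ f)

separate : ∀ {Q : A → Set} {L} → All (λ x → Dec (Q x)) L →
  ∃₂ λ F T → All Q F × All (¬_ ∘ Q) T × F ⊑ L × T ⊑ L × length L ≡ length F + length T
separate [] = [] , [] , [] , [] , [] , [] , refl
separate {L = x ∷ _} (d ∷ ds) with separate ds
... | F , T , qF , qT , sF , sT , e with d
... | yes q = x ∷ F , T , q ∷ qF , qT , refl ∷ sF , x ∷ʳ sT , cong suc e
... | no ¬q = F , x ∷ T , qF , ¬q ∷ qT , x ∷ʳ sF , refl ∷ sT ,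
  trans (cong suc e) (sym (+-suc (length F) (length T)))

module _ {P : A → Set} {_~_ : A → A → Set} where

  Bnd-transfer : ∀ {P′ : A → Set} {_≈_ : A → A → Set} {N M} → N ≤ M →
    (∀ {x} → P′ x → P x) → (∀ {x y} → P′ x → P′ y → x ~ y → x ≈ y) →
    Bnd P _~_ N → Bnd P′ _≈_ M
  Bnd-transfer {P′} {_≈_} N≤M f g b L ps ds = ≤-trans (b L (All.map f ps) (go ps ds)) N≤M
    where
    go : ∀ {L} → All P′ L → AllPairs (λ x y → ¬ (x ≈ y)) L → AllPairs (λ x y → ¬ (x ~ y)) L
    go [] [] = []
    go (p ∷ ps) (d ∷ ds) = All.zipWith (λ (q , n) e → n (g p q e)) (ps , d) ∷ go ps ds

  Bnd-one : (∀ {x y} → P x → P y → x ~ y) → Bnd P _~_ 1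
  Bnd-one f [] ps ds = z≤n
  Bnd-one f (x ∷ []) ps ds = s≤s z≤n
  Bnd-one f (x ∷ y ∷ L) (p ∷ q ∷ _) ((d ∷ _) ∷ _) = ⊥-elim (d (f p q))

  Bnd-zero : (∀ {x} → ¬ P x) → Bnd P _~_ 0
  Bnd-zero f [] ps ds = z≤n
  Bnd-zero f (x ∷ L) (p ∷ _) ds = ⊥-elim (f p)

  Bnd-split : (Q : A → Set) → ∀ {N M} → Bnd (λ x → P x × Q x) _~_ N →
    Bnd (λ x → P x × ¬ Q x) _~_ M → Bnd P _~_ (N + M)
  Bnd-split Q {N} {M} bQ b¬Q L ps ds = classically Q L λ dec →
    let F , T , qF , qT , sF , sT , e = separate dec in
    begin
      length L ≡⟨ e ⟩
      length F + length T
        ≤⟨ +-mono-≤ (bQ F (All.zip (Sublist.All-resp-⊆ sF ps , qF)) (AllPairs-resp-⊑ sF ds))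
                    (b¬Q T (All.zip (Sublist.All-resp-⊆ sT ps , qT)) (AllPairs-resp-⊑ sT ds)) ⟩
      N + M ∎
    where open ≤-Reasoning

  module _ {_~₁_ _~₂_ : A → A → Set} (refl₁ : ∀ {x} → x ~₁ x) {M : ℕ}
    (fibre : ∀ x₀ → P x₀ → Bnd (λ x → P x × x₀ ~₁ x) _~₂_ M)
    (joint : ∀ {x₀ x y} → P x₀ → P x → P y → x₀ ~₁ x → x₀ ~₁ y → x ~₂ y → x ~ y) where

    private
      -- Greedy choice: the head represents everything `~₁`-related to it, at most `M` entries by
      -- `fibre`, and the recursion continues on the rest. The double negation is there because `~₁`
      -- need not be decidable.
      representatives : ∀ fuel L → length L ≤ fuel → All P L →
        AllPairs (λ x y → ¬ (x ~ y)) L →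
        ¬ ¬ (∃ λ R → R ⊑ L × AllPairs (λ x y → ¬ (x ~₁ y)) R × length L ≤ length R * M)
      representatives _ [] _ _ _ k = k ([] , [] , [] , z≤n)
      representatives (suc fuel) (x ∷ L) (s≤s le) (p ∷ ps) (d ∷ ds) k =
        ¬¬-All-Dec (x ~₁_) L λ dec →
        let F , T , qF , qT , sF , sT , e = separate dec in
        representatives fuel T
          (≤-trans (≤-trans (m≤n+m _ (length F)) (≤-reflexive (sym e))) le)
          (Sublist.All-resp-⊆ sT ps) (AllPairs-resp-⊑ sT ds) λ (R , sR , dR , eR) →
        k (x ∷ R , refl ∷ Sublist.⊆-trans sR sT , Sublist.All-resp-⊆ sR qT ∷ dR ,
          (begin
            suc (length L) ≡⟨ cong suc e ⟩
            length (x ∷ F) + length T ≤⟨ +-mono-≤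
               (fibre x p
                 (x ∷ F) ((p , refl₁) ∷ All.zip (Sublist.All-resp-⊆ sF ps , qF))
                 (sep p ((p , refl₁) ∷ All.zip (Sublist.All-resp-⊆ sF ps , qF))
                   (AllPairs-resp-⊑ (refl ∷ sF) (d ∷ ds)))) eR ⟩
            M + length R * M ∎))
        where
        open ≤-Reasoning
        sep : ∀ {x₀} → P x₀ → ∀ {L} → All (λ y → P y × x₀ ~₁ y) L →
          AllPairs (λ x y → ¬ (x ~ y)) L → AllPairs (λ x y → ¬ (x ~₂ y)) L
        sep p₀ [] [] = []
        sep p₀ ((p , e) ∷ ps) (d ∷ ds) =
          All.zipWith (λ ((q , e′) , n) e₂ → n (joint p₀ p q e e′ e₂)) (ps , d) ∷ sep p₀ ps ds

    -- Counting by fibres: at most `N` classes for the coarse data `~₁`, and at most `M` values of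
    -- the remaining data `~₂` once a representative of the coarse data is fixed. The fibre bound
    -- may use that representative, as `Bnd-extension` does.
    Bnd-prod : ∀ {N} → Bnd P _~₁_ N → Bnd P _~_ (N * M)
    Bnd-prod {N} b L ps ds = decidable-stable (_ ≤? _) λ ≰ →
      representatives (length L) L ≤-refl ps ds λ (R , sR , dR , e) →
      ≰ (≤-trans e (*-monoˡ-≤ M (b R (Sublist.All-resp-⊆ sR ps) dR)))

-- Counting by bits, tests and patterns

SameBits : List (A → Bool) → A → A → Set
SameBits fs x y = All (λ f → f x ≡ f y) fs

bits : List (A → Bool) → A → List Bool
bits fs x = map (λ f → f x) fs

count : ℕ → (List Bool → Bool) → ℕ
count zero t = if t [] then 1 else 0
count (suc m) t = count m (t ∘ (true ∷_)) + count m (t ∘ (false ∷_))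

Bnd-head : {P : A → Set} (f : A → Bool) (fs : List (A → Bool)) → ∀ {N M} →
  Bnd (λ x → P x × f x ≡ true) (SameBits fs) N →
  Bnd (λ x → P x × f x ≡ false) (SameBits fs) M →
  Bnd P (SameBits (f ∷ fs)) (N + M)
Bnd-head f fs bt bf = Bnd-split (λ x → f x ≡ true)
  (Bnd-transfer ≤-refl id (λ (_ , e) (_ , e′) s → trans e (sym e′) ∷ s) bt)
  (Bnd-transfer ≤-refl (λ (p , n) → p , ¬-not n)
    (λ (_ , n) (_ , n′) s → trans (¬-not n) (sym (¬-not n′)) ∷ s) bf)

Bnd-bits : {P : A → Set} (fs : List (A → Bool)) → Bnd P (SameBits fs) (2 ^ length fs)
Bnd-bits [] = Bnd-one λ _ _ → []
Bnd-bits (f ∷ fs) = Bnd-transfer (≤-reflexive (cong (2 ^ length fs +_) (sym (+-identityʳ _))))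
  id (λ _ _ s → s) (Bnd-head f fs (Bnd-bits fs) (Bnd-bits fs))

-- Reduces a bound to evaluating `count`, so that a finite enumeration becomes a computation on
-- closed terms.
Bnd-test : (t : List Bool → Bool) {P : A → Set} (fs : List (A → Bool)) →
  (∀ {x} → P x → t (bits fs x) ≡ true) → Bnd P (SameBits fs) (count (length fs) t)
Bnd-test t [] h with t []
... | true = Bnd-one λ _ _ → []
... | false = Bnd-zero λ p → case h p of λ ()
Bnd-test t (f ∷ fs) h = Bnd-head f fs
  (Bnd-test (t ∘ (true ∷_)) fs λ {x} (p , e) → subst (λ b → t (b ∷ bits fs x) ≡ true) e (h p))
  (Bnd-test (t ∘ (false ∷_)) fs λ {x} (p , e) → subst (λ b → t (b ∷ bits fs x) ≡ true) e (h p))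

-- Counts the strings with no false more than ℓ places after a true: a leading true leaves d ⊓ ℓ free bits.
patterns : ℕ → ℕ → ℕ
patterns ℓ zero = 1
patterns ℓ (suc d) = 2 ^ (d ⊓ ℓ) + patterns ℓ d

-- Only the first `true` is tested: a place more than ℓ after a later `true` is also more than ℓ
-- after the first one.
Pattern : ℕ → List Bool → Set
Pattern ℓ [] = ⊤
Pattern ℓ (true ∷ s) = All (_≡ true) (drop ℓ s)
Pattern ℓ (false ∷ s) = Pattern ℓ s

-- Only the bits among the first ℓ places are free.
Bnd-tail-true : {P : A → Set} (fs : List (A → Bool)) (ℓ : ℕ) →
  (∀ {x} → P x → All (_≡ true) (drop ℓ (bits fs x))) →
  Bnd P (SameBits fs) (2 ^ (length fs ⊓ ℓ))
Bnd-tail-true fs zero h = Bnd-transfer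
  (≤-reflexive (cong (2 ^_) (sym (⊓-zeroʳ (length fs))))) id (λ _ _ s → s)
  (Bnd-one {_~_ = SameBits fs} λ p q → forced fs (h p) (h q))
  where
  forced : ∀ fs {x y} → All (_≡ true) (bits fs x) → All (_≡ true) (bits fs y) → SameBits fs x y
  forced [] [] [] = []
  forced (f ∷ fs) (e ∷ es) (e′ ∷ es′) = trans e (sym e′) ∷ forced fs es es′
Bnd-tail-true [] (suc ℓ) h = Bnd-one λ _ _ → []
Bnd-tail-true (f ∷ fs) (suc ℓ) h = Bnd-transfer
  (≤-reflexive (cong (2 ^ (length fs ⊓ ℓ) +_) (sym (+-identityʳ _)))) id (λ _ _ s → s)
  (Bnd-head f fs (Bnd-tail-true fs ℓ (h ∘ proj₁)) (Bnd-tail-true fs ℓ (h ∘ proj₁)))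

Bnd-pattern : {P : A → Set} (ℓ : ℕ) (fs : List (A → Bool)) →
  (∀ {x} → P x → Pattern ℓ (bits fs x)) → Bnd P (SameBits fs) (patterns ℓ (length fs))
Bnd-pattern ℓ [] h = Bnd-one λ _ _ → []
Bnd-pattern ℓ (f ∷ fs) h = Bnd-head f fs
  (Bnd-tail-true fs ℓ λ {x} (p , e) → subst (λ b → Pattern ℓ (b ∷ bits fs x)) e (h p))
  (Bnd-pattern ℓ fs λ {x} (p , e) → subst (λ b → Pattern ℓ (b ∷ bits fs x)) e (h p))

-- Edge counts and Turán numbers

ind : Bool → ℕ
ind b = if b then 1 else 0

deg : (A → A → Bool) → A → List A → ℕ
deg adj v [] = 0
deg adj v (x ∷ xs) = ind (adj v x) + deg adj v xs

size : (A → A → Bool) → List A → ℕ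
size adj [] = 0
size adj (v ∷ vs) = deg adj v vs + size adj vs

cross : (A → A → Bool) → List A → List A → ℕ
cross adj [] ys = 0
cross adj (x ∷ xs) ys = deg adj x ys + cross adj xs ys

module _ (adj : A → A → Bool) where
  deg-++ : ∀ v xs ys → deg adj v (xs ++ ys) ≡ deg adj v xs + deg adj v ys
  deg-++ v [] ys = refl
  deg-++ v (x ∷ xs) ys = trans (cong (ind (adj v x) +_) (deg-++ v xs ys)) (sym (+-assoc (ind (adj v x)) _ _))

  deg-↭ : ∀ v {xs ys} → xs ↭ ys → deg adj v xs ≡ deg adj v ys
  deg-↭ v ↭-done = refl
  deg-↭ v (prep x p) = cong (ind (adj v x) +_) (deg-↭ v p)
  deg-↭ v (swap {xs = xs} {ys} x y p) rewrite deg-↭ v p =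
    solve 3 (λ a b c → a :+ (b :+ c) := b :+ (a :+ c)) refl (ind (adj v x)) (ind (adj v y)) (deg adj v ys)
  deg-↭ v (↭-then p q) = trans (deg-↭ v p) (deg-↭ v q)

  deg-≤ : ∀ v xs → deg adj v xs ≤ length xs
  deg-≤ v [] = z≤n
  deg-≤ v (x ∷ xs) with adj v x
  ... | true = s≤s (deg-≤ v xs)
  ... | false = m≤n⇒m≤1+n (deg-≤ v xs)

  deg-full : ∀ v {xs} → All (λ x → adj v x ≡ true) xs → deg adj v xs ≡ length xs
  deg-full v [] = refl
  deg-full v (e ∷ es) rewrite e = cong suc (deg-full v es)

  size-++ : ∀ xs ys → size adj (xs ++ ys) ≡ size adj xs + cross adj xs ys + size adj ys
  size-++ [] ys = refl
  size-++ (x ∷ xs) ys rewrite size-++ xs ys | deg-++ x xs ys =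
    solve 5 (λ a b c d e → a :+ b :+ (c :+ d :+ e) := a :+ c :+ (b :+ d) :+ e) refl
      (deg adj x xs) (deg adj x ys) (size adj xs) (cross adj xs ys) (size adj ys)

  cross-[] : ∀ xs → cross adj xs [] ≡ 0
  cross-[] [] = refl
  cross-[] (x ∷ xs) = cross-[] xs

  module _ (adj-sym : ∀ x y → adj x y ≡ adj y x) where
    size-↭ : ∀ {xs ys} → xs ↭ ys → size adj xs ≡ size adj ys
    size-↭ ↭-done = refl
    size-↭ (prep x p) = cong₂ _+_ (deg-↭ x p) (size-↭ p)
    size-↭ (swap {xs = xs} {ys} x y p) rewrite adj-sym x y | deg-↭ x p | deg-↭ y p | size-↭ p =
      solve 4 (λ a b c d → a :+ b :+ (c :+ d) := a :+ c :+ (b :+ d)) refl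
        (ind (adj y x)) (deg adj x ys) (deg adj y ys) (size adj ys)
    size-↭ (↭-then p q) = trans (size-↭ p) (size-↭ q)

    cross-∷ʳ : ∀ xs y ys → cross adj xs (y ∷ ys) ≡ deg adj y xs + cross adj xs ys
    cross-∷ʳ [] y ys = refl
    cross-∷ʳ (x ∷ xs) y ys rewrite cross-∷ʳ xs y ys | adj-sym x y =
      solve 4 (λ a b c d → a :+ b :+ (c :+ d) := a :+ c :+ (b :+ d)) refl
        (ind (adj y x)) (deg adj x ys) (deg adj y xs) (cross adj xs ys)

    cross-sym : ∀ xs ys → cross adj xs ys ≡ cross adj ys xs
    cross-sym [] ys = sym (cross-[] ys)
    cross-sym (x ∷ xs) ys = trans (cong (deg adj x ys +_) (cross-sym xs ys)) (sym (cross-∷ʳ ys x xs))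

  cross-const : ∀ {c xs ys} → All (λ x → deg adj x ys ≡ c) xs → cross adj xs ys ≡ length xs * c
  cross-const [] = refl
  cross-const (e ∷ es) = cong₂ _+_ e (cross-const es)

  cross-≤ : ∀ {c xs ys} → All (λ x → deg adj x ys ≤ c) xs → cross adj xs ys ≤ length xs * c
  cross-≤ [] = z≤n
  cross-≤ (e ∷ es) = +-mono-≤ e (cross-≤ es)

  cross-tight : ∀ {c xs ys} → All (λ x → deg adj x ys ≤ c) xs → length xs * c ≤ cross adj xs ys →
    All (λ x → deg adj x ys ≡ c) xs
  cross-tight [] _ = []
  cross-tight {c} {x ∷ xs} {ys} (e ∷ es) h =
    ≤-antisym e (+-cancelʳ-≤ (cross adj xs ys) c (deg adj x ys) (≤-trans (+-monoʳ-≤ c (cross-≤ es)) h))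
    ∷ cross-tight es (+-cancelˡ-≤ c _ _ (≤-trans h (+-monoˡ-≤ _ e)))

size-map : ∀ (adj : A → A → Bool) (adj′ : B → B → Bool) (f : A → B) →
  (∀ x y → adj′ (f x) (f y) ≡ adj x y) → ∀ xs → size adj′ (map f xs) ≡ size adj xs
size-map {A} adj adj′ f h [] = refl
size-map {A} adj adj′ f h (x ∷ xs) = cong₂ _+_ (go xs) (size-map adj adj′ f h xs)
  where
  go : ∀ ys → deg adj′ (f x) (map f ys) ≡ deg adj x ys
  go [] = refl
  go (y ∷ ys) = cong₂ _+_ (cong ind (h x y)) (go ys)

-- The binomial coefficient n over 2.
pairs : ℕ → ℕ
pairs zero = 0
pairs (suc n) = n + pairs n

size-clique : ∀ (adj : A → A → Bool) {xs} → AllPairs (λ x y → adj x y ≡ true) xs →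
  size adj xs ≡ pairs (length xs)
size-clique adj [] = refl
size-clique adj {x ∷ xs} (e ∷ es) = cong₂ _+_ (deg-full adj x e) (size-clique adj es)

pairs-+ : ∀ m n → pairs (m + n) ≡ pairs m + m * n + pairs n
pairs-+ zero n = refl
pairs-+ (suc m) n rewrite pairs-+ m n =
  solve 4 (λ m n a b → m :+ n :+ (a :+ m :* n :+ b) := m :+ a :+ (n :+ m :* n) :+ b) refl
    m n (pairs m) (pairs n)

-- The number of parts is `suc q`, which keeps the modulus positive; `q` is then the number of
-- neighbours a vertex has in a block with one vertex from each part.
multiAdj : ℕ → ℕ → ℕ → Bool
multiAdj q i j = not ((i % suc q) ≡ᵇ (j % suc q))

opaque
  -- Kept opaque: the numerical arguments use only the initial values `turánSize-small` and the
  -- recursion `turánSize-step`.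
  turánSize : ℕ → ℕ → ℕ
  turánSize q n = size (multiAdj q) (upTo n)

  turánSize-def : ∀ q n → turánSize q n ≡ size (multiAdj q) (upTo n)
  turánSize-def q n = refl

≡ᵇ-sym : ∀ a b → (a ≡ᵇ b) ≡ (b ≡ᵇ a)
≡ᵇ-sym zero zero = refl
≡ᵇ-sym zero (suc b) = refl
≡ᵇ-sym (suc a) zero = refl
≡ᵇ-sym (suc a) (suc b) = ≡ᵇ-sym a b

≡ᵇ-refl : ∀ a → (a ≡ᵇ a) ≡ true
≡ᵇ-refl zero = refl
≡ᵇ-refl (suc a) = ≡ᵇ-refl a

≢⇒≡ᵇ-false : ∀ a b → a ≢ b → (a ≡ᵇ b) ≡ false
≢⇒≡ᵇ-false zero zero n with () ← n refl
≢⇒≡ᵇ-false zero (suc b) n = refl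
≢⇒≡ᵇ-false (suc a) zero n = refl
≢⇒≡ᵇ-false (suc a) (suc b) n = ≢⇒≡ᵇ-false a b (n ∘ cong suc)

multiAdj-sym : ∀ q i j → multiAdj q i j ≡ multiAdj q j i
multiAdj-sym q i j = cong not (≡ᵇ-sym (i % suc q) (j % suc q))

multiAdj-true : ∀ q i j → i % suc q ≢ j % suc q → multiAdj q i j ≡ true
multiAdj-true q i j ne = cong not (≢⇒≡ᵇ-false (i % suc q) (j % suc q) ne)

multiAdj-false : ∀ q i j → i % suc q ≡ j % suc q → multiAdj q i j ≡ false
multiAdj-false q i j e rewrite e = cong not (≡ᵇ-refl (j % suc q))

applyUpTo-+ : ∀ (f : ℕ → A) m n → applyUpTo f (m + n) ≡ applyUpTo f m ++ applyUpTo (λ i → f (m + i)) n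
applyUpTo-+ f zero n = refl
applyUpTo-+ f (suc m) n = cong (f 0 ∷_) (applyUpTo-+ (f ∘ suc) m n)

upTo-+ : ∀ m n → upTo (m + n) ≡ upTo m ++ map (m +_) (upTo n)
upTo-+ m n = trans (applyUpTo-+ id m n) (cong (upTo m ++_) (sym (map-applyUpTo id (m +_) n)))

module _ (q : ℕ) where
  private p = suc q

  turánSize-small : ∀ {n} → n ≤ p → turánSize q n ≡ pairs n
  turánSize-small {n} n≤p = trans (turánSize-def q n) (trans
    (size-clique (multiAdj q) (AllPairs.applyUpTo⁺₁ id n λ {i} {j} i<j j<n →
      multiAdj-true q i j λ e → <⇒≢ i<j (trans (sym (m<n⇒m%n≡m (≤-trans (<-trans i<j j<n) n≤p)))
        (trans e (m<n⇒m%n≡m (≤-trans j<n n≤p))))))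
    (cong pairs (length-upTo n)))

  -- The numbers below `p` represent each residue once, so j misses exactly one of them, namely
  -- `j % p`; the block is cut there.
  deg-block : ∀ j → deg (multiAdj q) j (upTo p) ≡ q
  deg-block j = begin
    deg M j (upTo p) ≡⟨ cong (deg M j ∘ upTo) p≡ ⟨
    deg M j (upTo (r + suc s)) ≡⟨ cong (deg M j) (upTo-+ r (suc s)) ⟩
    deg M j (upTo r ++ map (r +_) (upTo (suc s))) ≡⟨ deg-++ M j (upTo r) _ ⟩
    deg M j (upTo r) + (ind (M j (r + 0)) + deg M j (map (r +_) (applyUpTo suc s)))
      ≡⟨ cong₂ _+_ below (cong₂ _+_ at above) ⟩
    r + s ≡⟨ suc-injective (trans (sym (+-suc r s)) p≡) ⟩
    q ∎
    where
    open ≡-Reasoning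
    M = multiAdj q
    r = j % p
    s = proj₁ (m≤n⇒∃[o]m+o≡n (m%n<n j p))
    p≡ : r + suc s ≡ p
    p≡ = trans (+-suc r s) (proj₂ (m≤n⇒∃[o]m+o≡n (m%n<n j p)))
    adjacent : ∀ {i} → i < p → r ≢ i → M j i ≡ true
    adjacent {i} i<p ne = multiAdj-true q j i λ e → ne (trans e (m<n⇒m%n≡m i<p))
    below : deg M j (upTo r) ≡ r
    below = trans (deg-full M j (All.applyUpTo⁺₁ id r λ i<r →
      adjacent (<-trans i<r (m%n<n j p)) (>⇒≢ i<r))) (length-upTo r)
    at : ind (M j (r + 0)) ≡ 0
    at = cong ind (multiAdj-false q j (r + 0) (sym (trans (cong (_% p) (+-identityʳ r)) (m%n%n≡m%n j p))))
    above : deg M j (map (r +_) (applyUpTo suc s)) ≡ s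
    above = trans (cong (deg M j) (map-applyUpTo suc (r +_) s)) (trans
      (deg-full M j (All.applyUpTo⁺₁ (λ i → r + suc i) s λ {i} i<s →
        adjacent (subst (r + suc i <_) p≡ (+-monoʳ-< r (s<s i<s))) (<⇒≢ (m<m+n r z<s))))
      (length-applyUpTo _ s))

  -- Splits off a block with one vertex from each part: a clique, of which every other vertex sees
  -- all but one. Shifting by `p` preserves residues, so a Turán graph remains.
  turánSize-step : ∀ n → turánSize q (p + n) ≡ pairs p + q * n + turánSize q n
  turánSize-step n = begin
    turánSize q (p + n) ≡⟨ turánSize-def q (p + n) ⟩
    size M (upTo (p + n)) ≡⟨ cong (size M) (upTo-+ p n) ⟩
    size M (upTo p ++ map (p +_) (upTo n)) ≡⟨ size-++ M (upTo p) _ ⟩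
    size M (upTo p) + cross M (upTo p) (map (p +_) (upTo n)) + size M (map (p +_) (upTo n))
      ≡⟨ cong₂ _+_ (cong₂ _+_ (trans (sym (turánSize-def q p)) (turánSize-small ≤-refl))
           (trans (cross-sym M (multiAdj-sym q) (upTo p) _)
             (trans (cross-const M {c = q} {xs = map (p +_) (upTo n)} {ys = upTo p} (All.universal deg-block _))
               (trans (cong (_* q) (trans (length-map (p +_) (upTo n)) (length-upTo n))) (*-comm n q)))))
           (size-map M M (p +_) (λ i j → cong₂ (λ a b → not (a ≡ᵇ b)) (shift i) (shift j)) (upTo n)) ⟩
    pairs p + q * n + size M (upTo n) ≡⟨ cong (pairs p + q * n +_) (turánSize-def q n) ⟨
    pairs p + q * n + turánSize q n ∎
    where
    open ≡-Reasoning
    M = multiAdj q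
    shift : ∀ i → (p + i) % p ≡ i % p
    shift i = trans (cong (_% p) (+-comm p i)) ([m+n]%n≡m%n i p)

-- Numerical inequalities

periodic-induction : ∀ (P : ℕ → Set) p .{{_ : NonZero p}} →
  (∀ n → n < p → P n) → (∀ n → P n → P (p + n)) → ∀ n → P n
periodic-induction P p@(suc _) base next n = go n n ≤-refl
  where
  go : ∀ fuel n → n ≤ fuel → P n
  go zero n n≤0 = base n (≤-trans (s≤s n≤0) (s≤s z≤n))
  go (suc fuel) n n≤ with n <? p
  ... | yes n<p = base n n<p
  ... | no n≮p = subst P (m+[n∸m]≡n (≮⇒≥ n≮p))
    (next (n ∸ p) (go fuel (n ∸ p) (≤-trans (∸-monoˡ-≤ p n≤) (m∸n≤m fuel (pred p)))))

^-cancelˡ-≤ : ∀ p .{{_ : NonZero p}} {a b} → a ^ p ≤ b ^ p → a ≤ b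
^-cancelˡ-≤ p {a} {b} h with a ≤? b
... | yes a≤b = a≤b
... | no a≰b with () ← <⇒≱ (^-monoˡ-< p (≰⇒> a≰b)) h

^-distribʳ-* : ∀ a b n → (a * b) ^ n ≡ a ^ n * b ^ n
^-distribʳ-* a b zero = refl
^-distribʳ-* a b (suc n) rewrite ^-distribʳ-* a b n =
  solve 4 (λ a b x y → a :* b :* (x :* y) := a :* x :* (b :* y)) refl a b (a ^ n) (b ^ n)

^-swap : ∀ a m n → (a ^ m) ^ n ≡ (a ^ n) ^ m
^-swap a m n = trans (^-*-assoc a m n) (trans (cong (a ^_) (*-comm m n)) (sym (^-*-assoc a n m)))

patterns-small : ∀ ℓ {d} → d ≤ ℓ → patterns ℓ d ≡ 2 ^ d
patterns-small ℓ {zero} _ = refl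
patterns-small ℓ {suc d} d<ℓ rewrite m≤n⇒m⊓n≡m (<⇒≤ d<ℓ) | patterns-small ℓ (<⇒≤ d<ℓ) =
  cong (2 ^ d +_) (sym (+-identityʳ _))

patterns-large : ∀ ℓ j → patterns ℓ (j + ℓ) ≡ suc j * 2 ^ ℓ
patterns-large ℓ zero = trans (patterns-small ℓ ≤-refl) (sym (+-identityʳ _))
patterns-large ℓ (suc j) rewrite m≥n⇒m⊓n≡n (m≤n+m ℓ j) | patterns-large ℓ j = refl

patterns-mono : ∀ ℓ {d e} → d ≤ e → patterns ℓ d ≤ patterns ℓ e
patterns-mono ℓ {d} {e} d≤e = go (≤⇒≤′ d≤e)
  where
  go : ∀ {e} → d ≤′ e → patterns ℓ d ≤ patterns ℓ e
  go ≤′-refl = ≤-refl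
  go (≤′-step h) = ≤-trans (go h) (m≤n+m _ _)

patterns>0 : ∀ ℓ d → 0 < patterns ℓ d
patterns>0 ℓ d = patterns-mono ℓ {0} {d} z≤n

linear≤2^ : ∀ s c e → c ≤ 2 ^ e → s + c ≤ 2 ^ (s + e)
linear≤2^ zero c e h = h
linear≤2^ (suc s) c e h = begin
  suc s + c ≤⟨ s≤s (linear≤2^ s c e h) ⟩
  1 + 2 ^ (s + e) ≤⟨ +-monoˡ-≤ _ (m^n>0 2 (s + e)) ⟩
  2 ^ (s + e) + 2 ^ (s + e) ≡⟨ cong (2 ^ (s + e) +_) (+-identityʳ _) ⟨
  2 ^ (suc s + e) ∎
  where open ≤-Reasoning

-- Equality at s = 2, and false at s = 1 (54 > 32). The factor 2 is the slack that later absorbs a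
-- remainder with 40 orientations.
cube-slack : ∀ s → 2 ≤ s → 2 * (2 + s) ^ 3 ≤ 2 ^ (3 + 2 * s)
cube-slack (suc zero) (s≤s ())
cube-slack (suc (suc zero)) _ = ≤-refl
cube-slack (suc (suc (suc zero))) _ = ≤ᵇ⇒≤ 250 512 _
cube-slack (suc s@(suc (suc (suc _)))) _ = begin
  2 * (3 + s) ^ 3 ≤⟨ m≤m+n _ _ ⟩
  2 * (3 + s) ^ 3 + 2 * (3 * s ^ 3 + 15 * s ^ 2 + 21 * s + 5)
    ≡⟨ solve 1 (λ s → con 2 :* (con 3 :+ s) :^ 3 :+ con 2 :* (con 3 :* s :^ 3 :+ con 15 :* s :^ 2 :+ con 21 :* s :+ con 5)
         := con 4 :* (con 2 :* (con 2 :+ s) :^ 3)) refl s ⟩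
  4 * (2 * (2 + s) ^ 3) ≤⟨ *-monoʳ-≤ 4 (cube-slack s (s≤s (s≤s z≤n))) ⟩
  2 ^ 2 * 2 ^ (3 + 2 * s) ≡⟨ ^-distribˡ-+-* 2 2 (3 + 2 * s) ⟨
  2 ^ (2 + (3 + 2 * s))
    ≡⟨ cong (2 ^_) (solve 1 (λ s → con 2 :+ (con 3 :+ con 2 :* s) := con 3 :+ con 2 :* (con 1 :+ s)) refl s) ⟩
  2 ^ (3 + 2 * suc s) ∎
  where open ≤-Reasoning

cube : ∀ s → 1 ≤ s → (2 + s) ^ 3 ≤ 2 ^ (3 + 2 * s)
cube (suc zero) _ = ≤ᵇ⇒≤ 27 32 _
cube s@(suc (suc _)) _ = ≤-trans (m≤m+n _ _) (cube-slack s (s≤s (s≤s z≤n)))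

module _ (q : ℕ) where
  private
    p = suc q
    T = turánSize q

  module _ where
    open ≤-Reasoning

    -- Superadditivity with the average number of cross edges: over the p cyclic ways to match the
    -- parts of two Turán graphs, a fraction q / p of the r · m pairs is joined on average. The
    -- proof avoids averaging: increasing r or m by p adds `p * (pairs p + q * (r + m))` to both
    -- sides, so small r and m suffice.
    turánSize-+ : ∀ r m → p * T r + p * T m + q * (r * m) ≤ p * T (r + m)
    turánSize-+ = periodic-induction _ p
      (λ r r<p → periodic-induction _ p (λ m m<p → base r m (<⇒≤ r<p) (<⇒≤ m<p)) (λ m ih → begin
        p * T r + p * T (p + m) + q * (r * (p + m))
          ≡⟨ cong (λ z → p * T r + p * z + q * (r * (p + m))) (turánSize-step q m) ⟩
        p * T r + p * (pairs p + q * m + T m) + q * (r * (p + m))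
          ≡⟨ solve 7 (λ p q r m x a b → p :* a :+ p :* (x :+ q :* m :+ b) :+ q :* (r :* (p :+ m))
               := p :* (x :+ q :* (r :+ m)) :+ (p :* a :+ p :* b :+ q :* (r :* m)))
               refl p q r m (pairs p) (T r) (T m) ⟩
        p * (pairs p + q * (r + m)) + (p * T r + p * T m + q * (r * m)) ≤⟨ +-monoʳ-≤ (p * (pairs p + q * (r + m))) ih ⟩
        p * (pairs p + q * (r + m)) + p * T (r + m) ≡⟨ *-distribˡ-+ p _ (T (r + m)) ⟨
        p * (pairs p + q * (r + m) + T (r + m)) ≡⟨ cong (p *_) (turánSize-step q (r + m)) ⟨
        p * T (p + (r + m)) ≡⟨ cong (λ z → p * T z) (solve 3 (λ p r m → p :+ (r :+ m) := r :+ (p :+ m)) refl p r m) ⟩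
        p * T (r + (p + m)) ∎))
      (λ r ih m → begin
        p * T (p + r) + p * T m + q * ((p + r) * m)
          ≡⟨ cong (λ z → p * z + p * T m + q * ((p + r) * m)) (turánSize-step q r) ⟩
        p * (pairs p + q * r + T r) + p * T m + q * ((p + r) * m)
          ≡⟨ solve 7 (λ p q r m x a b → p :* (x :+ q :* r :+ a) :+ p :* b :+ q :* ((p :+ r) :* m)
               := p :* (x :+ q :* (r :+ m)) :+ (p :* a :+ p :* b :+ q :* (r :* m)))
               refl p q r m (pairs p) (T r) (T m) ⟩
        p * (pairs p + q * (r + m)) + (p * T r + p * T m + q * (r * m)) ≤⟨ +-monoʳ-≤ (p * (pairs p + q * (r + m))) (ih m) ⟩
        p * (pairs p + q * (r + m)) + p * T (r + m) ≡⟨ *-distribˡ-+ p _ (T (r + m)) ⟨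
        p * (pairs p + q * (r + m) + T (r + m)) ≡⟨ cong (p *_) (turánSize-step q (r + m)) ⟨
        p * T (p + (r + m)) ≡⟨ cong (λ z → p * T z) (+-assoc p r m) ⟨
        p * T (p + r + m) ∎)
      where
      base : ∀ r m → r ≤ p → m ≤ p → p * T r + p * T m + q * (r * m) ≤ p * T (r + m)
      base r m r≤p m≤p rewrite turánSize-small q r≤p | turánSize-small q m≤p with ≤-total (r + m) p
      ... | inj₁ le rewrite turánSize-small q le | pairs-+ r m = begin
        p * pairs r + p * pairs m + q * (r * m)
          ≤⟨ m≤n+m _ (r * m) ⟩
        r * m + (p * pairs r + p * pairs m + q * (r * m))
          ≡⟨ solve 4 (λ q c a b → c :+ ((con 1 :+ q) :* a :+ (con 1 :+ q) :* b :+ q :* c)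
               := (con 1 :+ q) :* (a :+ c :+ b)) refl q (r * m) (pairs r) (pairs m) ⟩
        p * (pairs r + r * m + pairs m) ∎
      -- Here x is the excess of r + m over p. After cancellation `p * x ≤ r * m` remains, which
      -- holds because p = r + a, m = a + x and x ≤ r.
      ... | inj₂ ge with x , e ← m≤n⇒∃[o]m+o≡n ge
                     | a , ea ← m≤n⇒∃[o]m+o≡n r≤p = +-cancelʳ-≤ (p * x) _ _ (begin
        p * pairs r + p * pairs m + q * (r * m) + p * x
          ≤⟨ +-monoʳ-≤ (p * pairs r + p * pairs m + q * (r * m)) px≤rm ⟩
        p * pairs r + p * pairs m + q * (r * m) + r * m
          ≡⟨ solve 4 (λ q c a b → ((con 1 :+ q) :* a :+ (con 1 :+ q) :* b :+ q :* c) :+ c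
               := (con 1 :+ q) :* (a :+ c :+ b)) refl q (r * m) (pairs r) (pairs m) ⟩
        p * (pairs r + r * m + pairs m) ≡⟨ cong (p *_) (trans (sym (pairs-+ r m)) (trans (cong pairs (sym e)) (pairs-+ p x))) ⟩
        p * (pairs p + p * x + pairs x)
          ≡⟨ solve 4 (λ q x a b → (con 1 :+ q) :* (a :+ (con 1 :+ q) :* x :+ b)
               := (con 1 :+ q) :* (a :+ q :* x :+ b) :+ (con 1 :+ q) :* x) refl q x (pairs p) (pairs x) ⟩
        p * (pairs p + q * x + pairs x) + p * x
          ≡⟨ cong (λ z → p * z + p * x) (trans (cong (pairs p + q * x +_) (sym (turánSize-small q x≤p)))
               (trans (sym (turánSize-step q x)) (cong T e))) ⟩
        p * T (r + m) + p * x ∎)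
        where
        m≡ : m ≡ a + x
        m≡ = +-cancelˡ-≡ r _ _ (trans (sym e) (trans (cong (_+ x) (sym ea)) (+-assoc r a x)))
        x≤r : x ≤ r
        x≤r = +-cancelˡ-≤ p x r (≤-trans (≤-reflexive e) (≤-trans (+-monoʳ-≤ r m≤p) (≤-reflexive (+-comm r p))))
        x≤p : x ≤ p
        x≤p = ≤-trans x≤r r≤p
        px≤rm : p * x ≤ r * m
        px≤rm = begin
          p * x ≡⟨ cong (_* x) ea ⟨
          (r + a) * x ≡⟨ *-distribʳ-+ x r a ⟩
          r * x + a * x ≤⟨ +-monoʳ-≤ (r * x) (*-monoʳ-≤ a x≤r) ⟩
          r * x + a * r ≡⟨ solve 3 (λ r x a → r :* x :+ a :* r := r :* (a :+ x)) refl r x a ⟩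
          r * (a + x) ≡⟨ cong (r *_) m≡ ⟨
          r * m ∎

    small-clique-deficit : ∀ r m → suc r < p → 1 ≤ m → pairs (suc r) + r * m + T m < T (suc r + m)
    small-clique-deficit r m r<q 1≤m = *-cancelˡ-< p _ _ (begin-strict
      p * (pairs (suc r) + r * m + T m)
        ≡⟨ solve 4 (λ p a c b → p :* (a :+ c :+ b) := p :* a :+ p :* b :+ p :* c) refl
             p (pairs (suc r)) (r * m) (T m) ⟩
      p * pairs (suc r) + p * T m + p * (r * m) <⟨ +-monoʳ-< (p * pairs (suc r) + p * T m) gap ⟩
      p * pairs (suc r) + p * T m + q * (suc r * m)
        ≡⟨ cong (λ z → p * z + p * T m + q * (suc r * m)) (turánSize-small q (<⇒≤ r<q)) ⟨
      p * T (suc r) + p * T m + q * (suc r * m) ≤⟨ turánSize-+ (suc r) m ⟩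
      p * T (suc r + m) ∎)
      where
      gap : p * (r * m) < q * (suc r * m)
      gap = begin-strict
        p * (r * m) ≡⟨ solve 3 (λ q r m → (con 1 :+ q) :* (r :* m) := q :* (r :* m) :+ r :* m) refl q r m ⟩
        q * (r * m) + r * m <⟨ +-monoʳ-< (q * (r * m)) (*-monoˡ-< m {{>-nonZero 1≤m}} (s<s⁻¹ r<q)) ⟩
        q * (r * m) + q * m ≡⟨ solve 3 (λ q r m → q :* (r :* m) :+ q :* m := q :* ((con 1 :+ r) :* m)) refl q r m ⟩
        q * (suc r * m) ∎

-- Throughout, k = ℓ + 3 and p = k − 1 = ℓ + 2 is the number of Turán parts.
module _ (ℓ : ℕ) (1≤ℓ : 1 ≤ ℓ) where
  private
    q = suc ℓ
    p = suc q
    T = turánSize q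
  open ≤-Reasoning

  -- By `turánSize-step` the Turán increment at p + s is q more than the one at s, and
  -- `patterns ℓ (p + s)` is (s + 3) · 2^ℓ. Since 2^q = 2 · 2^ℓ, it remains to bound s + 3 by twice
  -- 2 to the increment at s, which is `increments` with s shifted by one.
  clique-step : ∀ s → 1 ≤ s → 2 ^ T (p + s) * patterns ℓ (p + s) ≤ 2 ^ T (suc (p + s))
  clique-step (suc s) _ = begin
    2 ^ T (p + suc s) * patterns ℓ (p + suc s)
      ≡⟨ cong₂ _*_ (trans (cong (2 ^_) (turánSize-step q (suc s))) (^-distribˡ-+-* 2 (pairs p + q * suc s) (T (suc s))))
           (trans (cong (patterns ℓ) (solve 2 (λ ℓ s → con 2 :+ ℓ :+ (con 1 :+ s) := con 3 :+ s :+ ℓ) refl ℓ s)) (patterns-large ℓ (3 + s))) ⟩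
    2 ^ (pairs p + q * suc s) * 2 ^ T (suc s) * ((4 + s) * 2 ^ ℓ)
      ≡⟨ solve 4 (λ a b c d → a :* b :* (c :* d) := a :* d :* (c :* b)) refl
           (2 ^ (pairs p + q * suc s)) (2 ^ T (suc s)) (4 + s) (2 ^ ℓ) ⟩
    2 ^ (pairs p + q * suc s) * 2 ^ ℓ * ((4 + s) * 2 ^ T (suc s))
      ≤⟨ *-monoʳ-≤ (2 ^ (pairs p + q * suc s) * 2 ^ ℓ) (increments s) ⟩
    2 ^ (pairs p + q * suc s) * 2 ^ ℓ * (2 * 2 ^ T (2 + s))
      ≡⟨ cong (_* (2 * 2 ^ T (2 + s))) (^-distribˡ-+-* 2 (pairs p + q * suc s) ℓ) ⟨
    2 ^ (pairs p + q * suc s + ℓ) * 2 ^ suc (T (2 + s)) ≡⟨ ^-distribˡ-+-* 2 (pairs p + q * suc s + ℓ) _ ⟨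
    2 ^ (pairs p + q * suc s + ℓ + suc (T (2 + s)))
      ≡⟨ cong (2 ^_) (solve 4 (λ x ℓ s t → x :+ (con 1 :+ ℓ) :* (con 1 :+ s) :+ ℓ :+ (con 1 :+ t)
           := x :+ (con 1 :+ ℓ) :* (con 2 :+ s) :+ t) refl (pairs p) ℓ s (T (2 + s))) ⟩
    2 ^ (pairs p + q * (2 + s) + T (2 + s)) ≡⟨ cong (2 ^_) (turánSize-step q (2 + s)) ⟨
    2 ^ T (p + (2 + s)) ≡⟨ cong (λ z → 2 ^ T z) (+-suc p (suc s)) ⟩
    2 ^ T (suc (p + suc s)) ∎
    where
    -- This is where `1 ≤ ℓ` enters: for q = 1 it would read 5 ≤ 4. It serves the base case in which
    -- the Turán number passes from p to p + 1 vertices and gains only q.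
    q+4≤ : 4 + q ≤ 2 * 2 ^ q
    q+4≤ with ℓ′ , refl ← m≤n⇒∃[o]m+o≡n 1≤ℓ = begin
      6 + ℓ′ ≡⟨ +-comm 6 ℓ′ ⟩
      ℓ′ + 6 ≤⟨ linear≤2^ ℓ′ 6 3 (m≤n+m 6 2) ⟩
      2 ^ (ℓ′ + 3) ≡⟨ cong (2 ^_) (+-comm ℓ′ 3) ⟩
      2 ^ (3 + ℓ′) ∎
    p+s≤ : ∀ s → 4 + (p + s) ≤ 2 ^ q * (4 + s)
    p+s≤ s = begin
      4 + (p + s) ≡⟨ solve 2 (λ q s → con 4 :+ (con 1 :+ q :+ s) := (con 1 :+ q) :+ (con 4 :+ s)) refl q s ⟩
      (1 + q) + (4 + s) ≤⟨ +-monoˡ-≤ (4 + s) (+-monoˡ-≤ q (s≤s (z≤n {ℓ}))) ⟩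
      q + q + (4 + s) ≡⟨ cong (_+ (4 + s)) (solve 1 (λ q → q :+ q := q :* con 2) refl q) ⟩
      q * 2 + (4 + s) ≤⟨ +-monoˡ-≤ (4 + s) (*-monoʳ-≤ q (m≤m+n 2 (2 + s))) ⟩
      q * (4 + s) + (4 + s) ≡⟨ solve 2 (λ q x → q :* x :+ x := (q :+ con 1) :* x) refl q (4 + s) ⟩
      (q + 1) * (4 + s) ≤⟨ *-monoˡ-≤ (4 + s) (≤-trans (linear≤2^ q 1 0 ≤-refl) (≤-reflexive (cong (2 ^_) (+-identityʳ q)))) ⟩
      2 ^ q * (4 + s) ∎
    increments : ∀ s → (4 + s) * 2 ^ T (suc s) ≤ 2 * 2 ^ T (2 + s)
    increments = periodic-induction _ p base next
      where
      base : ∀ s → s < p → (4 + s) * 2 ^ T (suc s) ≤ 2 * 2 ^ T (2 + s)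
      base s s<p with m≤n⇒m<n∨m≡n s<p
      ... | inj₁ 2+s≤p rewrite turánSize-small q (<⇒≤ 2+s≤p) | turánSize-small q 2+s≤p = begin
        (4 + s) * 2 ^ pairs (suc s) ≤⟨ *-monoˡ-≤ (2 ^ pairs (suc s)) 4+s≤ ⟩
        2 * 2 ^ suc s * 2 ^ pairs (suc s) ≡⟨ *-assoc 2 (2 ^ suc s) _ ⟩
        2 * (2 ^ suc s * 2 ^ pairs (suc s)) ≡⟨ cong (2 *_) (^-distribˡ-+-* 2 (suc s) _) ⟨
        2 * 2 ^ (suc s + pairs (suc s)) ∎
        where
        4+s≤ : 4 + s ≤ 2 * 2 ^ suc s
        4+s≤ = subst₂ _≤_ (+-comm s 4) (cong (2 ^_) (+-comm s 2)) (linear≤2^ s 4 2 ≤-refl)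
      ... | inj₂ refl = begin
        (4 + q) * 2 ^ T p ≤⟨ *-monoˡ-≤ (2 ^ T p) q+4≤ ⟩
        2 * 2 ^ q * 2 ^ T p ≡⟨ *-assoc 2 (2 ^ q) _ ⟩
        2 * (2 ^ q * 2 ^ T p) ≡⟨ cong (2 *_) (^-distribˡ-+-* 2 q (T p)) ⟨
        2 * 2 ^ (q + T p) ≡⟨ cong (λ z → 2 * 2 ^ z) (trans (cong (q +_) (turánSize-small q ≤-refl))
           (trans (solve 2 (λ q x → q :+ x := x :+ q :* con 1 :+ con 0) refl q (pairs p))
             (trans (cong (pairs p + q * 1 +_) (sym (turánSize-small q {1} (s≤s z≤n)))) (trans (sym (turánSize-step q 1)) (cong T (+-comm p 1)))))) ⟩
        2 * 2 ^ T (1 + p) ∎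
      shift : ∀ s c → 2 ^ T (c + (p + s)) ≡ 2 ^ (pairs p + q * (c + s)) * 2 ^ T (c + s)
      shift s c = trans (cong (λ z → 2 ^ T z) (solve 3 (λ c p s → c :+ (p :+ s) := p :+ (c :+ s)) refl c p s))
        (trans (cong (2 ^_) (turánSize-step q (c + s))) (^-distribˡ-+-* 2 (pairs p + q * (c + s)) _))
      next : ∀ s → (4 + s) * 2 ^ T (suc s) ≤ 2 * 2 ^ T (2 + s) →
        (4 + (p + s)) * 2 ^ T (suc (p + s)) ≤ 2 * 2 ^ T (2 + (p + s))
      next s ih = begin
        (4 + (p + s)) * 2 ^ T (1 + (p + s)) ≤⟨ *-mono-≤ (p+s≤ s) (≤-reflexive (shift s 1)) ⟩
        2 ^ q * (4 + s) * (X * 2 ^ T (1 + s))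
          ≡⟨ solve 4 (λ a b x t → a :* b :* (x :* t) := x :* a :* (b :* t)) refl (2 ^ q) (4 + s) X (2 ^ T (1 + s)) ⟩
        X * 2 ^ q * ((4 + s) * 2 ^ T (1 + s)) ≤⟨ *-monoʳ-≤ (X * 2 ^ q) ih ⟩
        X * 2 ^ q * (2 * 2 ^ T (2 + s))
          ≡⟨ cong (_* (2 * 2 ^ T (2 + s))) (trans (sym (^-distribˡ-+-* 2 (pairs p + q * (1 + s)) q))
               (cong (2 ^_) (solve 3 (λ x q s → x :+ q :* (con 1 :+ s) :+ q := x :+ q :* (con 2 :+ s)) refl (pairs p) q s))) ⟩
        2 ^ (pairs p + q * (2 + s)) * (2 * 2 ^ T (2 + s))
          ≡⟨ solve 2 (λ a b → a :* (con 2 :* b) := con 2 :* (a :* b)) refl (2 ^ (pairs p + q * (2 + s))) (2 ^ T (2 + s)) ⟩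
        2 * (2 ^ (pairs p + q * (2 + s)) * 2 ^ T (2 + s)) ≡⟨ cong (2 *_) (shift s 2) ⟨
        2 * 2 ^ T (2 + (p + s)) ∎
        where X = 2 ^ (pairs p + q * (1 + s))

  clique-extend : ∀ s {N} → 1 ≤ s → N < 2 ^ T (p + s) → N * patterns ℓ (p + s) < 2 ^ T (suc (p + s))
  clique-extend s {N} 1≤s N< =
    <-≤-trans (*-monoˡ-< (patterns ℓ (p + s)) {{>-nonZero (patterns>0 ℓ (p + s))}} N<) (clique-step s 1≤s)

  -- One outside vertex against its average Turán credit, with denominators cleared. Dividing out
  -- the powers of two leaves (s + 2)^p ≤ 2^(p + q·s): this is `cube` for p = 3, and each further
  -- part costs only s + 2 ≤ 2^(s+1).
  patterns-power : ∀ s → 1 ≤ s → patterns ℓ (q + s) ^ p ≤ 2 ^ (q * (p + s))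
  patterns-power s 1≤s = begin
    patterns ℓ (q + s) ^ p
      ≡⟨ cong (_^ p) (trans (cong (patterns ℓ) (solve 2 (λ ℓ s → con 1 :+ ℓ :+ s := con 1 :+ s :+ ℓ) refl ℓ s)) (patterns-large ℓ (1 + s))) ⟩
    ((2 + s) * 2 ^ ℓ) ^ p ≡⟨ ^-distribʳ-* (2 + s) (2 ^ ℓ) p ⟩
    (2 + s) ^ p * (2 ^ ℓ) ^ p ≤⟨ *-mono-≤ (s+2-power s 1≤s) (≤-reflexive (^-*-assoc 2 ℓ p)) ⟩
    2 ^ (p + q * s) * 2 ^ (ℓ * p) ≡⟨ ^-distribˡ-+-* 2 (p + q * s) (ℓ * p) ⟨
    2 ^ (p + q * s + ℓ * p)
      ≡⟨ cong (2 ^_) (solve 3 (λ ℓ p s → p :+ (con 1 :+ ℓ) :* s :+ ℓ :* p := (con 1 :+ ℓ) :* (p :+ s)) refl ℓ p s) ⟩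
    2 ^ (q * (p + s)) ∎
    where
    powers : ∀ m s → 1 ≤ s → (2 + s) ^ (3 + m) ≤ 2 ^ (3 + m + (2 + m) * s)
    powers zero s 1≤s = cube s 1≤s
    powers (suc m) s 1≤s = begin
      (2 + s) * (2 + s) ^ (3 + m) ≤⟨ *-mono-≤ s+2≤ (powers m s 1≤s) ⟩
      2 ^ (1 + s) * 2 ^ (3 + m + (2 + m) * s) ≡⟨ ^-distribˡ-+-* 2 (1 + s) _ ⟨
      2 ^ (1 + s + (3 + m + (2 + m) * s))
        ≡⟨ cong (2 ^_) (solve 2 (λ m s → con 1 :+ s :+ (con 3 :+ m :+ (con 2 :+ m) :* s)
             := con 4 :+ m :+ (con 3 :+ m) :* s) refl m s) ⟩
      2 ^ (4 + m + (3 + m) * s) ∎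
      where
      s+2≤ : 2 + s ≤ 2 ^ (1 + s)
      s+2≤ with s′ , refl ← m≤n⇒∃[o]m+o≡n 1≤s =
        subst₂ _≤_ (+-comm s′ 3) (cong (2 ^_) (+-comm s′ 2)) (linear≤2^ s′ 3 2 (n≤1+n 3))
    s+2-power : ∀ s → 1 ≤ s → (2 + s) ^ p ≤ 2 ^ (p + q * s)
    s+2-power s 1≤s with m , refl ← m≤n⇒∃[o]m+o≡n 1≤ℓ = powers m s 1≤s

  -- The factors are the orientations of the clique, the rows of the m outside vertices, and the
  -- orientations of the remainder. Strictness comes from the first; the rest compares by
  -- `patterns-power` and `turánSize-+`.
  assembled-bound : ∀ s m {N S} → 1 ≤ s → N < 2 ^ T (p + s) → S ≤ 2 ^ T m →
    N * patterns ℓ (q + s) ^ m * S < 2 ^ T (p + s + m)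
  assembled-bound s m {N} {S} 1≤s N< S≤ = begin-strict
    N * G ^ m * S ≤⟨ *-monoʳ-≤ (N * G ^ m) S≤ ⟩
    N * G ^ m * 2 ^ T m ≡⟨ *-assoc N (G ^ m) _ ⟩
    N * (G ^ m * 2 ^ T m) <⟨ *-monoˡ-< (G ^ m * 2 ^ T m)
      {{m*n≢0 _ _ {{m^n≢0 G m {{>-nonZero (patterns>0 ℓ (q + s))}}}} {{m^n≢0 2 (T m)}}}} N< ⟩
    2 ^ T r * (G ^ m * 2 ^ T m) ≤⟨ ^-cancelˡ-≤ p powers ⟩
    2 ^ T (r + m) ∎
    where
    r = p + s
    G = patterns ℓ (q + s)
    powers : (2 ^ T r * (G ^ m * 2 ^ T m)) ^ p ≤ (2 ^ T (r + m)) ^ p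
    powers = begin
      (2 ^ T r * (G ^ m * 2 ^ T m)) ^ p
        ≡⟨ trans (^-distribʳ-* (2 ^ T r) _ p) (cong₂ _*_ (power (T r))
             (trans (^-distribʳ-* (G ^ m) _ p) (cong₂ _*_ (^-swap G m p) (power (T m))))) ⟩
      2 ^ (p * T r) * ((G ^ p) ^ m * 2 ^ (p * T m))
        ≤⟨ *-monoʳ-≤ (2 ^ (p * T r)) (*-monoˡ-≤ (2 ^ (p * T m)) (^-monoˡ-≤ m (patterns-power s 1≤s))) ⟩
      2 ^ (p * T r) * ((2 ^ (q * r)) ^ m * 2 ^ (p * T m))
        ≡⟨ cong (λ z → 2 ^ (p * T r) * (z * 2 ^ (p * T m))) (^-*-assoc 2 (q * r) m) ⟩
      2 ^ (p * T r) * (2 ^ (q * r * m) * 2 ^ (p * T m))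
        ≡⟨ cong (2 ^ (p * T r) *_) (^-distribˡ-+-* 2 (q * r * m) (p * T m)) ⟨
      2 ^ (p * T r) * 2 ^ (q * r * m + p * T m) ≡⟨ ^-distribˡ-+-* 2 (p * T r) _ ⟨
      2 ^ (p * T r + (q * r * m + p * T m))
        ≡⟨ cong (2 ^_) (solve 5 (λ a b q r m → a :+ (q :* r :* m :+ b) := a :+ b :+ q :* (r :* m)) refl
             (p * T r) (p * T m) q r m) ⟩
      2 ^ (p * T r + p * T m + q * (r * m)) ≤⟨ ^-monoʳ-≤ 2 (turánSize-+ q r m) ⟩
      2 ^ (p * T (r + m)) ≡⟨ power (T (r + m)) ⟨
      (2 ^ T (r + m)) ^ p ∎
      where
      power : ∀ x → (2 ^ x) ^ p ≡ 2 ^ (p * x)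
      power x = trans (^-*-assoc 2 x p) (cong (2 ^_) (*-comm x p))

  -- The Turán graph on k = p + 1 vertices is K_k minus one edge, so being below its power of two
  -- means being less than half of all tournaments.
  size-k-clique : ∀ {N} → 2 * N < 2 ^ pairs (suc p) → N < 2 ^ T (suc p)
  size-k-clique {N} h = *-cancelˡ-< 2 N _ (subst (2 * N <_) (cong (2 ^_) e) h)
    where
    e : pairs (suc p) ≡ suc (T (suc p))
    e = trans (solve 2 (λ q x → con 1 :+ q :+ x := con 1 :+ (x :+ q :* con 1 :+ con 0)) refl q (pairs p))
      (cong suc (trans (cong (pairs p + q * 1 +_) (sym (turánSize-small q {1} (s≤s z≤n))))
        (trans (sym (turánSize-step q 1)) (cong T (+-comm p 1)))))

-- The recursion of `Bnd-k-clique`: 3 · 2^(k-2) rows over a tournament that is not strong, 2 over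
-- any other. Less than half is preserved because 3 · 2^(k-2) + 4 ≤ 2^k, which needs k ≥ 4.
more-than-half-strong : ∀ k {N} → 4 ≤ k → 2 * N < 2 ^ pairs k →
  2 * (N * (3 * 2 ^ (k ∸ 2)) + 2 ^ pairs k * 2) < 2 ^ pairs (suc k)
more-than-half-strong k {N} 4≤k h with j , refl ← m≤n⇒∃[o]m+o≡n 4≤k = begin-strict
  2 * (N * (3 * x) + P * 2)
    ≡⟨ solve 3 (λ n x p → con 2 :* (n :* (con 3 :* x) :+ p :* con 2) := con 2 :* n :* (con 3 :* x) :+ p :* con 4) refl N x P ⟩
  2 * N * (3 * x) + P * 4 <⟨ +-monoˡ-< (P * 4) (*-monoˡ-< (3 * x) {{m*n≢0 3 x {{_}} {{m^n≢0 2 (2 + j)}}}} h) ⟩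
  P * (3 * x) + P * 4 ≤⟨ +-monoʳ-≤ (P * (3 * x)) (*-monoʳ-≤ P (^-monoʳ-≤ 2 (m≤m+n 2 j))) ⟩
  P * (3 * x) + P * x ≡⟨ solve 2 (λ p x → p :* (con 3 :* x) :+ p :* x := con 4 :* x :* p) refl P x ⟩
  4 * x * P ≡⟨ cong (_* P) (^-distribˡ-+-* 2 2 (2 + j)) ⟨
  2 ^ (4 + j) * P ≡⟨ ^-distribˡ-+-* 2 (4 + j) (pairs (4 + j)) ⟨
  2 ^ (4 + j + pairs (4 + j)) ∎
  where
  open ≤-Reasoning
  x = 2 ^ (2 + j)
  P = 2 ^ pairs (4 + j)

-- Numerical inequalities for k = 4

module _ where
  private T = turánSize 2
  open ≤-Reasoning

  T₃-4 : T 4 ≡ 5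
  T₃-4 = trans (turánSize-step 2 1) (cong (5 +_) (turánSize-small 2 {1} (s≤s z≤n)))

  T₃-5 : T 5 ≡ 8
  T₃-5 = trans (turánSize-step 2 2) (cong (7 +_) (turánSize-small 2 {2} (s≤s (s≤s z≤n))))

  -- The remainder is a four-vertex graph whose 40 orientations exceed 2^5. Rounding 40 up to 64 is
  -- paid for by the four outside rows, each with the spare factor 2 of `cube-slack` in its cube.
  assembled-bound-4 : ∀ s {N} → 2 ≤ s → N < 2 ^ T (3 + s) → N * patterns 1 (2 + s) ^ 4 * 40 < 2 ^ T (3 + s + 4)
  assembled-bound-4 s {N} 2≤s N< = begin-strict
    N * G ^ 4 * 40 ≤⟨ *-monoʳ-≤ (N * G ^ 4) (m≤m+n 40 24) ⟩
    N * G ^ 4 * 64 ≡⟨ *-assoc N (G ^ 4) 64 ⟩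
    N * (G ^ 4 * 64) <⟨ *-monoˡ-< (G ^ 4 * 64)
      {{m*n≢0 _ _ {{m^n≢0 G 4 {{>-nonZero (patterns>0 1 (2 + s))}}}}}} N< ⟩
    2 ^ T r * (G ^ 4 * 64) ≤⟨ ^-cancelˡ-≤ 3 powers ⟩
    2 ^ T (r + 4) ∎
    where
    r = 3 + s
    G = patterns 1 (2 + s)
    G³ : 2 * G ^ 3 ≤ 2 ^ (2 * r)
    G³ = begin
      2 * G ^ 3 ≡⟨ cong (λ z → 2 * z ^ 3) (trans (cong (patterns 1) (solve 1 (λ s → con 2 :+ s := con 1 :+ s :+ con 1) refl s)) (patterns-large 1 (1 + s))) ⟩
      2 * ((2 + s) * 2) ^ 3 ≡⟨ solve 1 (λ x → con 2 :* ((x :* con 2) :^ 3) := con 2 :* (x :^ 3) :* con 8) refl (2 + s) ⟩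
      2 * (2 + s) ^ 3 * 8 ≤⟨ *-monoˡ-≤ 8 (cube-slack s 2≤s) ⟩
      2 ^ (3 + 2 * s) * 2 ^ 3 ≡⟨ ^-distribˡ-+-* 2 (3 + 2 * s) 3 ⟨
      2 ^ (3 + 2 * s + 3) ≡⟨ cong (2 ^_) (solve 1 (λ s → con 3 :+ con 2 :* s :+ con 3 := con 2 :* (con 3 :+ s)) refl s) ⟩
      2 ^ (2 * r) ∎
    powers : (2 ^ T r * (G ^ 4 * 64)) ^ 3 ≤ (2 ^ T (r + 4)) ^ 3
    powers = begin
      (2 ^ T r * (G ^ 4 * 64)) ^ 3
        -- 64³ = 2^18: four of these factors 2 go to the rows, and the remaining 2^14 = 16384 stays
        -- below 2^15, the cube of 2^(T 4).
        ≡⟨ solve 2 (λ a g → (a :* (g :^ 4 :* con 64)) :^ 3 := a :^ 3 :* ((con 2 :* g :^ 3) :^ 4 :* con 16384)) refl (2 ^ T r) G ⟩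
      (2 ^ T r) ^ 3 * ((2 * G ^ 3) ^ 4 * 16384)
        ≤⟨ *-monoʳ-≤ ((2 ^ T r) ^ 3) (*-monoˡ-≤ 16384 (^-monoˡ-≤ 4 G³)) ⟩
      (2 ^ T r) ^ 3 * ((2 ^ (2 * r)) ^ 4 * 2 ^ 14)
        ≡⟨ cong₂ (λ a b → a * (b * 2 ^ 14)) (^-*-assoc 2 (T r) 3) (^-*-assoc 2 (2 * r) 4) ⟩
      2 ^ (T r * 3) * (2 ^ (2 * r * 4) * 2 ^ 14) ≡⟨ cong (2 ^ (T r * 3) *_) (^-distribˡ-+-* 2 (2 * r * 4) 14) ⟨
      2 ^ (T r * 3) * 2 ^ (2 * r * 4 + 14) ≡⟨ ^-distribˡ-+-* 2 (T r * 3) _ ⟨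
      2 ^ (T r * 3 + (2 * r * 4 + 14)) ≤⟨ ^-monoʳ-≤ 2 (begin
         T r * 3 + (2 * r * 4 + 14)
           ≤⟨ n≤1+n _ ⟩
         1 + (T r * 3 + (2 * r * 4 + 14))
           ≡⟨ solve 2 (λ a r → con 1 :+ (a :* con 3 :+ (con 2 :* r :* con 4 :+ con 14))
                := con 3 :* a :+ con 15 :+ con 2 :* (r :* con 4)) refl (T r) r ⟩
         3 * T r + 15 + 2 * (r * 4) ≡⟨ cong (λ z → 3 * T r + 3 * z + 2 * (r * 4)) T₃-4 ⟨
         3 * T r + 3 * T 4 + 2 * (r * 4) ≤⟨ turánSize-+ 2 r 4 ⟩
         3 * T (r + 4) ≡⟨ *-comm 3 (T (r + 4)) ⟩
         T (r + 4) * 3 ∎) ⟩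
      2 ^ (T (r + 4) * 3) ≡⟨ ^-*-assoc 2 (T (r + 4)) 3 ⟨
      (2 ^ T (r + 4)) ^ 3 ∎

  -- 224 counts the five-vertex core, 6 is `patterns 1 3` for each of the m other vertices, and the
  -- remainder has 1 + m vertices because it contains the fifth core vertex. Three more vertices
  -- multiply the left side by 6³ = 216 against 2^8 = 256, relative to the Turán powers.
  core-bound : ∀ m → 224 * 6 ^ m * 2 ^ T (1 + m) < 2 ^ T (5 + m)
  core-bound = periodic-induction _ 3 base λ m ih → begin-strict
    224 * 6 ^ (3 + m) * 2 ^ T (1 + (3 + m))
      ≡⟨ cong (λ z → 224 * 6 ^ (3 + m) * 2 ^ z) (turánSize-step 2 (1 + m)) ⟩
    224 * 6 ^ (3 + m) * 2 ^ (3 + 2 * (1 + m) + T (1 + m))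
      ≡⟨ cong (224 * 6 ^ (3 + m) *_) (^-distribˡ-+-* 2 (3 + 2 * (1 + m)) (T (1 + m))) ⟩
    224 * 6 ^ (3 + m) * (2 ^ (3 + 2 * (1 + m)) * 2 ^ T (1 + m))
      ≡⟨ solve 3 (λ x y z → con 224 :* (con 6 :* (con 6 :* (con 6 :* x))) :* (y :* z) := con 216 :* y :* (con 224 :* x :* z))
           refl (6 ^ m) (2 ^ (3 + 2 * (1 + m))) (2 ^ T (1 + m)) ⟩
    216 * 2 ^ (3 + 2 * (1 + m)) * (224 * 6 ^ m * 2 ^ T (1 + m))
      ≤⟨ *-monoˡ-≤ _ (*-monoˡ-≤ (2 ^ (3 + 2 * (1 + m))) (m≤m+n 216 40)) ⟩
    2 ^ 8 * 2 ^ (3 + 2 * (1 + m)) * (224 * 6 ^ m * 2 ^ T (1 + m))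
      ≡⟨ cong (_* (224 * 6 ^ m * 2 ^ T (1 + m))) (trans (sym (^-distribˡ-+-* 2 8 (3 + 2 * (1 + m))))
           (cong (2 ^_) (solve 1 (λ m → con 8 :+ (con 3 :+ con 2 :* (con 1 :+ m)) := con 3 :+ con 2 :* (con 5 :+ m)) refl m))) ⟩
    2 ^ (3 + 2 * (5 + m)) * (224 * 6 ^ m * 2 ^ T (1 + m))
      <⟨ *-monoʳ-< (2 ^ (3 + 2 * (5 + m))) {{m^n≢0 2 (3 + 2 * (5 + m))}} ih ⟩
    2 ^ (3 + 2 * (5 + m)) * 2 ^ T (5 + m) ≡⟨ ^-distribˡ-+-* 2 (3 + 2 * (5 + m)) _ ⟨
    2 ^ (3 + 2 * (5 + m) + T (5 + m)) ≡⟨ cong (2 ^_) (turánSize-step 2 (5 + m)) ⟨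
    2 ^ T (5 + (3 + m)) ∎
    where
    T-1 = turánSize-small 2 {1} (s≤s z≤n)
    T-2 = turánSize-small 2 {2} (s≤s (s≤s z≤n))
    T-3 = turánSize-small 2 {3} (s≤s (s≤s (s≤s z≤n)))
    base : ∀ m → m < 3 → 224 * 6 ^ m * 2 ^ T (1 + m) < 2 ^ T (5 + m)
    base 0 _ = subst₂ (λ a b → 224 * 6 ^ 0 * 2 ^ a < 2 ^ b) (sym T-1) (sym T₃-5) (m≤m+n _ _)
    base 1 _ = subst₂ (λ a b → 224 * 6 ^ 1 * 2 ^ a < 2 ^ b) (sym T-2)
      (sym (trans (turánSize-step 2 3) (cong (9 +_) T-3))) (<ᵇ⇒< _ _ _)
    base 2 _ = subst₂ (λ a b → 224 * 6 ^ 2 * 2 ^ a < 2 ^ b) (sym T-3)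
      (sym (trans (turánSize-step 2 4) (cong (11 +_) T₃-4))) (<ᵇ⇒< _ _ _)
    base (suc (suc (suc _))) (s≤s (s≤s (s≤s ())))

  core-bound-4 : 224 * 6 ^ 3 * 40 < 2 ^ T 8
  core-bound-4 = subst (λ b → 224 * 6 ^ 3 * 40 < 2 ^ b)
    (sym (trans (turánSize-step 2 5) (cong (13 +_) T₃-5))) (<ᵇ⇒< _ _ _)

-- Orientations as direction functions

lookup-injective : ∀ {xs : List A} → Unique xs → ∀ {i j} → lookup xs i ≡ lookup xs j → i ≡ j
lookup-injective (_ ∷ _) {Fin.zero} {Fin.zero} e = refl
lookup-injective (x∉ ∷ _) {Fin.zero} {Fin.suc j} e = contradiction e (All.lookup x∉ (∈-lookup j))
lookup-injective (x∉ ∷ _) {Fin.suc i} {Fin.zero} e = contradiction (sym e) (All.lookup x∉ (∈-lookup i))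
lookup-injective (_ ∷ u) {Fin.suc i} {Fin.suc j} e = cong Fin.suc (lookup-injective u e)

index-lookup : ∀ {xs : List A} → Unique xs → ∀ {x} (m : x ∈ xs) {i} → lookup xs i ≡ x → index m ≡ i
index-lookup u m e = lookup-injective u (trans (sym (lookup-index m)) (sym e))

map-toℕ-allFin : ∀ n → map toℕ (allFin n) ≡ upTo n
map-toℕ-allFin n = trans (map-tabulate id toℕ) (go n id)
  where
  go : ∀ n (f : ℕ → ℕ) → tabulate {n = n} (f ∘ toℕ) ≡ applyUpTo f n
  go zero f = refl
  go (suc n) f = cong (f 0 ∷_) (go n (f ∘ suc))

module _ {n} (G : Graph n) where
  private
    forward : Fin n → Fin n → Bool
    forward i j = adj G i j ∧ (toℕ i <ᵇ toℕ j)

    row : Fin n → List (Fin n) → List (Fin n × Fin n)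
    row i = concatMap (λ j → if forward i j then [ (i , j) ] else [])

    rows : List (Fin n) → List (Fin n) → List (Fin n × Fin n)
    rows xs ys = concatMap (λ i → row i ys) xs

    P? = λ (e : Fin n × Fin n) → T? (forward (proj₁ e) (proj₂ e))

    row-filter : ∀ i ys → row i ys ≡ filter P? (map (i ,_) ys)
    row-filter i [] = refl
    row-filter i (y ∷ ys) with forward i y
    ... | true = cong ((i , y) ∷_) (row-filter i ys)
    ... | false = row-filter i ys

    rows-filter : ∀ xs ys → rows xs ys ≡ filter P? (cartesianProduct xs ys)
    rows-filter [] ys = refl
    rows-filter (x ∷ xs) ys = trans (cong₂ _++_ (row-filter x ys) (rows-filter xs ys))
      (sym (filter-++ P? (map (x ,_) ys) (cartesianProduct xs ys)))

    row-length : ∀ i ys → length (row i ys) ≡ deg forward i ys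
    row-length i [] = refl
    row-length i (y ∷ ys) with forward i y
    ... | true = cong suc (row-length i ys)
    ... | false = row-length i ys

    rows-length : ∀ xs ys → length (rows xs ys) ≡ cross forward xs ys
    rows-length [] ys = refl
    rows-length (x ∷ xs) ys = trans (length-++ (row x ys)) (cong₂ _+_ (row-length x ys) (rows-length xs ys))

    forward-< : ∀ {x y} → toℕ x < toℕ y → forward x y ≡ adj G x y
    forward-< x<y rewrite Equivalence.to T-≡ (<⇒<ᵇ x<y) = ∧-identityʳ _

    forward-≮ : ∀ {x y} → ¬ (toℕ x < toℕ y) → forward x y ≡ false
    forward-≮ {x} {y} x≮y rewrite ¬-not {toℕ x <ᵇ toℕ y} {true} (λ e → x≮y (<ᵇ⇒< _ _ (Equivalence.from T-≡ e))) =
      ∧-zeroʳ _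

    sorted-size : ∀ {xs} → AllPairs (λ x y → toℕ x < toℕ y) xs → cross forward xs xs ≡ size (adj G) xs
    sorted-size [] = refl
    sorted-size {x ∷ xs} (l ∷ ls) = cong₂ _+_
      (cong₂ _+_ (cong ind (forward-≮ {x} {x} (<-irrefl refl))) (above l)) (trans (below xs l) (sorted-size ls))
      where
      above : ∀ {ys} → All (λ y → toℕ x < toℕ y) ys → deg forward x ys ≡ deg (adj G) x ys
      above [] = refl
      above (l ∷ ls) = cong₂ _+_ (cong ind (forward-< l)) (above ls)
      below : ∀ ys → All (λ y → toℕ x < toℕ y) ys → cross forward ys (x ∷ xs) ≡ cross forward ys xs
      below [] [] = refl
      below (y ∷ ys) (l ∷ ls) = cong₂ _+_ (cong (λ b → ind b + deg forward y xs) (forward-≮ {y} {x} (<⇒≯ l))) (below ys ls)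

  length-edges : length (edges G) ≡ size (adj G) (allFin n)
  length-edges = trans (rows-length (allFin n) (allFin n)) (sorted-size (AllPairs.tabulate⁺-< {f = id} id))

  edges-unique : Unique (edges G)
  edges-unique = subst Unique (sym (rows-filter (allFin n) (allFin n)))
    (Unique.filter⁺ P? (Unique.cartesianProduct⁺ (Unique.allFin⁺ n) (Unique.allFin⁺ n)))

  ∈-edges⁺ : ∀ {u v} → adj G u v ≡ true → toℕ u < toℕ v → (u , v) ∈ edges G
  ∈-edges⁺ {u} {v} a u<v = subst ((u , v) ∈_) (sym (rows-filter (allFin n) (allFin n)))
    (∈-filter⁺ P? (∈-cartesianProduct⁺ (∈-allFin u) (∈-allFin v))
      (Equivalence.from T-≡ (trans (forward-< u<v) a)))

  ∈-edges⁻ : ∀ {u v} → (u , v) ∈ edges G → adj G u v ≡ true × toℕ u < toℕ v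
  ∈-edges⁻ {u} {v} m =
    let (a , l) = Equivalence.to T-∧ (proj₂ (∈-filter⁻ P? {xs = cartesianProduct (allFin n) (allFin n)}
          (subst ((u , v) ∈_) (rows-filter (allFin n) (allFin n)) m)))
    in Equivalence.to T-≡ a , <ᵇ⇒< _ _ l

  open import Data.List.Membership.DecPropositional (≡-dec (Fin._≟_ {n}) (Fin._≟_ {n})) using (_∈?_)

  opaque
    -- On non-adjacent pairs the value is `false` in both directions, so reversal (`dir-flip`) is
    -- available only along edges and later comparisons are restricted to adjacent pairs.
    dir : Orientation G → Fin n → Fin n → Bool
    dir o u v with (u , v) ∈? edges G
    ... | yes m = Vec.lookup o (index m)
    ... | no _ with (v , u) ∈? edges G
    ...   | yes m = not (Vec.lookup o (index m))
    ...   | no _ = false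

    dir-forward : ∀ o {u v} p → lookup (edges G) p ≡ (u , v) → dir o u v ≡ Vec.lookup o p
    dir-forward o {u} {v} p e with (u , v) ∈? edges G
    ... | yes m = cong (Vec.lookup o) (index-lookup edges-unique m e)
    ... | no ∉ = contradiction (subst (_∈ edges G) e (∈-lookup p)) ∉

    dir-backward : ∀ o {u v} p → lookup (edges G) p ≡ (v , u) → dir o u v ≡ not (Vec.lookup o p)
    dir-backward o {u} {v} p e with (u , v) ∈? edges G
    ... | yes m = contradiction (proj₂ (∈-edges⁻ (subst (_∈ edges G) e (∈-lookup p)))) (<-asym (proj₂ (∈-edges⁻ m)))
    ... | no _ with (v , u) ∈? edges G
    ...   | yes m = cong (not ∘ Vec.lookup o) (index-lookup edges-unique m e)
    ...   | no ∉ = contradiction (subst (_∈ edges G) e (∈-lookup p)) ∉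

  position : ∀ {u v} → adj G u v ≡ true →
    ∃ λ p → lookup (edges G) p ≡ (u , v) ⊎ lookup (edges G) p ≡ (v , u)
  position {u} {v} a with <-cmp (toℕ u) (toℕ v)
  ... | tri< u<v _ _ = let m = ∈-edges⁺ a u<v in index m , inj₁ (sym (lookup-index m))
  ... | tri≈ _ e _ with refl ← toℕ-injective e with () ← trans (sym a) (irrefl G u)
  position {u} {v} a | tri> _ _ v<u =
    let m = ∈-edges⁺ (trans (adj-sym G v u) a) v<u in index m , inj₂ (sym (lookup-index m))

  dir⇒Arc : ∀ o {u v} → adj G u v ≡ true → dir o u v ≡ true → Arc G o u v
  dir⇒Arc o a d with position a
  ... | p , inj₁ e = p , inj₁ (e , trans (sym (dir-forward o p e)) d)
  ... | p , inj₂ e = p , inj₂ (e , not-injective (trans (sym (dir-backward o p e)) d))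

  Arc⇒dir : ∀ o {u v} → Arc G o u v → dir o u v ≡ true
  Arc⇒dir o (p , inj₁ (e , b)) = trans (dir-forward o p e) b
  Arc⇒dir o (p , inj₂ (e , b)) = trans (dir-backward o p e) (cong not b)

  Arc⇒adj : ∀ {o u v} → Arc G o u v → adj G u v ≡ true
  Arc⇒adj (p , inj₁ (e , _)) = proj₁ (∈-edges⁻ (subst (_∈ edges G) e (∈-lookup p)))
  Arc⇒adj {u = u} {v} (p , inj₂ (e , _)) =
    trans (adj-sym G u v) (proj₁ (∈-edges⁻ (subst (_∈ edges G) e (∈-lookup p))))

  dir-flip : ∀ o {u v} → adj G u v ≡ true → dir o v u ≡ not (dir o u v)
  dir-flip o a with position a
  ... | p , inj₁ e = trans (dir-backward o p e) (cong not (sym (dir-forward o p e)))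
  ... | p , inj₂ e = trans (dir-forward o p e) (trans (sym (not-involutive _)) (cong not (sym (dir-backward o p e))))

  dir-injective : ∀ {o o′} → (∀ u v → adj G u v ≡ true → dir o u v ≡ dir o′ u v) → o ≡ o′
  dir-injective {o} {o′} h = trans (sym (Vec.tabulate∘lookup o)) (trans (Vec.tabulate-cong same) (Vec.tabulate∘lookup o′))
    where
    same : ∀ p → Vec.lookup o p ≡ Vec.lookup o′ p
    same p = trans (sym (dir-forward o p refl)) (trans (h _ _ (proj₁ (∈-edges⁻ (∈-lookup p)))) (dir-forward o′ p refl))

t≡turánSize : ∀ q n → t (suc q) n ≡ turánSize q n
t≡turánSize q n = begin
  t (suc q) n ≡⟨ length-edges (turán (suc q) n) ⟩
  size (adj (turán (suc q) n)) (allFin n) ≡⟨ size-map (adj (turán (suc q) n)) (multiAdj q) toℕ (λ _ _ → refl) (allFin n) ⟨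
  size (multiAdj q) (map toℕ (allFin n)) ≡⟨ cong (size (multiAdj q)) (map-toℕ-allFin n) ⟩
  size (multiAdj q) (upTo n) ≡⟨ turánSize-def q n ⟨
  turánSize q n ∎
  where open ≡-Reasoning

-- Strongly connected subtournaments and extensions by one vertex

remove : ∀ {x : A} {ys} → x ∈ ys → ∃ λ zs → ys ↭ x ∷ zs
remove {x = x} m with xs , zs , refl ← ∈-∃++ m = xs ++ zs , ↭-shift x xs zs

Unique-⊆⇒length≤ : ∀ {xs ys : List A} → Unique xs → xs ⊆ ys → length xs ≤ length ys
Unique-⊆⇒length≤ [] _ = z≤n
Unique-⊆⇒length≤ {xs = x ∷ xs} (x∉ ∷ u) sub with zs , p ← remove (sub (here refl)) =
  ≤-trans (s≤s (Unique-⊆⇒length≤ u λ {y} m → strip (All.lookup x∉ m) (∈-resp-↭ p (sub (there m)))))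
    (≤-reflexive (sym (↭-length p)))
  where
  strip : ∀ {y} → x ≢ y → y ∈ x ∷ zs → y ∈ zs
  strip ne (here e) = contradiction (sym e) ne
  strip ne (there m) = m

∈-drop : ∀ ℓ {ys : List A} {y} → y ∈ drop ℓ ys → ∃₂ λ pre post → ys ≡ pre ++ y ∷ post × ℓ ≤ length pre
∈-drop zero m with pre , post , e ← ∈-∃++ m = pre , post , e , z≤n
∈-drop (suc ℓ) {z ∷ ys} m with pre , post , refl , le ← ∈-drop ℓ m = z ∷ pre , post , refl , s≤s le

module _ {n} (G : Graph n) where
  private
    V = Fin n
    O = Orientation G

  open import Data.List.Membership.DecPropositional (Fin._≟_ {n}) using (_∈?_)

  Adj : V → V → Set
  Adj u v = adj G u v ≡ true

  Adj-sym : ∀ {u v} → Adj u v → Adj v u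
  Adj-sym {u} {v} a = trans (adj-sym G v u) a

  Adj⇒≢ : ∀ {u v} → Adj u v → u ≢ v
  Adj⇒≢ {u} a refl with () ← trans (sym a) (irrefl G u)

  Clique : List V → Set
  Clique = AllPairs Adj

  Complete : List V → Set
  Complete S = ∀ {u v} → u ∈ S → v ∈ S → u ≢ v → Adj u v

  Clique⇒Unique : ∀ {S} → Clique S → Unique S
  Clique⇒Unique = AllPairs.map Adj⇒≢

  Clique⇒Complete : ∀ {S} → Clique S → Complete S
  Clique⇒Complete (a ∷ _) (here refl) (here refl) ne = contradiction refl ne
  Clique⇒Complete (a ∷ _) (here refl) (there v) ne = All.lookup a v
  Clique⇒Complete (a ∷ _) (there u) (here refl) ne = Adj-sym (All.lookup a u)
  Clique⇒Complete (_ ∷ c) (there u) (there v) ne = Clique⇒Complete c u v ne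

  Clique-intro : ∀ {S} → Unique S → Complete S → Clique S
  Clique-intro [] c = []
  Clique-intro (x∉ ∷ u) c =
    All.tabulate (λ m → c (here refl) (there m) (All.lookup x∉ m)) ∷ Clique-intro u (λ a b → c (there a) (there b))

  Clique-↭ : ∀ {S S′} → S ↭ S′ → Clique S → Clique S′
  Clique-↭ p = Permₛ.AllPairs-resp-↭ (setoid V) Adj-sym ((λ where refl → id) , (λ where refl → id)) (↭⇒↭ₛ p)

  -- Restriction to a vertex set keeps the orientation of the whole graph and limits only the
  -- cliques, so no induced subgraph is ever formed.
  GoodOn : ℕ → List V → O → Set
  GoodOn k vs o = ∀ S → S ⊆ vs → IsKClique G k S → ¬ StronglyConnectedOn G o S

  GoodOn-⊆ : ∀ {k vs ws o} → ws ⊆ vs → GoodOn k vs o → GoodOn k ws o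
  GoodOn-⊆ sub g S S⊆ = g S (λ m → sub (S⊆ m))

  dir-antisym : ∀ o {u v} → Adj u v → dir G o u v ≡ true → dir G o v u ≡ true → ⊥
  dir-antisym o a d d′ with () ← trans (sym (trans (dir-flip G o a) (cong not d))) d′

  dir-total : ∀ o {u v} → Adj u v → dir G o u v ≢ true → dir G o v u ≡ true
  dir-total o a nd = trans (dir-flip G o a) (cong not (¬-not nd))

  module _ {o : O} where
    PathIn-trans : ∀ {S u v w} → PathIn G o S u v → PathIn G o S v w → PathIn G o S u w
    PathIn-trans here q = q
    PathIn-trans (step a m p) q = step a m (PathIn-trans p q)

    PathIn-⊆ : ∀ {S S′ u v} → S ⊆ S′ → PathIn G o S u v → PathIn G o S′ u v
    PathIn-⊆ sub here = here
    PathIn-⊆ sub (step a m p) = step a (sub m) (PathIn-⊆ sub p)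

    strong-from-hub : ∀ {S} h → (∀ {u} → u ∈ S → PathIn G o S u h × PathIn G o S h u) →
      StronglyConnectedOn G o S
    strong-from-hub h f u v = PathIn-trans (proj₁ (f u)) (proj₂ (f v))

    path-crossing : ∀ {S u v} (P : V → Set) → (∀ x → Dec (P x)) → PathIn G o S u v → u ∈ S → ¬ P u → P v →
      ∃₂ λ a b → a ∈ S × b ∈ S × Arc G o a b × ¬ P a × P b
    path-crossing P P? here _ ¬p p = contradiction p ¬p
    path-crossing P P? (step {w = w} a w∈ path) u∈ ¬pu pv with P? w
    ... | yes pw = _ , w , u∈ , w∈ , a , ¬pu , pw
    ... | no ¬pw = path-crossing P P? path w∈ ¬pw pv

    strong-∷ : ∀ {C x a b} → StronglyConnectedOn G o C → a ∈ C → b ∈ C → Arc G o x a → Arc G o b x →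
      StronglyConnectedOn G o (x ∷ C)
    strong-∷ {C} {x} {a} {b} st a∈ b∈ xa bx = strong-from-hub x λ where
      (here refl) → here , here
      (there u∈) → PathIn-trans (PathIn-⊆ there (st u∈ b∈)) (step bx (here refl) here) ,
        step xa (there a∈) (PathIn-⊆ there (st a∈ u∈))

    -- Every c in `D` lies on the triangle c → a → b → c, whatever the arcs inside `D` are.
    strong-around : ∀ {D d a b} → d ∈ D → Arc G o a b → (∀ {c} → c ∈ D → Arc G o c a) →
      (∀ {c} → c ∈ D → Arc G o b c) → StronglyConnectedOn G o (a ∷ b ∷ D)
    strong-around {D} {d} {a} {b} d∈ ab to from = strong-from-hub a λ where
      (here refl) → here , here
      (there (here refl)) → step (from d∈) (there (there d∈)) (step (to d∈) (here refl) here) ,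
        step ab (there (here refl)) here
      (there (there c∈)) → step (to c∈) (here refl) here ,
        step ab (there (here refl)) (step (from c∈) (there (there c∈)) here)

    Directed : V → V → Set
    Directed u v = Adj u v × dir G o u v ≡ true

    Directed⇒Arc : ∀ {u v} → Directed u v → Arc G o u v
    Directed⇒Arc (a , d) = dir⇒Arc G o a d

    linked-from-head : ∀ {S x xs} → x ∷ xs ⊆ S → Linked Directed (x ∷ xs) → ∀ {u} → u ∈ x ∷ xs → PathIn G o S x u
    linked-from-head sub l (here refl) = here
    linked-from-head sub (d ∷ l) (there m) =
      step (Directed⇒Arc d) (sub (there (here refl))) (linked-from-head (sub ∘ there) l m)

    linked-to-last : ∀ {S} xs {y} → xs ++ [ y ] ⊆ S → Linked Directed (xs ++ [ y ]) →
      ∀ {u} → u ∈ xs ++ [ y ] → PathIn G o S u y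
    linked-to-last [] sub l (here refl) = here
    linked-to-last (x ∷ []) sub (d ∷ l) (here refl) = step (Directed⇒Arc d) (sub (there (here refl))) here
    linked-to-last (x ∷ z ∷ xs) sub (d ∷ l) (here refl) =
      step (Directed⇒Arc d) (sub (there (here refl))) (linked-to-last (z ∷ xs) (sub ∘ there) l (here refl))
    linked-to-last (x ∷ []) sub (d ∷ l) (there (here refl)) = here
    linked-to-last (x ∷ z ∷ xs) sub (d ∷ l) (there m) = linked-to-last (z ∷ xs) (sub ∘ there) l m

    cycle-strong : ∀ v xs y → Linked Directed (v ∷ xs ++ [ y ]) → Directed y v →
      StronglyConnectedOn G o (v ∷ xs ++ [ y ])
    cycle-strong v xs y l yv = strong-from-hub v λ m →
      PathIn-trans (linked-to-last (v ∷ xs) id l m) (step (Directed⇒Arc yv) (here refl) here) ,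
      linked-from-head id l m

    -- Every vertex outside C has arcs both to and from C, dominates C, or is dominated by C; if no
    -- vertex is of the first kind, strong connectivity forces an arc from the third to the second.
    module _ {S} (complete : Complete S) (strong : StronglyConnectedOn G o S) where
      private
        Into Outof Mixed : List V → V → Set
        Into C y = All (λ c → dir G o y c ≡ true) C
        Outof C y = All (λ c → dir G o c y ≡ true) C
        Mixed C y = y ∉ C × Any (λ c → dir G o y c ≡ true) C × Any (λ c → dir G o c y ≡ true) C

        Mixed? : ∀ C y → Dec (Mixed C y)
        Mixed? C y = ¬? (y ∈? C) ×-dec any? (λ c → dir G o y c Bool.≟ true) C ×-dec any? (λ c → dir G o c y Bool.≟ true) C

      Detour : List V → Set
      Detour C = ∃₂ λ a b → a ∈ S × b ∈ S × a ∉ C × b ∉ C × a ≢ b × Arc G o a b ×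
        (∀ {c} → c ∈ C → Arc G o c a) × (∀ {c} → c ∈ C → Arc G o b c)

      outside-cases : ∀ {C c x} → C ⊆ S → c ∈ C → x ∈ S → x ∉ C →
        (∃ λ y → y ∈ S × y ∉ C × ∃₂ λ a b → a ∈ C × b ∈ C × Arc G o y a × Arc G o b y) ⊎
        Detour C
      outside-cases {C} {c} {x} C⊆S c∈C x∈S x∉C with any? (Mixed? C) S
      ... | yes m with y , y∈S , y∉C , out , inn ← find m
                  with a , a∈ , ya ← find out | b , b∈ , by ← find inn =
        inj₁ (y , y∈S , y∉C , a , b , a∈ , b∈ ,
          dir⇒Arc G o (near y∈S y∉C a∈) ya , dir⇒Arc G o (Adj-sym (near y∈S y∉C b∈)) by)
        where
        near : ∀ {y a} → y ∈ S → y ∉ C → a ∈ C → Adj y a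
        near y∈S y∉C a∈ = complete y∈S (C⊆S a∈) λ where refl → y∉C a∈
      ... | no none = inj₂ (build (classify x∈S x∉C))
        where
        near : ∀ {y a} → y ∈ S → y ∉ C → a ∈ C → Adj y a
        near y∈S y∉C a∈ = complete y∈S (C⊆S a∈) λ where refl → y∉C a∈

        classify : ∀ {y} → y ∈ S → y ∉ C → Into C y ⊎ Outof C y
        classify {y} y∈S y∉C with any? (λ c → dir G o c y Bool.≟ true) C
        ... | no ¬in = inj₁ (All.tabulate λ {a} a∈ →
                dir-total o (Adj-sym (near y∈S y∉C a∈)) λ d → ¬in (lose a∈ d))
        ... | yes in′ = inj₂ (All.tabulate λ {a} a∈ →
                dir-total o (near y∈S y∉C a∈) λ d → none (lose y∈S (y∉C , lose a∈ d , in′)))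

        distinct : ∀ {a b} → a ∈ S → a ∉ C → Outof C a → Into C b → a ≢ b
        distinct a∈S a∉C outa intb refl =
          dir-antisym o (near a∈S a∉C c∈C) (All.lookup intb c∈C) (All.lookup outa c∈C)

        finish : ∀ {a b} → a ∈ S → b ∈ S → a ∉ C → b ∉ C → Arc G o a b → Outof C a → Into C b → Detour C
        finish {a} {b} a∈S b∈S a∉C b∉C ab outa intb =
          a , b , a∈S , b∈S , a∉C , b∉C , distinct a∈S a∉C outa intb , ab ,
          (λ c∈ → dir⇒Arc G o (Adj-sym (near a∈S a∉C c∈)) (All.lookup outa c∈)) ,
          (λ c∈ → dir⇒Arc G o (near b∈S b∉C c∈) (All.lookup intb c∈))

        build : Into C x ⊎ Outof C x → Detour C
        build (inj₁ into)
          with path-crossing (λ y → y ∉ C × Into C y)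
                 (λ y → ¬? (y ∈? C) ×-dec all? (λ c → dir G o y c Bool.≟ true) C)
                 (strong (C⊆S c∈C) x∈S) (C⊆S c∈C) (λ (c∉ , _) → c∉ c∈C) (x∉C , into)
        ... | a , b , a∈S , b∈S , ab , ¬pa , (b∉C , intb) with a ∈? C
        ...   | yes a∈C = ⊥-elim (dir-antisym o (near b∈S b∉C a∈C) (All.lookup intb a∈C) (Arc⇒dir G o ab))
        ...   | no a∉C with classify a∈S a∉C
        ...     | inj₁ inta = contradiction (a∉C , inta) ¬pa
        ...     | inj₂ outa = finish a∈S b∈S a∉C b∉C ab outa intb
        build (inj₂ outof)
          -- The mirror case needs an arc leaving the set dominated by C, that is, one entering its
          -- complement.
          with path-crossing (λ y → ¬ (y ∉ C × Outof C y))
                 (λ y → ¬? (¬? (y ∈? C) ×-dec all? (λ c → dir G o c y Bool.≟ true) C))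
                 (strong x∈S (C⊆S c∈C)) x∈S (λ k → k (x∉C , outof)) (λ (c∉ , _) → c∉ c∈C)
        ... | a , b , a∈S , b∈S , ab , ¬¬pa , ¬pb
          with a∉C , outa ← decidable-stable (¬? (a ∈? C) ×-dec all? (λ c → dir G o c a Bool.≟ true) C) ¬¬pa
          with b ∈? C
        ...   | yes b∈C = ⊥-elim (dir-antisym o (near a∈S a∉C b∈C) (Arc⇒dir G o ab) (All.lookup outa b∈C))
        ...   | no b∉C with classify b∈S b∉C
        ...     | inj₁ intb = finish a∈S b∈S a∉C b∉C ab outa intb
        ...     | inj₂ outb = contradiction (b∉C , outb) ¬pb

      StrongOfSize : ℕ → Set
      StrongOfSize m = ∃ λ C → C ⊆ S × Unique C × StronglyConnectedOn G o C × length C ≡ m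

      -- Moon's theorem, growing a strong set one vertex at a time. A mixed vertex can be added.
      -- Otherwise a detour a → b makes a and b strong together with any nonempty part of C, so two
      -- vertices enter and one leaves.
      strong-subset : Unique S → ∀ j → 3 + j ≤ length S → StrongOfSize (3 + j)
      strong-subset uS zero le = start S uS id le
        where
        start : ∀ S′ → Unique S′ → S′ ⊆ S → 3 ≤ length S′ → StrongOfSize 3
        -- A vertex mixed with respect to `[ x ]` would have arcs to and from x, so only the detour
        -- is left, and it yields a triangle.
        start (x ∷ y ∷ _) ((x≢y ∷ _) ∷ _) sub _
          with outside-cases {C = [ x ]} (λ where (here refl) → sub (here refl)) (here refl)
                 (sub (there (here refl))) (λ where (here e) → x≢y (sym e))
        ... | inj₁ (z , z∈S , z∉ , a , b , here refl , here refl , za , bz) =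
          ⊥-elim (dir-antisym o (complete z∈S (sub (here refl)) λ where refl → z∉ (here refl))
            (Arc⇒dir G o za) (Arc⇒dir G o bz))
        ... | inj₂ (a , b , a∈S , b∈S , a∉ , b∉ , a≢b , ab , to , from) =
          a ∷ b ∷ [ x ] ,
          (λ where (here refl) → a∈S
                   (there (here refl)) → b∈S
                   (there (there (here refl))) → sub (here refl)) ,
          ((a≢b ∷ (λ where refl → a∉ (here refl)) ∷ []) ∷ ((λ where refl → b∉ (here refl)) ∷ []) ∷ [] ∷ []) ,
          strong-around (here refl) ab to from , refl
        start (x ∷ []) _ _ (s≤s ())
      strong-subset uS (suc j) le with strong-subset uS j (≤-trans (n≤1+n _) le)
      ... | c ∷ C , C⊆S , c∉ ∷ uC , st , len with all? (_∈? (c ∷ C)) S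
      ...   | yes all = contradiction (≤-trans le (≤-trans (Unique-⊆⇒length≤ uS (All.lookup all)) (≤-reflexive len)))
                          (<⇒≱ ≤-refl)
      ...   | no ¬all with x , x∈S , x∉C ← find (All.¬All⇒Any¬ (_∈? (c ∷ C)) S ¬all)
                      with outside-cases C⊆S (here refl) x∈S x∉C
      ...     | inj₁ (y , y∈S , y∉C , a , b , a∈ , b∈ , ya , by) =
        y ∷ c ∷ C , (λ where (here refl) → y∈S
                             (there m) → C⊆S m) ,
        All.tabulate (λ m → λ where refl → y∉C m) ∷ c∉ ∷ uC , strong-∷ st a∈ b∈ ya by , cong suc len
      -- The vertex c is dropped; d keeps the rest nonempty, as `strong-around` requires.
      strong-subset uS (suc j) le | c ∷ d ∷ C , C⊆S , c∉ ∷ uC , st , len | no _ | inj₂ (a , b , a∈S , b∈S , a∉ , b∉ , a≢b , ab , to , from) =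
        a ∷ b ∷ d ∷ C ,
        (λ where (here refl) → a∈S
                 (there (here refl)) → b∈S
                 (there (there m)) → C⊆S (there m)) ,
        ((a≢b ∷ All.tabulate (λ m → λ where refl → a∉ (there m)))
         ∷ All.tabulate (λ m → λ where refl → b∉ (there m)) ∷ uC) ,
        strong-around (here refl) ab (to ∘ there) (from ∘ there) , cong suc len

  good⇒no-strong-clique : ∀ {ℓ vs o S} → GoodOn (3 + ℓ) vs o → S ⊆ vs → Clique S → 3 + ℓ ≤ length S →
    ¬ StronglyConnectedOn G o S
  good⇒no-strong-clique good S⊆ cl le st
    with C , C⊆S , uC , stC , len ← strong-subset (Clique⇒Complete cl) st (Clique⇒Unique cl) _ le =
    good C (S⊆ ∘ C⊆S) (len , uC , λ a b → Clique⇒Complete cl (C⊆S a) (C⊆S b)) stC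

  module _ (o : O) where
    private
      _⇒_ = Directed {o}

    insert-after : ∀ {z x xs} → z ⇒ x → Linked _⇒_ (z ∷ xs) → All (Adj x) xs →
      ∃ λ ys → ys ↭ x ∷ xs × Linked _⇒_ (z ∷ ys)
    insert-after {x = x} {[]} zx l a = [ x ] , ↭-refl , zx ∷ [-]
    insert-after {z} {x} {y ∷ xs} zx (zy ∷ l) (a ∷ as) with dir G o x y Bool.≟ true
    ... | yes xy = x ∷ y ∷ xs , ↭-refl , zx ∷ (a , xy) ∷ l
    ... | no ¬xy with ys , p , l′ ← insert-after (Adj-sym a , dir-total o a ¬xy) l as =
      y ∷ ys , ↭-trans (prep y p) (swap y x ↭-refl) , zy ∷ l′

    -- Rédei's theorem by insertion: x goes directly before the first vertex of the path that it
    -- beats, or to the end.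
    hamiltonian-path : ∀ {xs} → Clique xs → ∃ λ ys → ys ↭ xs × Linked _⇒_ ys
    hamiltonian-path [] = [] , ↭-refl , []
    hamiltonian-path {x ∷ xs} (as ∷ cl) with hamiltonian-path cl
    ... | [] , p , l = [ x ] , prep x p , [-]
    ... | y ∷ ys , p , l with All-resp-↭ (↭-sym p) as
    ...   | a ∷ as′ with dir G o x y Bool.≟ true
    ...     | yes xy = x ∷ y ∷ ys , prep x p , (a , xy) ∷ l
    ...     | no ¬xy with zs , q , l′ ← insert-after (Adj-sym a , dir-total o a ¬xy) l as′ =
      y ∷ zs , ↭-trans (prep y q) (↭-trans (swap y x ↭-refl) (prep x p)) , l′

  -- Orientations agreeing on blocks of vertex pairs

  -- With two vertex lists, one relation covers an induced part (`X` = `Y`), the row of a single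
  -- vertex (`X` = `[ v ]`) and all arcs between two sets.
  record Agree (X Y : List V) (o o′ : O) : Set where
    constructor agreeing
    field same : ∀ {x y} → x ∈ X → y ∈ Y → Adj x y → dir G o x y ≡ dir G o′ x y
  open Agree public

  length-neighbours : ∀ v W → length (filter (λ w → adj G v w Bool.≟ true) W) ≡ deg (adj G) v W
  length-neighbours v [] = refl
  length-neighbours v (w ∷ W) with adj G v w
  ... | true = cong suc (length-neighbours v W)
  ... | false = length-neighbours v W

  Agree-trans : ∀ {X Y o o′ o″} → Agree X Y o o′ → Agree X Y o o″ → Agree X Y o′ o″
  same (Agree-trans p q) x y a = trans (sym (same p x y a)) (same q x y a)

  Agree-flip : ∀ {X Y o o′} → Agree X Y o o′ → Agree Y X o o′
  same (Agree-flip {o = o} {o′} p) y x a = trans (dir-flip G o (Adj-sym a))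
    (trans (cong not (same p x y (Adj-sym a))) (sym (dir-flip G o′ (Adj-sym a))))

  Agree-∷ : ∀ {v W o o′} → Agree W W o o′ → Agree [ v ] W o o′ → Agree (v ∷ W) (v ∷ W) o o′
  same (Agree-∷ p q) (here refl) (here refl) a = contradiction refl (Adj⇒≢ a)
  same (Agree-∷ p q) (here refl) (there y) a = same q (here refl) y a
  same (Agree-∷ p q) (there x) (here refl) a = same (Agree-flip q) x (here refl) a
  same (Agree-∷ p q) (there x) (there y) a = same p x y a

  Agree-refl : ∀ {X Y o} → Agree X Y o o
  same Agree-refl _ _ _ = refl

  Bnd-row : ∀ {P : O → Set} v W → Bnd P (Agree [ v ] W) (2 ^ deg (adj G) v W)
  Bnd-row v W = Bnd-transfer
    (≤-reflexive (cong (2 ^_) (trans (length-map _ (filter N? W)) (length-neighbours v W)))) id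
    (λ _ _ e → agreeing λ where (here refl) w∈ a → All.lookup (All.map⁻ e) (∈-filter⁺ N? w∈ a))
    (Bnd-bits (map (λ w o → dir G o v w) (filter N? W)))
    where N? = λ w → adj G v w Bool.≟ true

  Bnd-all : ∀ {P : O → Set} vs → Bnd P (Agree vs vs) (2 ^ size (adj G) vs)
  Bnd-all [] = Bnd-one λ _ _ → agreeing λ ()
  Bnd-all {P} (v ∷ vs) = Bnd-transfer
    (≤-reflexive (trans (*-comm (2 ^ size (adj G) vs) _) (sym (^-distribˡ-+-* 2 (deg (adj G) v vs) _)))) id (λ _ _ e → e)
    (Bnd-prod {P = P} {_~_ = Agree (v ∷ vs) (v ∷ vs)} Agree-refl (λ _ _ → Bnd-row v vs)
      (λ _ _ _ p q r → Agree-∷ (Agree-trans p q) r) (Bnd-all vs))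

  -- v with a later part of the path w → … → y is a directed cycle when v → w and y → v.
  good⇒Pattern : ∀ {ℓ vs o v} → GoodOn (3 + ℓ) vs o → ∀ ws → Clique (v ∷ ws) → v ∷ ws ⊆ vs →
    Linked (Directed {o}) ws → Pattern ℓ (map (dir G o v) ws)
  good⇒Pattern good [] _ _ _ = _
  good⇒Pattern {ℓ} {vs} {o} {v} good (w ∷ ws) ((vw ∷ vws) ∷ (aw ∷ cl)) sub l with dir G o v w in eq
  ... | false = good⇒Pattern good ws (vws ∷ cl) (λ where
          (here refl) → sub (here refl)
          (there m) → sub (there (there m))) (Linked.tail l)
  ... | true = subst (All (_≡ true)) (sym (drop-map ℓ ws))
          (All.map⁺ (All.tabulate forced))
    where
    forced : ∀ {y} → y ∈ drop ℓ ws → dir G o v y ≡ true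
    forced {y} m with dir G o v y Bool.≟ true
    ... | yes d = d
    -- As `ℓ ≤ length pre`, the cycle through v, w, `pre` and y has at least ℓ + 3 vertices.
    ... | no ¬d with pre , post , refl , le ← ∈-drop ℓ m =
      ⊥-elim (good⇒no-strong-clique good (sub ∘ Sublist.Any-resp-⊆ sublist)
          (AllPairs-resp-⊑ sublist ((vw ∷ vws) ∷ aw ∷ cl))
          (s≤s (s≤s (≤-trans (s≤s le) (≤-reflexive (sym (trans (length-++ pre) (+-comm (length pre) 1)))))))
        (cycle-strong v (w ∷ pre) y ((vw , eq) ∷ prefix l) (Adj-sym vy , dir-total o vy ¬d)))
      where
      vy : Adj v y
      vy = All.lookup vws (∈-++⁺ʳ pre (here refl))
      sublist : v ∷ w ∷ pre ++ [ y ] ⊑ v ∷ w ∷ pre ++ y ∷ post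
      sublist = refl Sublist.∷ refl Sublist.∷ Sublist.++⁺ Sublist.⊆-refl (refl Sublist.∷ Sublist.minimum post)
      prefix : ∀ {R : V → V → Set} {x xs} → Linked R (x ∷ xs ++ y ∷ post) → Linked R (x ∷ xs ++ [ y ])
      prefix {xs = []} (r ∷ _) = r ∷ [-]
      prefix {xs = _ ∷ _} (r ∷ l) = r ∷ prefix l

  -- All orientations in the fibre agree with `o₀` on W, so one Hamiltonian path of the neighbours
  -- of v, chosen for `o₀`, orders the row of v for every one of them.
  Bnd-extension : ∀ {ℓ vs W v d o₀} → Clique W → v ∷ W ⊆ vs → deg (adj G) v W ≤ d →
    Bnd (λ o → GoodOn (3 + ℓ) vs o × Agree W W o₀ o) (Agree [ v ] W) (patterns ℓ d)
  Bnd-extension {ℓ} {vs} {W} {v} {d} {o₀} clW sub le =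
    Bnd-transfer (patterns-mono ℓ length≤) id (λ _ _ → agree) (Bnd-pattern ℓ fs pattern-holds)
    where
    N? = λ w → adj G v w Bool.≟ true
    N = filter N? W
    path = hamiltonian-path o₀ (AllPairs.filter⁺ N? clW)
    ws = proj₁ path
    ws↭N = proj₁ (proj₂ path)
    fs = map (λ w o → dir G o v w) ws

    ws⁻ : ∀ {w} → w ∈ ws → w ∈ W × Adj v w
    ws⁻ m = ∈-filter⁻ N? (∈-resp-↭ ws↭N m)

    length≤ : length fs ≤ d
    length≤ = begin
      length fs ≡⟨ length-map _ ws ⟩
      length ws ≡⟨ ↭-length ws↭N ⟩
      length N ≡⟨ length-neighbours v W ⟩
      deg (adj G) v W ≤⟨ le ⟩
      d ∎
      where
      open ≤-Reasoning

    agree : ∀ {o o′} → SameBits fs o o′ → Agree [ v ] W o o′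
    same (agree e) (here refl) w∈ a = All.lookup (All.map⁻ e) (∈-resp-↭ (↭-sym ws↭N) (∈-filter⁺ N? w∈ a))

    pattern-holds : ∀ {o} → GoodOn (3 + ℓ) vs o × Agree W W o₀ o → Pattern ℓ (bits fs o)
    pattern-holds {o} (good , ag) = subst (Pattern ℓ) (map-∘ ws)
      (good⇒Pattern good ws
        (All.tabulate (proj₂ ∘ ws⁻) ∷ Clique-↭ (↭-sym ws↭N) (AllPairs.filter⁺ N? clW))
        (λ where (here refl) → sub (here refl)
                 (there m) → sub (there (proj₁ (ws⁻ m))))
        (linked (All.tabulate (proj₁ ∘ ws⁻)) (proj₂ (proj₂ path))))
      where
      linked : ∀ {xs} → All (_∈ W) xs → Linked (Directed {o₀}) xs → Linked (Directed {o}) xs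
      linked _ [] = []
      linked _ [-] = [-]
      linked (x ∷ y ∷ ms) ((a , d) ∷ l) = (a , trans (sym (same ag x y a)) d) ∷ linked (y ∷ ms) l

-- Tournaments on five vertices

nth : List Bool → ℕ → Bool
nth [] _ = false
nth (b ∷ bs) zero = b
nth (b ∷ bs) (suc i) = nth bs i

-- Decodes the strictly upper triangular part of a tournament matrix, stored row by row.
arc : (r : ℕ) → List Bool → Fin r → Fin r → Bool
arc (suc r) bs Fin.zero Fin.zero = false
arc (suc r) bs Fin.zero (Fin.suc j) = nth bs (Fin.toℕ j)
arc (suc r) bs (Fin.suc i) Fin.zero = not (nth bs (Fin.toℕ i))
arc (suc r) bs (Fin.suc i) (Fin.suc j) = arc r (drop r bs) i j

closed-walk : (A → A → Bool) → A → A → List A → Bool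
closed-walk f v u [] = f u v
closed-walk f v u (x ∷ xs) = f u x ∧ closed-walk f v x xs

is-cycle : (A → A → Bool) → List A → Bool
is-cycle f [] = false
is-cycle f (v ∷ xs) = closed-walk f v v xs

no-cycle : List (List A) → (A → A → Bool) → Bool
no-cycle [] f = true
no-cycle (c ∷ cs) f = not (is-cycle f c) ∧ no-cycle cs f

∧-true : ∀ a {b} → a ∧ b ≡ true → a ≡ true × b ≡ true
∧-true true e = refl , e

insertions : A → List A → List (List A)
insertions x [] = [ [ x ] ]
insertions x (y ∷ ys) = (x ∷ y ∷ ys) ∷ map (y ∷_) (insertions x ys)

permutations : List A → List (List A)
permutations [] = [ [] ]
permutations (x ∷ xs) = concatMap (insertions x) (permutations xs)

-- The starting vertex is fixed, so each cyclic order appears only once.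
cycles : List A → List (List A)
cycles [] = []
cycles (x ∷ xs) = map (x ∷_) (permutations xs)

cycles₄ cycles₅ : List (List (Fin 5))
cycles₄ = concatMap cycles ((1F ∷ 2F ∷ 3F ∷ 4F ∷ []) ∷ (0F ∷ 2F ∷ 3F ∷ 4F ∷ []) ∷ (0F ∷ 1F ∷ 3F ∷ 4F ∷ [])
  ∷ (0F ∷ 1F ∷ 2F ∷ 4F ∷ []) ∷ (0F ∷ 1F ∷ 2F ∷ 3F ∷ []) ∷ [])
cycles₅ = cycles (0F ∷ 1F ∷ 2F ∷ 3F ∷ 4F ∷ [])

-- Evaluated over all 1024 tournaments. Only one direction is used: a Hamiltonian cycle makes a set
-- strong, so good orientations avoid all listed cycles and the count is an upper bound.
count-240 : count 10 (λ bs → no-cycle cycles₄ (arc 5 bs)) ≡ 240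
count-240 = refl

count-480 : count 10 (λ bs → no-cycle cycles₅ (arc 5 bs)) ≡ 480
count-480 = refl

open import Data.List.Relation.Unary.Unique.DecPropositional (Fin._≟_ {5}) using (unique?)

module _ {n} (G : Graph n) where
  private
    V = Fin n
    O = Orientation G

  arcs : List V → List (O → Bool)
  arcs [] = []
  arcs (w ∷ ws) = map (λ x o → dir G o w x) ws ++ arcs ws

  arc-dir : ∀ o {W} → Clique G W → ∀ i j → i ≢ j →
    arc (length W) (bits (arcs W) o) i j ≡ dir G o (lookup W i) (lookup W j)
  arc-dir o {_ ∷ _} _ Fin.zero Fin.zero i≢j = contradiction refl i≢j
  arc-dir o {w ∷ ws} _ Fin.zero (Fin.suc j) _ = first ws j
    where
    first : ∀ xs {fs} (j : Fin (length xs)) →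
      nth (bits (map (λ x o → dir G o w x) xs ++ fs) o) (Fin.toℕ j) ≡ dir G o w (lookup xs j)
    first (x ∷ xs) Fin.zero = refl
    first (x ∷ xs) (Fin.suc j) = first xs j
  arc-dir o {w ∷ ws} cl@(a ∷ _) (Fin.suc i) Fin.zero _ = trans (cong not (arc-dir o {w ∷ ws} cl Fin.zero (Fin.suc i) λ ()))
    (sym (dir-flip G o (All.lookup a (∈-lookup i))))
  arc-dir o {w ∷ ws} (_ ∷ cl) (Fin.suc i) (Fin.suc j) ne = trans
    (cong (λ bs → arc (length ws) bs i j) (rest ws)) (arc-dir o cl i j (ne ∘ cong Fin.suc))
    where
    rest : ∀ xs {fs} → drop (length xs) (bits (map (λ x o → dir G o w x) xs ++ fs) o) ≡ bits fs o
    rest [] = refl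
    rest (x ∷ xs) = rest xs

  SameBits⇒bits≡ : ∀ {fs : List (O → Bool)} {o o′} → SameBits fs o o′ → bits fs o ≡ bits fs o′
  SameBits⇒bits≡ [] = refl
  SameBits⇒bits≡ (e ∷ es) = cong₂ _∷_ e (SameBits⇒bits≡ es)

  arcs-agree : ∀ {W o o′} → Clique G W → SameBits (arcs W) o o′ → Agree G W W o o′
  same (arcs-agree {W} {o} {o′} cl e) {x} {y} x∈ y∈ a = begin
    dir G o x y ≡⟨ cong₂ (dir G o) (lookup-index x∈) (lookup-index y∈) ⟩
    dir G o (lookup W i) (lookup W j) ≡⟨ arc-dir o cl i j i≢j ⟨
    arc (length W) (bits (arcs W) o) i j ≡⟨ cong (λ bs → arc (length W) bs i j) (SameBits⇒bits≡ e) ⟩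
    arc (length W) (bits (arcs W) o′) i j ≡⟨ arc-dir o′ cl i j i≢j ⟩
    dir G o′ (lookup W i) (lookup W j) ≡⟨ cong₂ (dir G o′) (lookup-index x∈) (lookup-index y∈) ⟨
    dir G o′ x y ∎
    where
    open ≡-Reasoning
    i = index x∈
    j = index y∈
    i≢j : i ≢ j
    i≢j i≡j = Adj⇒≢ G a (trans (lookup-index x∈) (trans (cong (lookup W) i≡j) (sym (lookup-index y∈))))

  cycle⇒strong : ∀ {o W} → Clique G W → ∀ c → Unique c →
    is-cycle (arc (length W) (bits (arcs W) o)) c ≡ true → StronglyConnectedOn G o (map (lookup W) c)
  cycle⇒strong cl [] _ ()
  cycle⇒strong {o} {W} cl (v ∷ []) _ _ (here refl) (here refl) = here
  cycle⇒strong {o} {W} cl (v ∷ x ∷ xs) (v∉@(v≢x ∷ _) ∷ x∉ ∷ u) e =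
    let e₁ , e₂ = ∧-true (f v x) e
        ys , y , eq , l , last = split x xs v∉ (x∉ ∷ u) e₂
    in subst (λ S → StronglyConnectedOn G o (lookup W v ∷ S)) (sym eq)
      (cycle-strong G (lookup W v) ys y (link ys eq (directed v≢x e₁) l) last)
    where
    f = arc (length W) (bits (arcs W) o)
    _⇒_ = Directed G {o}
    directed : ∀ {i j} → i ≢ j → f i j ≡ true → lookup W i ⇒ lookup W j
    directed {i} {j} i≢j e = Clique⇒Complete G cl (∈-lookup i) (∈-lookup j)
        (i≢j ∘ lookup-injective (Clique⇒Unique G cl)) , trans (sym (arc-dir o cl i j i≢j)) e
    link : ∀ ys {y u z zs} → z ∷ zs ≡ ys ++ [ y ] → u ⇒ z → Linked _⇒_ (ys ++ [ y ]) → Linked _⇒_ (u ∷ ys ++ [ y ])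
    link [] refl r l = r ∷ l
    link (_ ∷ ys) refl r l = r ∷ l
    split : ∀ x xs → All (v ≢_) (x ∷ xs) → Unique (x ∷ xs) → closed-walk f v x xs ≡ true →
      ∃₂ λ ys y → map (lookup W) (x ∷ xs) ≡ ys ++ [ y ] × Linked _⇒_ (ys ++ [ y ]) × y ⇒ lookup W v
    split x [] (v≢x ∷ _) _ e = [] , _ , refl , [-] , directed (v≢x ∘ sym) e
    split x (z ∷ zs) (_ ∷ v∉) ((x≢z ∷ _) ∷ u) e with e₁ , e₂ ← ∧-true (f x z) e
      with ys , y , eq , l , last ← split z zs v∉ u e₂ =
      lookup W x ∷ ys , y , cong (lookup W x ∷_) eq , link ys eq (directed x≢z e₁) l , last

  good⇒no-cycle : ∀ {k o W} → Clique G W → GoodOn G k W o → ∀ cs →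
    All (λ c → Unique c × length c ≡ k) cs → no-cycle cs (arc (length W) (bits (arcs W) o)) ≡ true
  good⇒no-cycle cl good [] [] = refl
  good⇒no-cycle {k} {o} {W} cl good (c ∷ cs) ((uc , len) ∷ hs)
    with is-cycle (arc (length W) (bits (arcs W) o)) c in eq
  ... | false = good⇒no-cycle cl good cs hs
  ... | true = ⊥-elim (good S S⊆W
          (trans (length-map _ c) len , uS , λ a b → Clique⇒Complete G cl (S⊆W a) (S⊆W b))
          (cycle⇒strong cl c uc eq))
    where
    S = map (lookup W) c
    S⊆W : ∀ {x} → x ∈ S → x ∈ W
    S⊆W m with i , _ , refl ← ∈-map⁻ (lookup W) m = ∈-lookup i
    uS : Unique S
    uS = Unique.map⁺ (lookup-injective (Clique⇒Unique G cl)) uc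

  Bnd-K₅ : ∀ {k W} cs → Clique G W → length W ≡ 5 → All (λ c → Unique c × length c ≡ k) cs →
    Bnd (GoodOn G k W) (Agree G W W) (count 10 (λ bs → no-cycle cs (arc 5 bs)))
  Bnd-K₅ {k} {W@(_ ∷ _ ∷ _ ∷ _ ∷ _ ∷ [])} cs cl refl hs =
    Bnd-transfer ≤-refl id (λ _ _ → arcs-agree cl)
      (Bnd-test (λ bs → no-cycle cs (arc 5 bs)) (arcs W) λ good → good⇒no-cycle cl good cs hs)

  Bnd-K₅-no-strong-K₄ : ∀ {W} → Clique G W → length W ≡ 5 → Bnd (GoodOn G 4 W) (Agree G W W) 240
  Bnd-K₅-no-strong-K₄ cl len = subst (Bnd _ _) count-240
    (Bnd-K₅ cycles₄ cl len (from-yes (All.all? (λ c → unique? c ×-dec length c ≟ 4) cycles₄)))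

  Bnd-K₅-no-strong-K₅ : ∀ {W} → Clique G W → length W ≡ 5 → Bnd (GoodOn G 5 W) (Agree G W W) 480
  Bnd-K₅-no-strong-K₅ cl len = subst (Bnd _ _) count-480
    (Bnd-K₅ cycles₅ cl len (from-yes (All.all? (λ c → unique? c ×-dec length c ≟ 5) cycles₅)))

-- Bounds for small cliques

module _ {n} (G : Graph n) where
  private
    V = Fin n
    O = Orientation G
  open import Data.List.Membership.DecPropositional (Fin._≟_ {n}) using (_∈?_)

  spanning : ∀ {S W : List V} → Unique S → S ⊆ W → length W ≤ length S → W ⊆ S
  spanning {S} {W} uS S⊆W le {x} x∈W with x ∈? S
  ... | yes m = m
  ... | no x∉S = contradiction (Unique-⊆⇒length≤ (All.tabulate (λ m → λ where refl → x∉S m) ∷ uS)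
                    (λ where (here refl) → x∈W
                             (there m) → S⊆W m)) (<⇒≱ (s≤s le))

  -- A violating k-subset of a set of size k is the whole set. The double negation remains because
  -- failure of `GoodOn` provides no actual subset.
  ¬good⇒strong : ∀ {k W o} → length W ≡ k → ¬ GoodOn G k W o → ¬ ¬ StronglyConnectedOn G o W
  ¬good⇒strong {k} {W} {o} len ¬good ¬strong = ¬good λ S S⊆W (lenS , uS , _) strong →
    let W⊆S = spanning uS S⊆W (≤-reflexive (trans len (sym lenS)))
    in ¬strong (λ u∈ v∈ → PathIn-⊆ G S⊆W (strong (W⊆S u∈) (W⊆S v∈)))

  module _ {ℓ vs v W} (sub : v ∷ W ⊆ vs) (clique : Clique G (v ∷ W)) (len : length W ≡ 2 + ℓ) where

    -- W has k - 1 vertices and is strong; if v had arcs both to and from W, then v together with W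
    -- would be a strong k-clique.
    constant-row : ∀ {o} → GoodOn G (3 + ℓ) vs o → ¬ GoodOn G (2 + ℓ) W o →
      ∀ {a b} → a ∈ W → b ∈ W → dir G o v a ≡ dir G o v b
    constant-row {o} good ¬good {a} {b} a∈ b∈ = decidable-stable (_ Bool.≟ _) λ ne →
      ¬good⇒strong len ¬good λ strong → clash strong ne
      where
      v-adj : ∀ {x} → x ∈ W → Adj G v x
      v-adj = All.lookup (AllPairs.head clique)
      extended : StronglyConnectedOn G o W → ∀ {a b} → a ∈ W → b ∈ W → dir G o v a ≡ true → dir G o v b ≡ false → ⊥
      extended strong a∈ b∈ va vb = good⇒no-strong-clique G good sub clique (≤-reflexive (cong suc (sym len)))
        (strong-∷ G strong a∈ b∈ (dir⇒Arc G o (v-adj a∈) va)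
          (dir⇒Arc G o (Adj-sym G (v-adj b∈)) (trans (dir-flip G o (v-adj b∈)) (cong not vb))))
      clash : StronglyConnectedOn G o W → dir G o v a ≢ dir G o v b → ⊥
      clash strong ne with dir G o v a in ea | dir G o v b in eb
      ... | true | true = ne refl
      ... | false | false = ne refl
      ... | true | false = extended strong a∈ b∈ ea eb
      ... | false | true = extended strong b∈ a∈ eb ea

  Bnd-constant-row : ∀ {P : O → Set} {ℓ vs v W} → v ∷ W ⊆ vs → Clique G (v ∷ W) → length W ≡ 2 + ℓ →
    (∀ {o} → P o → GoodOn G (3 + ℓ) vs o × ¬ GoodOn G (2 + ℓ) W o) → Bnd P (Agree G [ v ] W) 2
  Bnd-constant-row {P} {v = v} {w ∷ ws} sub clique len h = Bnd-transfer {P = P} ≤-refl id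
    (λ { {x} {y} p q (e ∷ []) → agreeing λ where
        (here refl) m _ → trans (const p m (here refl)) (trans e (sym (const q m (here refl)))) })
    (Bnd-bits [ (λ o → dir G o v w) ])
    where
    const : ∀ {o} → P o → ∀ {a b} → a ∈ w ∷ ws → b ∈ w ∷ ws → dir G o v a ≡ dir G o v b
    const p = constant-row sub clique len (proj₁ (h p)) (proj₂ (h p))

  Bnd-∷ : ∀ {P : O → Set} {v W N M} → Bnd P (Agree G W W) N →
    (∀ o₀ → P o₀ → Bnd (λ o → P o × Agree G W W o₀ o) (Agree G [ v ] W) M) →
    Bnd P (Agree G (v ∷ W) (v ∷ W)) (N * M)
  Bnd-∷ {P} b f = Bnd-prod {P = P} (Agree-refl G) f
    (λ _ _ _ p q r → Agree-∷ G (Agree-trans G p q) r) b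

  Bnd-clique-∷ : ∀ {ℓ v W N} → Clique G (v ∷ W) → Bnd (GoodOn G (3 + ℓ) W) (Agree G W W) N →
    Bnd (GoodOn G (3 + ℓ) (v ∷ W)) (Agree G (v ∷ W) (v ∷ W)) (N * patterns ℓ (length W))
  Bnd-clique-∷ {ℓ} {v} {W} (a ∷ cl) b =
    Bnd-∷ (Bnd-transfer ≤-refl (GoodOn-⊆ G there) (λ _ _ e → e) b)
      (λ o₀ _ → Bnd-extension G cl id (deg-≤ (adj G) v W))

  -- Splits by whether W, of size k - 1, is strong. If not, `Bnd-extension` allows
  -- `patterns ℓ (2 + ℓ)` = 3 · 2^ℓ rows; if it is, the row of v is constant.
  Bnd-k-clique : ∀ {ℓ v W N M} → Clique G (v ∷ W) → length W ≡ 2 + ℓ →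
    Bnd (GoodOn G (2 + ℓ) W) (Agree G W W) N → Bnd (λ o → ¬ GoodOn G (2 + ℓ) W o) (Agree G W W) M →
    Bnd (GoodOn G (3 + ℓ) (v ∷ W)) (Agree G (v ∷ W) (v ∷ W)) (N * (3 * 2 ^ ℓ) + M * 2)
  Bnd-k-clique {ℓ} {v} {W} {N} clique@(a ∷ cl) len bN bM = Bnd-split (GoodOn G (2 + ℓ) W)
    (Bnd-∷ (Bnd-transfer ≤-refl proj₂ (λ _ _ e → e) bN)
      (λ o₀ _ → Bnd-transfer (≤-reflexive (trans (cong (patterns ℓ) len) (patterns-large ℓ 2)))
        (λ ((g , _) , e) → g , e) (λ _ _ e → e) (Bnd-extension G cl id (deg-≤ (adj G) v W))))
    (Bnd-∷ (Bnd-transfer ≤-refl proj₂ (λ _ _ e → e) bM)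
      (λ o₀ _ → Bnd-constant-row id clique len proj₁))

  strong⇒out-arc : ∀ {o S u v} → StronglyConnectedOn G o S → u ∈ S → v ∈ S → u ≢ v →
    ∃ λ w → w ∈ S × Directed G {o} u w
  strong⇒out-arc {o} strong u∈ v∈ u≢v with strong u∈ v∈
  ... | here = contradiction refl u≢v
  ... | step a w∈ _ = _ , w∈ , Arc⇒adj G {o} a , Arc⇒dir G o a

  private
    out-degrees-positive : List Bool → Bool
    out-degrees-positive (ab ∷ ac ∷ bc ∷ []) = (ab ∨ ac) ∧ (not ab ∨ bc) ∧ (not ac ∨ not bc)
    out-degrees-positive _ = false

  -- In a strong triangle every vertex has an arc out, a test passed only by the two cyclic
  -- triangles.
  Bnd-strong-triangle : ∀ {A} → Clique G A → length A ≡ 3 → Bnd (λ o → ¬ GoodOn G 3 A o) (Agree G A A) 2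
  Bnd-strong-triangle {A@(a ∷ b ∷ c ∷ [])} cl@((ab ∷ ac ∷ []) ∷ (bc ∷ []) ∷ [] ∷ []) refl =
    Bnd-transfer ≤-refl id (λ _ _ → arcs-agree G cl) (Bnd-test out-degrees-positive (arcs G A) positive)
    where
    positive : ∀ {o} → ¬ GoodOn G 3 A o → out-degrees-positive (bits (arcs G A) o) ≡ true
    positive {o} ¬good = decidable-stable (_ Bool.≟ _) λ ne → ¬good⇒strong refl ¬good λ strong → ne (go strong)
      where
      from-b : ∀ {w} → w ∈ A → Directed G {o} b w → not (dir G o a b) ∨ dir G o b c ≡ true
      from-b (here refl) (adj , d) = cong (_∨ _) (trans (sym (dir-flip G o ab)) d)
      from-b (there (here refl)) (adj , d) = contradiction refl (Adj⇒≢ G adj)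
      from-b (there (there (here refl))) (adj , d) = trans (cong (not (dir G o a b) ∨_) d) (∨-zeroʳ _)
      from-a : ∀ {w} → w ∈ A → Directed G {o} a w → dir G o a b ∨ dir G o a c ≡ true
      from-a (here refl) (adj , d) = contradiction refl (Adj⇒≢ G adj)
      from-a (there (here refl)) (adj , d) = cong (_∨ _) d
      from-a (there (there (here refl))) (adj , d) = trans (cong (dir G o a b ∨_) d) (∨-zeroʳ _)
      from-c : ∀ {w} → w ∈ A → Directed G {o} c w → not (dir G o a c) ∨ not (dir G o b c) ≡ true
      from-c (here refl) (adj , d) = cong (_∨ _) (trans (sym (dir-flip G o ac)) d)
      from-c (there (here refl)) (adj , d) =
        trans (cong (not (dir G o a c) ∨_) (trans (sym (dir-flip G o bc)) d)) (∨-zeroʳ _)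
      from-c (there (there (here refl))) (adj , d) = contradiction refl (Adj⇒≢ G adj)
      go : StronglyConnectedOn G o A → out-degrees-positive (bits (arcs G A) o) ≡ true
      go strong =
        let _ , wa , da = strong⇒out-arc strong (here refl) (there (here refl)) (Adj⇒≢ G ab)
            _ , wb , db = strong⇒out-arc strong (there (here refl)) (here refl) (Adj⇒≢ G ab ∘ sym)
            _ , wc , dc = strong⇒out-arc strong (there (there (here refl))) (here refl) (Adj⇒≢ G ac ∘ sym)
        in cong₂ _∧_ (from-a wa da) (cong₂ _∧_ (from-b wb db) (from-c wc dc))

  -- 6 = 2 · 3: the arc between b and c, times `patterns 0 2` rows of a.
  Bnd-no-strong-triangle : ∀ {A} → Clique G A → length A ≡ 3 → Bnd (GoodOn G 3 A) (Agree G A A) 6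
  Bnd-no-strong-triangle {a ∷ b ∷ c ∷ []} cl@(_ ∷ cl′) refl = Bnd-clique-∷ {ℓ = 0} cl
    (Bnd-transfer (≤-reflexive (cong (2 ^_) (size-clique (adj G) cl′))) id (λ _ _ e → e) (Bnd-all G (b ∷ c ∷ [])))

  -- 40 = 6 · 6 + 2 · 2: a transitive triangle has at most 6 rows above it, a cyclic one at most 2.
  Bnd-K₄ : ∀ {W} → Clique G W → length W ≡ 4 → Bnd (GoodOn G 4 W) (Agree G W W) 40
  Bnd-K₄ {w ∷ W} cl@(_ ∷ cl′) len = Bnd-k-clique cl (suc-injective len)
    (Bnd-no-strong-triangle cl′ (suc-injective len)) (Bnd-strong-triangle cl′ (suc-injective len))

  -- As v and x are not adjacent, the row of v over `x ∷ A` is its row over A, so both rows are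
  -- bounded given A alone.
  Bnd-two-rows : ∀ {P : O → Set} {x v A M} → ¬ Adj G v x →
    (∀ o₀ → P o₀ → Bnd (λ o → P o × Agree G A A o₀ o) (Agree G [ x ] A) M) →
    (∀ o₀ → P o₀ → Bnd (λ o → P o × Agree G A A o₀ o) (Agree G [ v ] A) M) →
    ∀ {N} → Bnd P (Agree G A A) N → Bnd P (Agree G (v ∷ x ∷ A) (v ∷ x ∷ A)) (N * M * M)
  Bnd-two-rows {P} {x} {v} {A} {M} ¬vx bx bv bA = Bnd-∷ (Bnd-∷ bA bx) λ o₀ p₀ →
    Bnd-transfer ≤-refl (λ (p , e) → p , agreeing λ a b → same e (there a) (there b))
      (λ _ _ e → agreeing λ where
        (here refl) (here refl) a → contradiction a ¬vx
        (here refl) (there m) a → same e (here refl) m a) (bv o₀ p₀)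

  -- The core K₅ minus the edge vx: 6 · 6 · 6 orientations with A transitive and 2 · 2 · 2 with A cyclic.
  Bnd-K₅⁻ : ∀ {v x A} → Clique G (x ∷ A) → Clique G (v ∷ A) → ¬ Adj G v x → length A ≡ 3 →
    Bnd (GoodOn G 4 (v ∷ x ∷ A)) (Agree G (v ∷ x ∷ A) (v ∷ x ∷ A)) 224
  Bnd-K₅⁻ {v} {x} {A} clx@(_ ∷ clA) clv ¬vx len = Bnd-split (GoodOn G 3 A)
    (Bnd-two-rows ¬vx
      (λ _ _ → Bnd-transfer ≤-refl (λ ((g , _) , e) → g , e) (λ _ _ e → e) (Bnd-extension G clA there (six x)))
      (λ _ _ → Bnd-transfer ≤-refl (λ ((g , _) , e) → g , e) (λ _ _ e → e) (Bnd-extension G clA v∷A⊆ (six v)))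
      (Bnd-transfer ≤-refl proj₂ (λ _ _ e → e) (Bnd-no-strong-triangle clA len)))
    (Bnd-two-rows ¬vx (λ _ _ → Bnd-constant-row there clx len proj₁)
      (λ _ _ → Bnd-constant-row v∷A⊆ clv len proj₁)
      (Bnd-transfer ≤-refl proj₂ (λ _ _ e → e) (Bnd-strong-triangle clA len)))
    where
    v∷A⊆ : v ∷ A ⊆ v ∷ x ∷ A
    v∷A⊆ (here refl) = here refl
    v∷A⊆ (there m) = there (there m)
    six : ∀ y → deg (adj G) y A ≤ 3
    six y = ≤-trans (deg-≤ (adj G) y A) (≤-reflexive len)

-- Cliques and clique-based bounds

all-adjacent : ∀ {n} (G : Graph n) v W → length W ≤ deg (adj G) v W → All (λ x → adj G v x ≡ true) W
all-adjacent G v [] _ = []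
all-adjacent G v (x ∷ W) le with adj G v x in eq
... | true = eq ∷ all-adjacent G v W (s≤s⁻¹ le)
... | false = contradiction (deg-≤ (adj G) v W) (<⇒≱ le)

unique-non-neighbour : ∀ {n} (G : Graph n) v W → length W ≡ suc (deg (adj G) v W) →
  ∃₂ λ x A → W ↭ x ∷ A × adj G v x ≡ false × All (λ y → adj G v y ≡ true) A
unique-non-neighbour G v (x ∷ W) e with adj G v x in eq
... | false = x , W , ↭-refl , eq , all-adjacent G v W (≤-reflexive (suc-injective e))
... | true with y , A , p , ny , a ← unique-non-neighbour G v W (suc-injective e) =
  y , x ∷ A , ↭-trans (prep x p) (swap x y ↭-refl) , ny , eq ∷ a

module _ {n} (G : Graph n) where
  private
    V = Fin n
    O = Orientation G

  CliqueBound : ℕ → ℕ → ℕ → Set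
  CliqueBound k r N = ∀ W → Clique G W → length W ≡ r → Bnd (GoodOn G k W) (Agree G W W) N

  -- The recursion has to start at five vertices, since on four vertices 40 of the 64 tournaments
  -- are not strong.
  half-not-strong : ∀ j → ∃ λ N → 2 * N < 2 ^ pairs (5 + j) × CliqueBound (5 + j) (5 + j) N
  half-not-strong zero = 480 , ≤ᵇ⇒≤ 961 1024 _ , λ W cl len → Bnd-K₅-no-strong-K₅ G cl len
  half-not-strong (suc j) with N , h , b ← half-not-strong j =
    N * (3 * 2 ^ (3 + j)) + 2 ^ pairs (5 + j) * 2 , more-than-half-strong (5 + j) {N} (s≤s (s≤s (s≤s (s≤s z≤n)))) h ,
    λ { (w ∷ W) cl@(_ ∷ cl′) len → Bnd-k-clique G cl (suc-injective len) (b W cl′ (suc-injective len))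
      (Bnd-transfer (≤-reflexive (cong (2 ^_) (trans (size-clique (adj G) cl′) (cong pairs (suc-injective len)))))
        id (λ _ _ e → e) (Bnd-all G W)) }

  SmallCliqueBound : ℕ → ℕ → Set
  SmallCliqueBound ℓ r = ∃ λ N → N < 2 ^ turánSize (suc ℓ) r × CliqueBound (3 + ℓ) r N

  small-clique-bound-suc : ∀ ℓ s → 1 ≤ ℓ → 1 ≤ s → SmallCliqueBound ℓ (2 + ℓ + s) → SmallCliqueBound ℓ (2 + ℓ + suc s)
  small-clique-bound-suc ℓ s 1≤ℓ 1≤s (N , N< , b) = subst (SmallCliqueBound ℓ) (sym (+-suc (2 + ℓ) s))
    (N * patterns ℓ (2 + ℓ + s) , clique-extend ℓ 1≤ℓ s 1≤s N< , λ where
      (w ∷ W) cl@(_ ∷ cl′) len → Bnd-transfer (≤-reflexive (cong (λ m → N * patterns ℓ m) (suc-injective len)))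
        id (λ _ _ e → e) (Bnd-clique-∷ G {ℓ} cl (b W cl′ (suc-injective len))))

  small-clique-bound₄ : ∀ s → SmallCliqueBound 1 (3 + (2 + s))
  small-clique-bound₄ zero = 240 , subst (λ x → 240 < 2 ^ x) (sym T₃-5) (≤ᵇ⇒≤ 241 256 _) ,
    λ W cl len → Bnd-K₅-no-strong-K₄ G cl len
  small-clique-bound₄ (suc s) = small-clique-bound-suc 1 (2 + s) ≤-refl (s≤s z≤n) (small-clique-bound₄ s)

  small-clique-bound₅ : ∀ ℓ s → SmallCliqueBound (2 + ℓ) (4 + ℓ + suc s)
  small-clique-bound₅ ℓ zero with N , h , b ← half-not-strong ℓ = subst (SmallCliqueBound (2 + ℓ)) (+-comm 1 (4 + ℓ))
    (N , size-k-clique (2 + ℓ) (s≤s z≤n) h , b)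
  small-clique-bound₅ ℓ (suc s) = small-clique-bound-suc (2 + ℓ) (suc s) (s≤s z≤n) (s≤s z≤n) (small-clique-bound₅ ℓ s)

  -- The excluded pair is K₄ for k = 4, where 40 > 2^5. For k = 4 the chain of bounds starts at K₅
  -- instead (240 < 2^8); for larger k it starts at K_k.
  small-clique : ∀ ℓ s → 1 ≤ ℓ → 1 ≤ s → ¬ (ℓ ≡ 1 × s ≡ 1) → SmallCliqueBound ℓ (2 + ℓ + s)
  small-clique 1 1 _ _ ne = contradiction (refl , refl) ne
  small-clique 1 (suc (suc s)) _ _ _ = small-clique-bound₄ s
  small-clique (suc (suc ℓ)) (suc s) _ _ _ = small-clique-bound₅ ℓ s

  Bnd-rows : ∀ {P : O → Set} {W c} R → (∀ v → v ∈ R → Bnd P (Agree G [ v ] W) c) →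
    Bnd P (Agree G R W) (c ^ length R)
  Bnd-rows [] h = Bnd-one λ _ _ → agreeing λ ()
  Bnd-rows {P} {W} {c} (v ∷ R) h = Bnd-transfer (≤-reflexive (*-comm (c ^ length R) c)) id (λ _ _ e → e)
    (Bnd-prod {P = P} {_~_ = Agree G (v ∷ R) W} (Agree-refl G)
      (λ _ _ → Bnd-transfer ≤-refl proj₁ (λ _ _ e → e) (h v (here refl)))
      (λ _ _ _ p q r → agreeing λ where
        (here refl) → same r (here refl)
        (there m) → same (Agree-trans G p q) m)
      (Bnd-rows R (λ u m → h u (there m))))

  -- Three successive fibres: arcs within U, rows from R′ to W, arcs within R. Usually U = W and R′
  -- = R. In the exceptional case U is W plus one vertex of R and R′ omits that vertex, whose arcs
  -- to W are counted with U and whose other arcs are counted with R.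
  Bnd-assemble : ∀ {ℓ vs U W R R′ N S d} → Clique G W → U ⊆ vs → W ⊆ U → R ⊆ vs → R′ ⊆ R →
    (∀ {x} → x ∈ vs → x ∈ W ⊎ x ∈ R) → (∀ {x} → x ∈ R → x ∈ U ⊎ x ∈ R′) →
    (∀ {v} → v ∈ R′ → deg (adj G) v W ≤ d) →
    Bnd (GoodOn G (3 + ℓ) U) (Agree G U U) N → Bnd (GoodOn G (3 + ℓ) R) (Agree G R R) S →
    Bnd (GoodOn G (3 + ℓ) vs) (Agree G vs vs) (N * patterns ℓ d ^ length R′ * S)
  Bnd-assemble {ℓ} {vs} {U} {W} {R} {R′} {N} {S} {d} clW U⊆ W⊆U R⊆ R′⊆R cover coverR degs bU bR =
    Bnd-prod {P = Γ} {_~_ = Agree G vs vs} {_~₁_ = λ o o′ → Agree G U U o o′ × Agree G R′ W o o′}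
      (Agree-refl G , Agree-refl G)
      (λ _ _ → Bnd-transfer ≤-refl (GoodOn-⊆ G R⊆ ∘ proj₁) (λ _ _ e → e) bR)
      (λ _ _ _ (pU , pR′) (qU , qR′) r → combine (Agree-trans G pU qU) (Agree-trans G pR′ qR′) r)
      (Bnd-prod {P = Γ} {_~_ = λ o o′ → Agree G U U o o′ × Agree G R′ W o o′} (Agree-refl G)
        (λ o₀ _ → Bnd-rows R′ λ v v∈ → Bnd-transfer ≤-refl
          (λ (g , e) → g , agreeing λ a b → same e (W⊆U a) (W⊆U b)) (λ _ _ e → e)
          (Bnd-extension G {o₀ = o₀} clW (λ where
             (here refl) → R⊆ (R′⊆R v∈)
             (there m) → U⊆ (W⊆U m)) (degs v∈)))
        (λ _ _ _ p q r → Agree-trans G p q , r)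
        (Bnd-transfer ≤-refl (GoodOn-⊆ G U⊆) (λ _ _ e → e) bU))
    where
    Γ = GoodOn G (3 + ℓ) vs
    combine : ∀ {o o′} → Agree G U U o o′ → Agree G R′ W o o′ → Agree G R R o o′ → Agree G vs vs o o′
    combine {o} {o′} aU aR′ aR = agreeing λ x∈ y∈ → go (cover x∈) (cover y∈)
      where
      RW : Agree G R W o o′
      RW = agreeing λ x∈ y∈ → case coverR x∈ of λ where
        (inj₁ x∈U) → same aU x∈U (W⊆U y∈)
        (inj₂ x∈R′) → same aR′ x∈R′ y∈
      go : ∀ {x y} → x ∈ W ⊎ x ∈ R → y ∈ W ⊎ y ∈ R → Adj G x y → dir G o x y ≡ dir G o′ x y
      go (inj₁ x) (inj₁ y) = same aU (W⊆U x) (W⊆U y)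
      go (inj₂ x) (inj₁ y) = same RW x y
      go (inj₁ x) (inj₂ y) = same (Agree-flip G RW) x y
      go (inj₂ x) (inj₂ y) = same aR x y

  -- v extends W to K₅ minus an edge, or sees at most two vertices of W.
  Bnd-core : ∀ {W v} → Clique G W → length W ≡ 4 → deg (adj G) v W ≤ 3 →
    Bnd (GoodOn G 4 (v ∷ W)) (Agree G (v ∷ W) (v ∷ W)) 224
  Bnd-core {W} {v} cl len le with m≤n⇒m<n∨m≡n le
  ... | inj₁ deg≤2 = Bnd-transfer {N = 40 * 4} (≤ᵇ⇒≤ 160 224 _) id (λ _ _ e → e)
    (Bnd-∷ G (Bnd-transfer ≤-refl (GoodOn-⊆ G there) (λ _ _ e → e) (Bnd-K₄ G cl len))
      (λ _ _ → Bnd-extension G {ℓ = 1} cl id (s≤s⁻¹ deg≤2)))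
  ... | inj₂ deg≡3 with x , A , p , ¬vx , va ← unique-non-neighbour G v W (trans len (cong suc (sym deg≡3))) =
    Bnd-transfer ≤-refl (GoodOn-⊆ G (to⊆ (↭-sym p))) (λ _ _ e → agreeing λ a b → same e (to⊆ p a) (to⊆ p b))
      (Bnd-K₅⁻ G clxA (va ∷ AllPairs.tail clxA) (λ a → case trans (sym a) ¬vx of λ ())
        (suc-injective (trans (sym (↭-length p)) len)))
    where
    clxA = Clique-↭ G p cl
    to⊆ : ∀ {X Y} → X ↭ Y → v ∷ X ⊆ v ∷ Y
    to⊆ q (here e) = here e
    to⊆ q (there m) = there (∈-resp-↭ q m)

-- Turán's theorem with uniqueness

-- Positions are natural numbers because the part of a vertex will be its position modulo p.
data At {A : Set} : List A → ℕ → A → Set where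
  here : ∀ {x xs} → At (x ∷ xs) 0 x
  there : ∀ {x y xs i} → At xs i y → At (x ∷ xs) (suc i) y

At-∈ : ∀ {xs : List A} {i x} → At xs i x → x ∈ xs
At-∈ here = here refl
At-∈ (there a) = there (At-∈ a)

∈-At : ∀ {xs : List A} {x} (m : x ∈ xs) → At xs (toℕ (index m)) x
∈-At (here refl) = here
∈-At (there m) = there (∈-At m)

At-< : ∀ {xs : List A} {i x} → At xs i x → i < length xs
At-< here = z<s
At-< (there a) = s<s (At-< a)

At-exists : ∀ (xs : List A) {i} → i < length xs → ∃ (At xs i)
At-exists (x ∷ xs) {zero} _ = x , here
At-exists (x ∷ xs) {suc i} lt with y , a ← At-exists xs (s<s⁻¹ lt) = y , there a

At-functional : ∀ {xs : List A} {i x y} → At xs i x → At xs i y → x ≡ y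
At-functional here here = refl
At-functional (there a) (there b) = At-functional a b

At-injective : ∀ {xs : List A} {i j x} → Unique xs → At xs i x → At xs j x → i ≡ j
At-injective u here here = refl
At-injective (x∉ ∷ u) here (there b) = contradiction refl (All.lookup x∉ (At-∈ b))
At-injective (x∉ ∷ u) (there a) here = contradiction refl (All.lookup x∉ (At-∈ a))
At-injective (_ ∷ u) (there a) (there b) = cong suc (At-injective u a b)

At-++⁻ : ∀ xs {ys : List A} {i x} → At (xs ++ ys) i x → At xs i x ⊎ ∃ λ j → i ≡ length xs + j × At ys j x
At-++⁻ [] a = inj₂ (_ , refl , a)
At-++⁻ (x ∷ xs) here = inj₁ here
At-++⁻ (x ∷ xs) (there a) with At-++⁻ xs a
... | inj₁ b = inj₁ (there b)
... | inj₂ (j , refl , b) = inj₂ (j , refl , b)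

At-take⁺ : ∀ k {xs : List A} {i x} → i < k → At xs i x → At (take k xs) i x
At-take⁺ (suc k) _ here = here
At-take⁺ (suc k) lt (there a) = there (At-take⁺ k (s<s⁻¹ lt) a)

At-take⁻ : ∀ k {xs : List A} {i x} → At (take k xs) i x → i < k × At xs i x
At-take⁻ (suc k) {_ ∷ _} here = z<s , here
At-take⁻ (suc k) {_ ∷ _} (there a) with lt , b ← At-take⁻ k a = s<s lt , there b

AllPairs-At : ∀ {R : A → A → Set} xs → (∀ {i j x y} → i < j → At xs i x → At xs j y → R x y) → AllPairs R xs
AllPairs-At [] h = []
AllPairs-At (x ∷ xs) h = All.tabulate (λ m → h z<s here (there (∈-At m))) ∷ AllPairs-At xs λ lt a b → h (s<s lt) (there a) (there b)

Unique-↭ : ∀ {xs ys : List A} → xs ↭ ys → Unique xs → Unique ys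
Unique-↭ p = Permₛ.Unique-resp-↭ (setoid _) (↭⇒↭ₛ p)

complement : ∀ {W vs : List A} → Unique W → W ⊆ vs → ∃ λ R → vs ↭ W ++ R
complement {vs = vs} [] _ = vs , ↭-refl
complement {W = w ∷ W} (w∉ ∷ u) sub with zs , p ← remove (sub (here refl))
  with R , q ← complement u (λ {x} m → case ∈-resp-↭ p (sub (there m)) of λ where
    (here e) → contradiction (sym e) (All.lookup w∉ m)
    (there m′) → m′) = R , ↭-trans p (prep w q)

module _ {n} (G : Graph n) where
  private
    V = Fin n
  open import Data.List.Membership.DecPropositional (Fin._≟_ {n}) using (_∈?_)

  HasClique : ℕ → List V → Set
  HasClique r vs = ∃ λ W → W ⊆ vs × Clique G W × length W ≡ r

  HasClique-⊆ : ∀ {r vs ws} → vs ⊆ ws → HasClique r vs → HasClique r ws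
  HasClique-⊆ sub (W , W⊆ , c , l) = W , (λ m → sub (W⊆ m)) , c , l

  HasClique-≤ : ∀ {r s vs} → r ≤ s → HasClique s vs → HasClique r vs
  HasClique-≤ {r} r≤s (W , W⊆ , c , refl) =
    take r W , (λ m → W⊆ (At-∈ (proj₂ (At-take⁻ r (∈-At m))))) , AllPairs.take⁺ r c ,
    trans (length-take r W) (m≤n⇒m⊓n≡m r≤s)

  hasClique? : ∀ r vs → Dec (HasClique r vs)
  hasClique? zero vs = yes ([] , (λ ()) , [] , refl)
  hasClique? (suc r) [] = no λ where
    ([] , _ , _ , ())
    (w ∷ W , W⊆ , _) → case W⊆ (here refl) of λ ()
  hasClique? (suc r) (v ∷ vs) = map′ to from (hasClique? (suc r) vs ⊎-dec hasClique? r (filter N? vs))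
    where
    N? = λ w → adj G v w Bool.≟ true
    to : HasClique (suc r) vs ⊎ HasClique r (filter N? vs) → HasClique (suc r) (v ∷ vs)
    to (inj₁ h) = HasClique-⊆ there h
    to (inj₂ (W , W⊆ , c , l)) = v ∷ W ,
      (λ { (here e) → here e ; (there m) → there (proj₁ (∈-filter⁻ N? (W⊆ m))) }) ,
      All.tabulate (λ m → proj₂ (∈-filter⁻ N? {xs = vs} (W⊆ m))) ∷ c , cong suc l
    from : HasClique (suc r) (v ∷ vs) → HasClique (suc r) vs ⊎ HasClique r (filter N? vs)
    from (W , W⊆ , c , l) with v ∈? W
    ... | no v∉W = inj₁ (W , (λ m → case W⊆ m of λ where
              (here refl) → contradiction m v∉W
              (there m′) → m′) , c , l)
    ... | yes v∈W with W′ , p ← remove v∈W with a ∷ c′ ← Clique-↭ G p c =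
      inj₂ (W′ , (λ m → case W⊆ (∈-resp-↭ (↭-sym p) (there m)) of λ where
          (here refl) → contradiction refl (Adj⇒≢ G (All.lookup a m))
          (there m′) → ∈-filter⁺ N? m′ (All.lookup a m)) ,
        c′ , suc-injective (trans (sym (↭-length p)) l))

  maximumClique : ∀ vs → ∃ λ r → HasClique r vs × ¬ HasClique (suc r) vs
  maximumClique vs = go (suc (length vs)) 0 (+-identityʳ _) ([] , (λ ()) , [] , refl)
    where
    go : ∀ fuel r → fuel + r ≡ suc (length vs) → HasClique r vs → ∃ λ r → HasClique r vs × ¬ HasClique (suc r) vs
    go zero r refl (W , W⊆ , c , l) =
      contradiction (Unique-⊆⇒length≤ (Clique⇒Unique G c) W⊆) (<⇒≱ (≤-reflexive (sym l)))
    go (suc fuel) r e h with hasClique? (suc r) vs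
    ... | yes h′ = go fuel (suc r) (trans (+-suc fuel r) e) h′
    ... | no ¬h′ = r , h , ¬h′

  deg-maximum : ∀ {vs W r v} → W ⊆ vs → Clique G W → length W ≡ suc r → ¬ HasClique (2 + r) vs → v ∈ vs →
    deg (adj G) v W ≤ r
  deg-maximum {vs} {W} {r} {v} W⊆ c l ¬h v∈ with deg (adj G) v W ≤? r
  ... | yes le = le
  ... | no ≰ = contradiction (v ∷ W , (λ { (here refl) → v∈ ; (there m) → W⊆ m }) ,
          all-adjacent G v W (≤-trans (≤-reflexive l) (≰⇒> ≰)) ∷ c , cong suc l) ¬h

  module _ (q : ℕ) where
    private
      p = suc q
      T = turánSize q

    -- A listing whose positions realise the Turán adjacency; the position map is then the
    -- isomorphism (`ordered⇒≅`).
    Ordered : List V → Set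
    Ordered vs = ∀ {i j x y} → At vs i x → At vs j y → adj G x y ≡ multiAdj q i j

    matching : ∀ U W → (∀ {u} → u ∈ U → ∃ λ w → w ∈ W × adj G u w ≡ false) →
      AllPairs (λ u u′ → ∀ w → w ∈ W → adj G u w ≡ false → adj G u′ w ≡ false → ⊥) U →
      ∃ λ W′ → W′ ↭ W × (∀ {i u w} → At U i u → At W′ i w → adj G u w ≡ false)
    matching [] W _ _ = W , ↭-refl , λ ()
    matching (u ∷ U) W miss (d ∷ ds) with w , w∈ , uw ← miss (here refl) with W₁ , π ← remove w∈
      with W′ , π′ , h ← matching U W₁
        (λ {u′} m → let w′ , w′∈ , u′w′ = miss (there m) in w′ , (case ∈-resp-↭ π w′∈ of λ where
            (here refl) → ⊥-elim (All.lookup d m w w′∈ uw u′w′)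
            (there m′) → m′) , u′w′)
        (AllPairs.map (λ f w m → f w (∈-resp-↭ (↭-sym π) (there m))) ds) =
      w ∷ W′ , ↭-trans (prep w π′) (↭-sym π) , λ where
        here here → uw
        (there a) (there b) → h a b

    clique-ordered : ∀ {W} → Clique G W → length W ≤ p → Ordered W
    clique-ordered {W} c le {i} {j} {x} {y} a b with i ≟ j
    ... | yes refl with refl ← At-functional a b = trans (irrefl G x) (sym (multiAdj-false q i i refl))
    ... | no i≢j = trans (Clique⇒Complete G c (At-∈ a) (At-∈ b) λ { refl → i≢j (At-injective (Clique⇒Unique G c) a b) })
      (sym (multiAdj-true q i j λ e → i≢j (trans (sym (small a)) (trans e (small b)))))
      where
      small : ∀ {i x} → At W i x → i % p ≡ i
      small a = m<n⇒m%n≡m (≤-trans (At-< a) le)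

    -- W meets every part once, and each vertex outside W belongs to the part of its only non-neighbour in W.
    module _ {vs W R} (¬h : ¬ HasClique (suc p) vs) (W⊆ : W ⊆ vs) (R⊆ : R ⊆ vs) (cW : Clique G W) (lW : length W ≡ p)
      (degs : All (λ v → deg (adj G) v W ≡ q) R) (oR : Ordered R) where
      private
        Miss : V → V → Set
        Miss u w = adj G u w ≡ false

        non-neighbour : ∀ {u} → u ∈ R → ∃₂ λ x A → W ↭ x ∷ A × Miss u x × All (Adj G u) A
        non-neighbour {u} m = unique-non-neighbour G u W (trans lW (cong suc (sym (All.lookup degs m))))

        rest-adjacent : ∀ {u w} → u ∈ R → w ∈ W → Miss u w → ∃ λ A → W ↭ w ∷ A × All (Adj G u) A
        rest-adjacent u∈ w∈ uw with x , A , π , _ , a ← non-neighbour u∈ with ∈-resp-↭ π w∈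
        ... | here refl = A , π , a
        ... | there m = case trans (sym uw) (All.lookup a m) of λ ()

        miss-unique : ∀ {u w w′} → u ∈ R → w ∈ W → w′ ∈ W → Miss u w → Miss u w′ → w ≡ w′
        miss-unique u∈ w∈ w′∈ uw uw′ with A , π , a ← rest-adjacent u∈ w∈ uw with ∈-resp-↭ π w′∈
        ... | here e = sym e
        ... | there m = case trans (sym uw′) (All.lookup a m) of λ ()

        -- Otherwise u and u′ could replace w in W, giving a clique on p + 1 vertices.
        no-common : ∀ {u u′ w} → u ∈ R → u′ ∈ R → Adj G u u′ → w ∈ W → Miss u w → Miss u′ w → ⊥
        no-common {u} {u′} u∈ u′∈ uu′ w∈ uw u′w
          with A , π , a ← rest-adjacent u∈ w∈ uw | A′ , π′ , a′ ← rest-adjacent u′∈ w∈ u′w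
          with _ ∷ cA ← Clique-↭ G π cW =
          ¬h (u ∷ u′ ∷ A ,
            (λ where (here refl) → R⊆ u∈
                     (there (here refl)) → R⊆ u′∈
                     (there (there m)) → W⊆ (∈-resp-↭ (↭-sym π) (there m))) ,
            (uu′ ∷ a) ∷ All-resp-↭ (drop-∷ (↭-trans (↭-sym π′) π)) a′ ∷ cA ,
            cong suc (trans (sym (↭-length π)) lW))

        -- The first p entries of R lie in different parts and so are pairwise adjacent; `no-common`
        -- makes their missed vertices distinct.
        matched : ∃ λ W′ → W′ ↭ W × (∀ {i u w} → At (take p R) i u → At W′ i w → Miss u w)
        matched = matching (take p R) W
          (λ m → let x , A , π , ux , _ = non-neighbour (At-∈ (proj₂ (At-take⁻ p (∈-At m))))
                 in x , ∈-resp-↭ (↭-sym π) (here refl) , ux)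
          (AllPairs-At (take p R) λ {i} {j} i<j a b w →
            let i<p , a′ = At-take⁻ p a
                j<p , b′ = At-take⁻ p b
            in no-common (At-∈ a′) (At-∈ b′) (trans (oR a′ b′) (multiAdj-true q i j λ e →
                 <⇒≢ i<j (trans (sym (m<n⇒m%n≡m i<p)) (trans e (m<n⇒m%n≡m j<p))))))

        shift : ∀ j → (p + j) % p ≡ j % p
        shift j = trans (cong (_% p) (+-comm p j)) ([m+n]%n≡m%n j p)

      module _ {W′} (π : W′ ↭ W) (h : ∀ {i u w} → At (take p R) i u → At W′ i w → adj G u w ≡ false) where
        private
          lW′ = trans (↭-length π) lW
          uW′ = Clique⇒Unique G (Clique-↭ G (↭-sym π) cW)

          W′∈ : ∀ {i w} → At W′ i w → w ∈ W
          W′∈ a = ∈-resp-↭ π (At-∈ a)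

          W′< : ∀ {i w} → At W′ i w → i < p
          W′< a = ≤-trans (At-< a) (≤-reflexive lW′)

          miss-at : ∀ {i u w} → At R i u → At W′ i w → Miss u w
          miss-at a b = h (At-take⁺ p (W′< b) a) b

          -- Suppose i differs from `j % p`. If R has an i-th entry, it also misses w and is
          -- adjacent to u, against `no-common`. If not, then j < p, so by the alignment u misses
          -- the j-th entry of W′; as u misses only one vertex, i = j.
          miss⇒part : ∀ {i j w u} → At W′ i w → At R j u → Miss u w → i ≡ j % p
          miss⇒part {i} {j} {w} {u} a b uw with i ≟ (j % p)
          ... | yes e = e
          ... | no i≢ with i <? length R
          ...   | yes i<R with uᵢ , c ← At-exists R i<R = ⊥-elim (no-common (At-∈ c) (At-∈ b)
                    (trans (oR c b) (multiAdj-true q i j λ e → i≢ (trans (sym (m<n⇒m%n≡m (W′< a))) e)))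
                    (W′∈ a) (miss-at c a) uw)
          ...   | no i≮R with j<p ← <-≤-trans (<-≤-trans (At-< b) (≮⇒≥ i≮R)) (<⇒≤ (W′< a))
                  with w′ , c ← At-exists W′ (<-≤-trans j<p (≤-reflexive (sym lW′)))
                  with refl ← miss-unique (At-∈ b) (W′∈ a) (W′∈ c) uw (miss-at b c) =
            trans (At-injective uW′ a c) (sym (m<n⇒m%n≡m j<p))

          part⇒miss : ∀ {i j w u} → At W′ i w → At R j u → i ≡ j % p → Miss u w
          part⇒miss {w = w} {u} a b e with x , A , ρ , ux , _ ← non-neighbour (At-∈ b)
            with c ← ∈-At (∈-resp-↭ (↭-sym π) (∈-resp-↭ (↭-sym ρ) (here refl)))
            with refl ← trans e (sym (miss⇒part c b ux)) = subst (Miss u) (At-functional c a) ux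

          W′R : ∀ {i j w u} → At W′ i w → At R j u → adj G w u ≡ multiAdj q i (p + j)
          W′R {i} {j} {w} {u} a b with adj G u w in eq
          ... | false = trans (adj-sym G w u) (trans eq (sym (multiAdj-false q i (p + j)
                  (trans (m<n⇒m%n≡m (W′< a)) (trans (miss⇒part a b eq) (sym (shift j)))))))
          ... | true = trans (adj-sym G w u) (trans eq (sym (multiAdj-true q i (p + j) λ e →
                  case trans (sym eq) (part⇒miss a b (trans (sym (m<n⇒m%n≡m (W′< a))) (trans e (shift j)))) of λ ())))

        append-ordered : Ordered (W′ ++ R)
        append-ordered a b = ordered (At-++⁻ W′ a) (At-++⁻ W′ b)
          where
          Placed : ℕ → V → Set
          Placed i x = At W′ i x ⊎ ∃ λ j → i ≡ length W′ + j × At R j x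
          ordered : ∀ {i j x y} → Placed i x → Placed j y → adj G x y ≡ multiAdj q i j
          ordered (inj₁ a) (inj₁ b) = clique-ordered (Clique-↭ G (↭-sym π) cW) (≤-reflexive lW′) a b
          ordered {i} (inj₁ a) (inj₂ (j , refl , b)) =
            trans (W′R a b) (cong (λ l → multiAdj q i (l + j)) (sym lW′))
          ordered {j = j} {x} {y} (inj₂ (i , refl , a)) (inj₁ b) = trans (adj-sym G x y) (trans (W′R b a)
            (trans (multiAdj-sym q j (p + i)) (cong (λ l → multiAdj q (l + i) j) (sym lW′))))
          ordered (inj₂ (i , refl , a)) (inj₂ (j , refl , b)) = trans (oR a b)
            (trans (cong₂ (λ x y → not (x ≡ᵇ y)) (sym (shift i)) (sym (shift j)))
              (cong (λ l → multiAdj q (l + i) (l + j)) (sym lW′)))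

      extend-ordering : ∃ λ W′ → W′ ↭ W × Ordered (W′ ++ R)
      extend-ordering = let W′ , π , h = matched in W′ , π , append-ordered π h

    -- Removes a maximum clique, of which every other vertex misses at least one member. For size p
    -- this reproduces `turánSize-step`, and equality forces equality both in the cross edges and in
    -- the remainder, whose ordering then extends. A smaller clique loses strictly, unless nothing
    -- is left outside it.
    turán-bound : ∀ fuel vs → length vs ≤ fuel → Unique vs → ¬ HasClique (suc p) vs →
      size (adj G) vs ≤ T (length vs) × (T (length vs) ≤ size (adj G) vs → ∃ λ vs′ → vs′ ↭ vs × Ordered vs′)
    turán-bound fuel [] _ _ _ = z≤n , λ _ → [] , ↭-refl , λ ()
    turán-bound (suc fuel) vs@(v ∷ _) (s≤s le) u ¬h with maximumClique vs
    ... | zero , _ , ¬h₁ = contradiction ([ v ] , (λ where (here refl) → here refl) , [] ∷ [] , refl) ¬h₁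
    ... | suc r , (W , W⊆ , cW , lW) , ¬h₁ with R , π ← complement (Clique⇒Unique G cW) W⊆ = result
      where
      R⊆ : R ⊆ vs
      R⊆ m = ∈-resp-↭ (↭-sym π) (∈-++⁺ʳ W m)
      m = length R
      lvs : length vs ≡ suc r + m
      lvs = trans (↭-length π) (trans (length-++ W) (cong (_+ m) lW))
      degs : All (λ v → deg (adj G) v W ≤ r) R
      degs = All.tabulate λ x∈ → deg-maximum W⊆ cW lW ¬h₁ (R⊆ x∈)
      size≡ : size (adj G) vs ≡ pairs (suc r) + cross (adj G) R W + size (adj G) R
      size≡ = trans (size-↭ (adj G) (adj-sym G) π) (trans (size-++ (adj G) W R)
        (cong (_+ size (adj G) R) (cong₂ _+_ (trans (size-clique (adj G) cW) (cong pairs lW)) (cross-sym (adj G) (adj-sym G) W R))))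
      r<p+1 : suc r ≤ p
      r<p+1 = ≮⇒≥ λ p<r → ¬h (HasClique-≤ p<r (W , W⊆ , cW , lW))
      ih = turán-bound fuel R (s≤s⁻¹ (≤-trans (≤-trans (s≤s (m≤n+m m r)) (≤-reflexive (sym lvs))) (s≤s le)))
        (AllPairs-resp-⊑ (Sublist.++⁺ˡ W Sublist.⊆-refl) (Unique-↭ π u)) (¬h ∘ HasClique-⊆ R⊆)
      size≤ : size (adj G) vs ≤ pairs (suc r) + r * m + T m
      size≤ = begin
        size (adj G) vs ≡⟨ size≡ ⟩
        pairs (suc r) + cross (adj G) R W + size (adj G) R
          ≤⟨ +-mono-≤ (+-monoʳ-≤ (pairs (suc r)) (cross-≤ (adj G) degs)) (proj₁ ih) ⟩
        pairs (suc r) + m * r + T m ≡⟨ cong (λ z → pairs (suc r) + z + T m) (*-comm m r) ⟩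
        pairs (suc r) + r * m + T m ∎
        where open ≤-Reasoning
      Result : ℕ → Set
      Result l = size (adj G) vs ≤ T l × (T l ≤ size (adj G) vs → ∃ λ vs′ → vs′ ↭ vs × Ordered vs′)
      balanced : suc r ≡ p → Result (suc r + m)
      balanced refl = subst (size (adj G) vs ≤_) (sym (turánSize-step q m)) size≤ , λ tight →
        let tight′ = subst₂ _≤_ (turánSize-step q m) size≡ tight
            cross-large = +-cancelˡ-≤ (pairs p) _ _ (+-cancelʳ-≤ (T m) _ _ (≤-trans tight′ (+-monoʳ-≤ (pairs p + cross (adj G) R W) (proj₁ ih))))
            R-large = +-cancelˡ-≤ (pairs p + r * m) _ _ (≤-trans tight′ (+-monoˡ-≤ (size (adj G) R) (+-monoʳ-≤ (pairs p)
              (≤-trans (cross-≤ (adj G) degs) (≤-reflexive (*-comm m r))))))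
            R′ , ρ , oR′ = proj₂ ih R-large
            W′ , σ , o = extend-ordering {R = R′} ¬h W⊆ (λ x → R⊆ (∈-resp-↭ ρ x)) cW lW
              (All-resp-↭ (↭-sym ρ) (cross-tight (adj G) degs (≤-trans (≤-reflexive (*-comm m r)) cross-large))) oR′
        in W′ ++ R′ , ↭-trans (++⁺ σ ρ) (↭-sym π) , o
      unbalanced : suc r < p → Result (suc r + m)
      unbalanced r<p with m≤n⇒m<n∨m≡n (z≤n {m})
      ... | inj₁ 1≤m = let lt = ≤-<-trans size≤ (small-clique-deficit q r m r<p 1≤m)
                       in <⇒≤ lt , λ tight → contradiction tight (<⇒≱ lt)
      ... | inj₂ 0≡m =
        ≤-trans size≤ (≤-reflexive (subst (λ m → pairs (suc r) + r * m + T m ≡ T (suc r + m)) 0≡m complete-size)) ,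
        λ _ → W , ↭-sym (subst (vs ↭_) (trans (cong (W ++_) (empty R (sym 0≡m))) (++-identityʳ W)) π) ,
          clique-ordered cW (≤-trans (≤-reflexive lW) r<p+1)
        where
        empty : ∀ (xs : List V) → length xs ≡ 0 → xs ≡ []
        empty [] _ = refl
        complete-size : pairs (suc r) + r * 0 + T 0 ≡ T (suc r + 0)
        complete-size = begin
          pairs (suc r) + r * 0 + T 0 ≡⟨ cong₂ (λ a b → pairs (suc r) + a + b) (*-zeroʳ r) (turánSize-small q z≤n) ⟩
          pairs (suc r) + 0 + 0 ≡⟨ trans (+-identityʳ _) (+-identityʳ _) ⟩
          pairs (suc r) ≡⟨ turánSize-small q r<p+1 ⟨
          T (suc r) ≡⟨ cong T (+-identityʳ (suc r)) ⟨
          T (suc r + 0) ∎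
          where open ≡-Reasoning
      result : Result (length vs)
      result = subst Result (sym lvs) (case m≤n⇒m<n∨m≡n r<p+1 of λ where
        (inj₁ r<p) → unbalanced r<p
        (inj₂ e) → balanced e)

-- The extremal graphs

bitVectors : ∀ m → List (Vec Bool m)
bitVectors zero = [ [] ]
bitVectors (suc m) = map (true ∷_) (bitVectors m) ++ map (false ∷_) (bitVectors m)

length-bitVectors : ∀ m → length (bitVectors m) ≡ 2 ^ m
length-bitVectors zero = refl
length-bitVectors (suc m) = trans (length-++ (map (true ∷_) (bitVectors m))) (cong₂ _+_ (half true)
  (trans (half false) (sym (+-identityʳ _))))
  where
  half : ∀ b → length (map (b ∷_) (bitVectors m)) ≡ 2 ^ m
  half b = trans (length-map _ (bitVectors m)) (length-bitVectors m)

∈-bitVectors : ∀ {m} (v : Vec Bool m) → v ∈ bitVectors m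
∈-bitVectors [] = here refl
∈-bitVectors (true ∷ v) = ∈-++⁺ˡ (∈-map⁺ (true ∷_) (∈-bitVectors v))
∈-bitVectors {suc m} (false ∷ v) = ∈-++⁺ʳ (map (true ∷_) (bitVectors m)) (∈-map⁺ (false ∷_) (∈-bitVectors v))

bitVectors-unique : ∀ m → Unique (bitVectors m)
bitVectors-unique zero = [] ∷ []
bitVectors-unique (suc m) = Unique.++⁺ (Unique.map⁺ Vec.∷-injectiveʳ (bitVectors-unique m)) (Unique.map⁺ Vec.∷-injectiveʳ (bitVectors-unique m))
  λ (a , b) → let _ , _ , e = ∈-map⁻ (true ∷_) a
                  _ , _ , e′ = ∈-map⁻ (false ∷_) b
              in case trans (sym e) e′ of λ ()

-- The upper bound by induction on the vertex set

module _ {n} (G : Graph n) where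
  private
    V = Fin n
    O = Orientation G

  open import Data.List.Membership.DecPropositional (Vec.≡-dec {n = length (edges G)} Bool._≟_) using (_∈?_)

  module _ (ℓ : ℕ) (1≤ℓ : 1 ≤ ℓ) where
    private
      k = 3 + ℓ
      T′ = turánSize (suc ℓ)

    OrientationBound : List V → ℕ → Set
    OrientationBound vs N = Bnd (GoodOn G k vs) (Agree G vs vs) N

    Exceptional : List V → Set
    Exceptional vs = ℓ ≡ 1 × length vs ≡ 4

    -- The second alternative is forced by K₄ for k = 4, which may occur as the remainder after
    -- removing a clique.
    Bounded : List V → Set
    Bounded vs = OrientationBound vs (2 ^ T′ (length vs)) ⊎ (Exceptional vs × OrientationBound vs 40)

    -- The inequality is strict so that it also yields uniqueness: a graph containing K_k cannot
    -- attain the Turán value.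
    strictly-bounded : ∀ vs → (∀ R → length R < length vs → Unique R → Bounded R) → Unique vs →
      HasClique G k vs → ¬ Exceptional vs → ∃ λ N → N < 2 ^ T′ (length vs) × OrientationBound vs N
    strictly-bounded vs ih u h ¬exc
      with r , (W , W⊆ , cW , lW) , ¬h ← maximumClique G vs
      with j , refl ← m≤n⇒∃[o]m+o≡n (≮⇒≥ λ r<k → ¬h (HasClique-≤ G r<k h))
      with R , π ← complement (Clique⇒Unique G cW) W⊆ = result
      where
      R⊆ : R ⊆ vs
      R⊆ m = ∈-resp-↭ (↭-sym π) (∈-++⁺ʳ W m)
      lvs : length vs ≡ 3 + ℓ + j + length R
      lvs = trans (↭-length π) (trans (length-++ W) (cong (_+ length R) lW))
      degs : ∀ {v} → v ∈ R → deg (adj G) v W ≤ 2 + ℓ + j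
      degs m = deg-maximum G W⊆ cW lW ¬h (R⊆ m)
      bR : Bounded R
      bR = ih R (≤-trans (s≤s (m≤n+m (length R) (2 + ℓ + j))) (≤-reflexive (sym lvs)))
        (AllPairs-resp-⊑ (Sublist.++⁺ˡ W Sublist.⊆-refl) (Unique-↭ π u))
      cover : ∀ {x} → x ∈ vs → x ∈ W ⊎ x ∈ R
      cover m = ∈-++⁻ W (∈-resp-↭ π m)
      Result = ∃ λ N → N < 2 ^ T′ (length vs) × OrientationBound vs N

      general : ¬ (ℓ ≡ 1 × suc j ≡ 1) → Result
      general ne with N , N< , bW ← small-clique G ℓ (suc j) 1≤ℓ (s≤s z≤n) ne = finish bR
        where
        r≡ : 3 + ℓ + j ≡ 2 + ℓ + suc j
        r≡ = sym (+-suc (2 + ℓ) j)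
        l≡ : length vs ≡ 2 + ℓ + suc j + length R
        l≡ = trans lvs (cong (_+ length R) r≡)
        assembled : ∀ {S} → OrientationBound R S →
          OrientationBound vs (N * patterns ℓ (suc ℓ + suc j) ^ length R * S)
        assembled bS = Bnd-assemble G cW W⊆ id R⊆ id cover inj₂
          (λ m → ≤-trans (degs m) (≤-reflexive (sym (+-suc (suc ℓ) j))))
          (bW W cW (trans lW r≡)) bS
        finish : Bounded R → Result
        finish (inj₁ b) = _ , subst (λ l → N * patterns ℓ (suc ℓ + suc j) ^ length R * 2 ^ T′ (length R) < 2 ^ T′ l) (sym l≡)
          (assembled-bound ℓ 1≤ℓ (suc j) (length R) (s≤s z≤n) N< ≤-refl) , assembled b
        -- With ℓ = 1 the excluded pair forces j ≥ 1, which gives the bound `2 ≤ suc j` that the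
        -- slack requires.
        finish (inj₂ ((refl , lR) , b)) = _ , subst₂ (λ l m → N * patterns 1 (2 + suc j) ^ m * 40 < 2 ^ T′ l)
          (trans (cong (3 + suc j +_) (sym lR)) (sym l≡)) (sym lR)
          (assembled-bound-4 (suc j) (s≤s (n≢0⇒n>0 λ e → ne (refl , cong suc e))) N<) , assembled b

      -- The maximum clique is K₄. R is nonempty, since otherwise `vs` would be exceptional, and its
      -- first vertex joins W to form the core.
      small : ℓ ≡ 1 → j ≡ 0 → ∀ R′ → R′ ≡ R → Result
      small refl refl [] refl = contradiction (refl , lvs) ¬exc
      small refl refl (v ∷ R″) refl = finish bR
        where
        assembled : ∀ {S} → OrientationBound R S → OrientationBound vs (224 * 6 ^ length R″ * S)
        assembled = Bnd-assemble G cW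
          (λ { (here refl) → R⊆ (here refl) ; (there m) → W⊆ m }) there R⊆ there cover
          (λ { (here refl) → inj₁ (here refl) ; (there m) → inj₂ m }) (λ m → degs (there m))
          (Bnd-core G cW lW (degs (here refl)))
        finish : Bounded R → Result
        finish (inj₁ b) = _ , subst (λ l → 224 * 6 ^ length R″ * 2 ^ T′ (length R) < 2 ^ T′ l) (sym lvs)
          (core-bound (length R″)) , assembled b
        finish (inj₂ ((_ , lR) , b)) = _ , subst₂ (λ l m → 224 * 6 ^ m * 40 < 2 ^ T′ l)
          (trans (cong (4 +_) (sym lR)) (sym lvs)) (suc-injective (sym lR)) core-bound-4 , assembled b

      result : Result
      result with (ℓ ≟ 1) ×-dec (suc j ≟ 1)
      ... | yes (e , e′) = small e (suc-injective e′) R refl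
      ... | no ne = general ne

    bounded : ∀ fuel vs → length vs ≤ fuel → Unique vs → Bounded vs
    bounded fuel vs le u with hasClique? G k vs
    ... | no ¬h = inj₁ (Bnd-transfer (^-monoʳ-≤ 2 (proj₁ (turán-bound G (suc ℓ) (length vs) vs ≤-refl u ¬h)))
            id (λ _ _ e → e) (Bnd-all G vs))
    ... | yes h@(W , W⊆ , cW , lW) with (ℓ ≟ 1) ×-dec (length vs ≟ 4)
    ...   | yes exc@(refl , l) = inj₂ (exc , Bnd-transfer ≤-refl (GoodOn-⊆ G W⊆)
              (λ _ _ e → agreeing λ a b → same e (vs⊆W a) (vs⊆W b)) (Bnd-K₄ G cW lW))
      where
      vs⊆W : vs ⊆ W
      vs⊆W = spanning G (Clique⇒Unique G cW) W⊆ (≤-reflexive (trans l (sym lW)))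
    bounded zero [] le u | yes (W , W⊆ , cW , lW) | no ¬exc =
      contradiction (Unique-⊆⇒length≤ (Clique⇒Unique G cW) W⊆) (<⇒≱ (≤-trans (s≤s z≤n) (≤-reflexive (sym lW))))
    bounded (suc fuel) vs le u | yes h | no ¬exc =
      let N , N< , b = strictly-bounded vs (λ R lt uR → bounded fuel R (s≤s⁻¹ (≤-trans lt le)) uR) u h ¬exc
      in inj₁ (Bnd-transfer (<⇒≤ N<) id (λ _ _ e → e) b)

  SkIs⇒≤ : ∀ {k m N} → Bnd (GoodOn G k (allFin n)) (Agree G (allFin n) (allFin n)) N → SkIs k G m → m ≤ N
  SkIs⇒≤ b (L , uL , spec , refl) = b L
    (All.tabulate λ {o} o∈ S _ → proj₁ (spec o) o∈ S)
    (AllPairs.map (λ ne e → ne (dir-injective G λ u v a → same e (∈-allFin u) (∈-allFin v) a)) uL)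

  -- A good orientation outside `L` could be put in front of `L`, exceeding the bound `N`; goodness
  -- itself is never decided.
  full⇒complete : ∀ {k N L} → Bnd (GoodOn G k (allFin n)) (Agree G (allFin n) (allFin n)) N → Unique L →
    (∀ {o} → o ∈ L → Good G k o) → length L ≡ N → ∀ {o} → Good G k o → o ∈ L
  full⇒complete {L = L} b uL good len {o} g with o ∈? L
  ... | yes m = m
  ... | no o∉ = contradiction
    (b (o ∷ L) ((λ S _ → g S) ∷ All.tabulate (λ m S _ → good m S))
      (AllPairs.map (λ ne e → ne (dir-injective G λ u v a → same e (∈-allFin u) (∈-allFin v) a))
        (All.tabulate (λ { m refl → o∉ m }) ∷ uL)))
    (<⇒≱ (≤-reflexive (cong suc (sym len))))

  ordered⇒≅ : ∀ q {vs} → vs ↭ allFin n → Ordered G q vs → G ≅ turán (suc q) n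
  ordered⇒≅ q {vs} π ordered = mk↔ₛ′ to from to-from from-to , preserves
    where
    len : length vs ≡ n
    len = trans (↭-length π) (length-tabulate id)
    place : ∀ v → v ∈ vs
    place v = ∈-resp-↭ (↭-sym π) (∈-allFin v)
    to from : Fin n → Fin n
    to v = Fin.cast len (index (place v))
    from i = lookup vs (Fin.cast (sym len) i)
    to-from : ∀ i → to (from i) ≡ i
    to-from i = trans (cong (Fin.cast len) (index-lookup (Unique-↭ (↭-sym π) (Unique.allFin⁺ n)) (place (from i)) refl))
      (trans (cast-trans (sym len) len i) (cast-is-id _ i))
    from-to : ∀ v → from (to v) ≡ v
    from-to v = trans (cong (lookup vs) (trans (cast-trans len (sym len) _) (cast-is-id _ _))) (sym (lookup-index (place v)))
    preserves : ∀ u v → adj G u v ≡ adj (turán (suc q) n) (to u) (to v)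
    preserves u v = trans (ordered (∈-At (place u)) (∈-At (place v)))
      (cong₂ (multiAdj q) (sym (toℕ-cast len (index (place u)))) (sym (toℕ-cast len (index (place v)))))

turán-no-clique : ∀ q n → ¬ HasClique (turán (suc q) n) (2 + q) (allFin n)
turán-no-clique q n (W , _ , cW , lW) = <⇒≱ (≤-reflexive (sym lW)) (begin
  length W ≡⟨ length-map residue W ⟨
  length (map residue W) ≤⟨ Unique-⊆⇒length≤ (residues-unique cW)
      (λ m → let i , _ , e = ∈-map⁻ residue m in subst (_∈ upTo (suc q)) (sym e) (∈-upTo⁺ (m%n<n (toℕ i) (suc q)))) ⟩
  length (upTo (suc q)) ≡⟨ length-upTo (suc q) ⟩
  suc q ∎)
  where
  open ≤-Reasoning
  residue : Fin n → ℕ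
  residue i = toℕ i % suc q
  residues-unique : ∀ {W} → Clique (turán (suc q) n) W → Unique (map residue W)
  residues-unique [] = []
  residues-unique {x ∷ _} (as ∷ c) = All.map⁺ (All.map (λ {y} a e → case trans (sym a) (multiAdj-false q (toℕ x) (toℕ y) e) of λ ()) as)
    ∷ residues-unique c

turán-SkIs : ∀ q n → SkIs (2 + q) (turán (suc q) n) (2 ^ t (suc q) n)
turán-SkIs q n = bitVectors _ , bitVectors-unique _ ,
  (λ o → (λ _ S (l , u , c) _ → turán-no-clique q n (S , (λ {x} _ → ∈-allFin x) , Clique-intro (turán (suc q) n) u c , l)) ,
         (λ _ → ∈-bitVectors o)) ,
  length-bitVectors (t (suc q) n)

-- The forty good orientations of K₄

module K₄ where
  K₄ : Graph 4
  K₄ = complete 4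

  private
    E = edges K₄
    O = Orientation K₄

  closed-at : O → Vec Bool 4 → Fin (length E) → Bool
  closed-at o X p = if Vec.lookup o p then not (tail X) ∨ head X else not (head X) ∨ tail X
    where
    tail head : Vec Bool 4 → Bool
    tail X = Vec.lookup X (proj₁ (lookup E p))
    head X = Vec.lookup X (proj₂ (lookup E p))

  closed : O → Vec Bool 4 → Bool
  closed o X = all (closed-at o X) (allFin (length E))

  proper : Vec Bool 4 → Bool
  proper X = any (Vec.lookup X) (allFin 4) ∧ any (not ∘ Vec.lookup X) (allFin 4)

  -- A nonempty proper vertex set that no arc leaves certifies that the tournament is not strong. As
  -- a Boolean test it lets the list of orientations and its length be found by evaluation.
  has-cut : O → Bool
  has-cut o = any (λ X → proper X ∧ closed o X) (bitVectors 4)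

  closed-arc : ∀ {o X} → Bool.T (closed o X) → ∀ {u v} → Arc K₄ o u v → Vec.lookup X u ≡ true → Vec.lookup X v ≡ true
  closed-arc {o} {X} c {u} {v} (p , arc) xu = go arc (All.lookup (All.all⁺ (closed-at o X) (allFin (length E)) c) (∈-allFin p))
    where
    go : (lookup E p ≡ (u , v) × Vec.lookup o p ≡ true) ⊎ (lookup E p ≡ (v , u) × Vec.lookup o p ≡ false) →
      Bool.T (closed-at o X p) → Vec.lookup X v ≡ true
    go (inj₁ (e , b)) h with Vec.lookup o p | lookup E p
    go (inj₁ (refl , refl)) h | _ | _ with Vec.lookup X u
    go (inj₁ (refl , refl)) h | _ | _ | true = Equivalence.to T-≡ h
    go (inj₁ (refl , refl)) h | _ | _ | false = contradiction xu λ ()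
    go (inj₂ (e , b)) h with Vec.lookup o p | lookup E p
    go (inj₂ (refl , refl)) h | _ | _ with Vec.lookup X u
    go (inj₂ (refl , refl)) h | _ | _ | true = Equivalence.to T-≡ h
    go (inj₂ (refl , refl)) h | _ | _ | false = contradiction xu λ ()

  closed-path : ∀ {o X S u v} → Bool.T (closed o X) → PathIn K₄ o S u v → Vec.lookup X u ≡ true → Vec.lookup X v ≡ true
  closed-path c here xu = xu
  closed-path {o} {X} c (step a _ p) xu = closed-path {o} {X} c p (closed-arc {o} {X} c a xu)

  has-cut⇒good : ∀ o → Bool.T (has-cut o) → Good K₄ 4 o
  has-cut⇒good o h S (lS , uS , _) strong
    with X , _ , both ← find (any⁻ (λ X → proper X ∧ closed o X) (bitVectors 4) h)
    with pr , cl ← Equivalence.to T-∧ both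
    with in′ , out ← Equivalence.to T-∧ pr
    with u , _ , xu ← find (any⁻ (Vec.lookup X) (allFin 4) in′)
    with v , _ , xv ← find (any⁻ (not ∘ Vec.lookup X) (allFin 4) out) =
    impossible (closed-path {o} {X} cl (strong (everything u) (everything v)) (Equivalence.to T-≡ xu)) xv
    where
    everything : ∀ x → x ∈ S
    everything x = spanning K₄ uS (λ {y} _ → ∈-allFin y) (≤-reflexive (sym lS)) (∈-allFin x)
    impossible : ∀ {b} → b ≡ true → Bool.T (not b) → ⊥
    impossible refl ()

  cut-orientations : List O
  cut-orientations = filterᵇ has-cut (bitVectors 6)

  all-vertices : Clique K₄ (allFin 4)
  all-vertices = (refl ∷ refl ∷ refl ∷ []) ∷ (refl ∷ refl ∷ []) ∷ (refl ∷ []) ∷ [] ∷ []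

  -- The 40 orientations with a cut are good, and by the upper bound there is no room for another one.
  K₄-SkIs : SkIs 4 K₄ 40
  K₄-SkIs = cut-orientations , unique , (λ o → good , full⇒complete K₄ (Bnd-K₄ K₄ all-vertices refl) unique good refl) , refl
    where
    unique : Unique cut-orientations
    unique = Unique.filter⁺ (λ o → T? (has-cut o)) (bitVectors-unique 6)
    good : ∀ {o} → o ∈ cut-orientations → Good K₄ 4 o
    good {o} m = has-cut⇒good o (proj₂ (∈-filter⁻ (λ o → T? (has-cut o)) {xs = bitVectors 6} m))

theorem3p7 : ∀ (n k : ℕ) → 4 ≤ k → k ≤ n →
    ((n ≡ 4 × k ≡ 4) →
    SknIs 4 4 40 × (∀ (G : Graph 4) → SkIs 4 G 40 → G ≅ complete 4))
    × ((5 ≤ n ⊎ 5 ≤ k) →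
    SknIs k n (2 ^ t (k ∸ 1) n)
    × (∀ (G : Graph n) → SkIs k G (2 ^ t (k ∸ 1) n) → G ≅ turán (k ∸ 1) n))
theorem3p7 n k 4≤k k≤n with j , refl ← m≤n⇒∃[o]m+o≡n 4≤k = small , large
  where
  ℓ = suc j
  q = suc ℓ

  small : n ≡ 4 × 4 + j ≡ 4 → SknIs 4 4 40 × (∀ (G : Graph 4) → SkIs 4 G 40 → G ≅ complete 4)
  small _ = (upper , complete 4 , K₄.K₄-SkIs) , unique
    where
    upper : ∀ (G : Graph 4) m → SkIs 4 G m → m ≤ 40
    upper G m s with bounded G 1 ≤-refl 4 (allFin 4) ≤-refl (Unique.allFin⁺ 4)
    ... | inj₁ b = ≤-trans (SkIs⇒≤ G b s) (subst (λ x → 2 ^ x ≤ 40) (sym T₃-4) (≤ᵇ⇒≤ 32 40 _))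
    ... | inj₂ (_ , b) = SkIs⇒≤ G b s
    unique : ∀ (G : Graph 4) → SkIs 4 G 40 → G ≅ complete 4
    -- Four vertices contain no K₅, so Turán's theorem with four parts applies, and its extremal
    -- graph on four vertices is K₄.
    unique G s with turán-bound G 3 4 (allFin 4) ≤-refl (Unique.allFin⁺ 4)
      (λ (W , W⊆ , c , l) → <⇒≱ (≤-reflexive (sym l)) (Unique-⊆⇒length≤ (Clique⇒Unique G c) W⊆))
    -- Five edges allow only 2^5 = 32 < 40 orientations, so all six edges must be present.
    ... | _ , tight with 6 ≤? size (adj G) (allFin 4)
    ...   | yes 6≤ = let vs , π , ordered = tight (≤-trans (≤-reflexive (turánSize-small 3 {4} ≤-refl)) 6≤)
                     in ordered⇒≅ G 3 π ordered
    ...   | no 6≰ = contradiction (≤-trans (SkIs⇒≤ G (Bnd-all G (allFin 4)) s)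
              (^-monoʳ-≤ 2 (s≤s⁻¹ (≰⇒> 6≰)))) (<⇒≱ (≤ᵇ⇒≤ 33 40 _))

  large : 5 ≤ n ⊎ 5 ≤ 4 + j → SknIs (4 + j) n (2 ^ t (suc q) n) × (∀ (G : Graph n) → SkIs (4 + j) G (2 ^ t (suc q) n) → G ≅ turán (suc q) n)
  large hyp = (upper , turán (suc q) n , turán-SkIs q n) , unique
    where
    vs = allFin n
    T≡ : turánSize q (length vs) ≡ t (suc q) n
    T≡ = trans (cong (turánSize q) (length-tabulate id)) (sym (t≡turánSize q n))
    ¬exceptional : ¬ (ℓ ≡ 1 × length vs ≡ 4)
    ¬exceptional (refl , l) = case hyp of λ where
      (inj₁ 5≤n) → <⇒≱ 5≤n (≤-reflexive (trans (sym (length-tabulate id)) l))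
      (inj₂ 5≤4) → <⇒≱ 5≤4 ≤-refl
    upper : ∀ (G : Graph n) m → SkIs (4 + j) G m → m ≤ 2 ^ t (suc q) n
    upper G m s with bounded G ℓ (s≤s z≤n) (length vs) vs ≤-refl (Unique.allFin⁺ n)
    ... | inj₁ b = ≤-trans (SkIs⇒≤ G b s) (≤-reflexive (cong (2 ^_) T≡))
    ... | inj₂ (exc , _) = contradiction exc ¬exceptional
    unique : ∀ (G : Graph n) → SkIs (4 + j) G (2 ^ t (suc q) n) → G ≅ turán (suc q) n
    unique G s with hasClique? G (4 + j) vs
    ... | yes h = let N , N< , b = strictly-bounded G ℓ (s≤s z≤n) vs (λ R _ → bounded G ℓ (s≤s z≤n) (length R) R ≤-refl)
                        (Unique.allFin⁺ n) h ¬exceptional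
                  in contradiction (≤-trans N< (≤-reflexive (cong (2 ^_) T≡))) (≤⇒≯ (SkIs⇒≤ G b s))
    -- With fewer edges than the Turán graph there would be too few orientations altogether, so
    -- equality holds in Turán's theorem.
    ... | no ¬h with turán-bound G q (length vs) vs ≤-refl (Unique.allFin⁺ n) ¬h
    ...   | _ , tight with turánSize q (length vs) ≤? size (adj G) vs
    ...     | yes le = let ws , π , ordered = tight le in ordered⇒≅ G q π ordered
    ...     | no ≰ = contradiction (SkIs⇒≤ G (Bnd-all G vs) s)
                (<⇒≱ (^-monoʳ-< 2 ≤-refl (<-≤-trans (≰⇒> ≰) (≤-reflexive T≡))))
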